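{- \textsc{Imbalance} parameterized by the size of a twin cover is in XP: there is an algorithm that, given a graph $G$ on $n$ vertices (given explicitly, e.g. by adjacency lists or matrix), a twin cover $S\subseteq V(G)$ of $G$ with $|S|=k$, and an integer $t$, decides whether $\mathcal{I}(G)\le t$ in time $f(k)\cdot n^{g(k)}$ for some computable functions $f,g$.
   Context: All graphs are finite, simple and undirected. A layout of $G=(V,E)$ is a linear ordering $\sigma$ of $V$; for $v\in V$, $N_L(v,\sigma)$ (resp. $N_R(v,\sigma)$) is the set of neighbours of $v$ preceding (resp. following) $v$ in $\sigma$. The imbalance of $v$ is $\mathcal{I}(v,\sigma)=\big||N_L(v,\sigma)|-|N_R(v,\sigma)|\big|$, $\mathcal{I}(\sigma)=\sum_{v}\mathcal{I}(v,\sigma)$, and $\mathcal{I}(G)=\min_\sigma\mathcal{I}(\sigma)$ over all layouts. A twin cover of $G$ is a set $S\subseteq V$ such that every connected component $X$ of $G-S$ is a set of true twins in $G$ ($N[u]=N[v]$ for all $u,v\in X$). -}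

module Defs where

open import Data.Bool using (Bool; true; false)
open import Data.Fin using (Fin; zero; suc; punchIn; _<?_)
open import Data.Fin.Permutation using (Permutation′; _⟨$⟩ʳ_; _≈_; id; insert; remove; insert-remove)
open import Data.Fin.Subset using (Subset; _∈_; _∉_; _∩_; _∪_; ⁅_⁆; ∣_∣)
open import Data.Integer using (ℤ; +_; -[1+_])
open import Data.List using (List; [_]; cartesianProductWith; allFin)
import Data.List.Extrema
open import Data.List.Membership.Propositional using () renaming (_∈_ to _∈ˡ_)
open import Data.List.Membership.Propositional.Properties using (∈-cartesianProductWith⁺; ∈-allFin)
open import Data.List.Relation.Unary.Any using (here)
import Data.List.Relation.Unary.All as All
open import Data.Nat using (ℕ; zero; suc; _+_; _≤_; ∣_-_∣)
open import Data.Nat.Binary using (ℕᵇ; zero; 2[1+_]; 1+[2_]; fromℕ)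
open import Data.Nat.Properties using (+-0-commutativeMonoid; ≤-totalOrder; ≤-trans; ≤-reflexive)
open import Algebra.Properties.CommutativeMonoid.Sum +-0-commutativeMonoid using (sum; sum-cong-≗)
open import Data.Product using (Σ-syntax; ∃-syntax; _×_; _,_)
open import Data.Vec using (Vec; []; _∷_; lookup; tabulate)
open import Data.Vec.Properties using (tabulate-cong)
open import Level using (0ℓ)
open import Relation.Binary.Construct.Closure.ReflexiveTransitive using (Star)
open import Relation.Binary.PropositionalEquality using (_≡_; refl; trans; cong; cong₂)
open import Relation.Nullary using (does)
open import Relation.Unary using (Pred; _≐_) renaming (_∈_ to _∈ᵖ_)

open Data.List.Extrema ≤-totalOrder using (argmin; f[argmin]≤f[xs])

record Graph (n : ℕ) : Set where
  field
    N           : Fin n → Subset n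
    symmetric   : ∀ {u v} → u ∈ N v → v ∈ N u
    irreflexive : ∀ {v} → v ∉ N v

-- σ ⟨$⟩ʳ v is the position of the vertex v.
Layout : ℕ → Set
Layout = Permutation′

module _ {n : ℕ} (G : Graph n) where
  open Graph G

  N[_] : Fin n → Subset n
  N[ v ] = N v ∪ ⁅ v ⁆

  N-L N-R : Fin n → Layout n → Subset n
  N-L v σ = N v ∩ tabulate (λ u → does (σ ⟨$⟩ʳ u <? σ ⟨$⟩ʳ v))
  N-R v σ = N v ∩ tabulate (λ u → does (σ ⟨$⟩ʳ v <? σ ⟨$⟩ʳ u))

  vertexImbalance : Fin n → Layout n → ℕ
  vertexImbalance v σ = ∣ ∣ N-L v σ ∣ - ∣ N-R v σ ∣ ∣

  layoutImbalance : Layout n → ℕ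
  layoutImbalance σ = sum (λ v → vertexImbalance v σ)

-- Permutations carry proofs, so the list is complete only up to _≈_.
layouts : ∀ n → List (Layout n)
layouts zero    = [ id ]
layouts (suc n) = cartesianProductWith (insert zero) (allFin (suc n)) (layouts n)

imbalance : ∀ {n} → Graph n → ℕ
imbalance {n} G = layoutImbalance G (argmin (layoutImbalance G) id (layouts n))

private
  insert-cong : ∀ {n} (j : Fin (suc n)) {π ρ : Layout n} →
                π ≈ ρ → insert zero j π ≈ insert zero j ρ
  insert-cong j π≈ρ zero    = refl
  insert-cong j π≈ρ (suc k) = cong (punchIn j) (π≈ρ k)

layouts-complete : ∀ {n} (σ : Layout n) → ∃[ τ ] τ ∈ˡ layouts n × τ ≈ σ
layouts-complete {zero}  σ = id , here refl , λ ()
layouts-complete {suc n} σ with layouts-complete (remove zero σ)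
... | τ , τ∈ , τ≈ = insert zero (σ ⟨$⟩ʳ zero) τ
                  , ∈-cartesianProductWith⁺ (insert zero) (∈-allFin (σ ⟨$⟩ʳ zero)) τ∈
                  , λ i → trans
                            (insert-cong (σ ⟨$⟩ʳ zero) {τ} {remove zero σ} τ≈ i)
                            (insert-remove zero σ i)

layoutImbalance-cong : ∀ {n} (G : Graph n) {σ τ : Layout n} →
                       σ ≈ τ → layoutImbalance G σ ≡ layoutImbalance G τ
layoutImbalance-cong G σ≈τ = sum-cong-≗ λ v → cong₂ (λ L R → ∣ ∣ L ∣ - ∣ R ∣ ∣)
  (cong (Graph.N G v ∩_) (tabulate-cong λ u → cong₂ (λ i j → does (i <? j)) (σ≈τ u) (σ≈τ v)))
  (cong (Graph.N G v ∩_) (tabulate-cong λ u → cong₂ (λ i j → does (i <? j)) (σ≈τ v) (σ≈τ u)))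

-- Together with the definition, which exhibits a layout attaining the value,
-- this makes `imbalance G` the minimum over all layouts.
imbalance-minimal : ∀ {n} (G : Graph n) (σ : Layout n) → imbalance G ≤ layoutImbalance G σ
imbalance-minimal {n} G σ with layouts-complete σ
... | τ , τ∈ , τ≈σ = ≤-trans
  (All.lookup (f[argmin]≤f[xs] {f = layoutImbalance G} id (layouts n)) τ∈)
  (≤-reflexive (layoutImbalance-cong G {τ} {σ} τ≈σ))

module _ {n : ℕ} (G : Graph n) (S : Subset n) where
  open Graph G

  EdgeOutside : Fin n → Fin n → Set
  EdgeOutside u v = u ∉ S × v ∉ S × v ∈ N u

  ComponentOutside : Pred (Fin n) 0ℓ → Set
  ComponentOutside X = ∃[ u ] u ∉ S × X ≐ Star EdgeOutside u

  IsTwinCover : Set₁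
  IsTwinCover = ∀ X → ComponentOutside X →
                ∀ {u v} → u ∈ᵖ X → v ∈ᵖ X → N[_] G u ≡ N[_] G v

-- A first-order call-by-value language over binary trees.  A step only builds
-- or inspects one node, copies a pointer, or passes a number of arguments fixed
-- by the program, so it takes constant time on a pointer machine, and the cost
-- is polynomially related to the running time of a Turing machine.

data Tree : Set where
  nil  : Tree
  node : Tree → Tree → Tree

data Expr {m : ℕ} (arity : Fin m → ℕ) (n : ℕ) : Set where
  var  : Fin n → Expr arity n
  nil  : Expr arity n
  node : (a b : Expr arity n) → Expr arity n
  bind : (a : Expr arity n) (b : Expr arity (suc n)) → Expr arity n
  case : (a : Expr arity n) (b : Expr arity n) (c : Expr arity (suc (suc n))) → Expr arity n
  call : (f : Fin m) → Vec (Expr arity n) (arity f) → Expr arity n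

record Program (inputs : ℕ) : Set where
  field
    #functions : ℕ
    arity      : Fin #functions → ℕ
    body       : (f : Fin #functions) → Expr arity (arity f)
    main       : Expr arity inputs

module Semantics {m : ℕ} {arity : Fin m → ℕ} (body : (f : Fin m) → Expr arity (arity f)) where

  infix 4 _⊢_⇓_cost_ _⊢*_⇓_cost_

  mutual
    data _⊢_⇓_cost_ {n : ℕ} (ρ : Vec Tree n) : Expr arity n → Tree → ℕ → Set where
      var       : ∀ {i} → ρ ⊢ var i ⇓ lookup ρ i cost 1
      nil       : ρ ⊢ nil ⇓ nil cost 1
      node      : ∀ {a b x y s t} →
                  ρ ⊢ a ⇓ x cost s → ρ ⊢ b ⇓ y cost t →
                  ρ ⊢ node a b ⇓ node x y cost suc (s + t)
      bind      : ∀ {a b x y s t} →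
                  ρ ⊢ a ⇓ x cost s → x ∷ ρ ⊢ b ⇓ y cost t →
                  ρ ⊢ bind a b ⇓ y cost suc (s + t)
      case-nil  : ∀ {a b c x s t} →
                  ρ ⊢ a ⇓ nil cost s → ρ ⊢ b ⇓ x cost t →
                  ρ ⊢ case a b c ⇓ x cost suc (s + t)
      case-node : ∀ {a b c x y z s t} →
                  ρ ⊢ a ⇓ node x y cost s → x ∷ y ∷ ρ ⊢ c ⇓ z cost t →
                  ρ ⊢ case a b c ⇓ z cost suc (s + t)
      call      : ∀ {f as xs y s t} →
                  ρ ⊢* as ⇓ xs cost s → xs ⊢ body f ⇓ y cost t →
                  ρ ⊢ call f as ⇓ y cost suc (s + t)

    data _⊢*_⇓_cost_ {n : ℕ} (ρ : Vec Tree n) :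
                     ∀ {l} → Vec (Expr arity n) l → Vec Tree l → ℕ → Set where
      []  : ρ ⊢* [] ⇓ [] cost 0
      _∷_ : ∀ {l a x s t} {as : Vec (Expr arity n) l} {xs} →
            ρ ⊢ a ⇓ x cost s → ρ ⊢* as ⇓ xs cost t →
            ρ ⊢* a ∷ as ⇓ x ∷ xs cost (s + t)

  mutual
    deterministic : ∀ {n} {ρ : Vec Tree n} {e x y s t} →
                    ρ ⊢ e ⇓ x cost s → ρ ⊢ e ⇓ y cost t → x ≡ y × s ≡ t
    deterministic var var = refl , refl
    deterministic nil nil = refl , refl
    deterministic (node p q) (node p′ q′) with deterministic p p′ | deterministic q q′
    ... | refl , refl | refl , refl = refl , refl
    deterministic (bind p q) (bind p′ q′) with deterministic p p′
    ... | refl , refl with deterministic q q′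
    ...   | refl , refl = refl , refl
    deterministic (case-nil p q) (case-nil p′ q′) with deterministic p p′ | deterministic q q′
    ... | refl , refl | refl , refl = refl , refl
    deterministic (case-nil p q) (case-node p′ q′) with deterministic p p′
    ... | () , _
    deterministic (case-node p q) (case-nil p′ q′) with deterministic p p′
    ... | () , _
    deterministic (case-node p q) (case-node p′ q′) with deterministic p p′
    ... | refl , refl with deterministic q q′
    ...   | refl , refl = refl , refl
    deterministic (call p q) (call p′ q′) with deterministic* p p′
    ... | refl , refl with deterministic q q′
    ...   | refl , refl = refl , refl

    deterministic* : ∀ {n l} {ρ : Vec Tree n} {as : Vec (Expr arity n) l} {xs ys s t} →
                     ρ ⊢* as ⇓ xs cost s → ρ ⊢* as ⇓ ys cost t → xs ≡ ys × s ≡ t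
    deterministic* []      []        = refl , refl
    deterministic* (p ∷ q) (p′ ∷ q′) with deterministic p p′ | deterministic* q q′
    ... | refl , refl | refl , refl = refl , refl

_on_returns_inTime_ : ∀ {i} → Program i → Vec Tree i → Tree → ℕ → Set
P on xs returns y inTime t = xs ⊢ Program.main P ⇓ y cost t
  where open Semantics (Program.body P)

_on_returns_within_ : ∀ {i} → Program i → Vec Tree i → Tree → ℕ → Set
P on xs returns y within T = ∃[ t ] t ≤ T × P on xs returns y inTime t

encodeBool : Bool → Tree
encodeBool false = nil
encodeBool true  = node nil nil

encodeVec : ∀ {A : Set} {n} → (A → Tree) → Vec A n → Tree
encodeVec enc []       = nil
encodeVec enc (x ∷ xs) = node (enc x) (encodeVec enc xs)

encodeUnary : ℕ → Tree
encodeUnary zero    = nil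
encodeUnary (suc n) = node nil (encodeUnary n)

-- Bijective base 2, least significant digit first.
encodeBinary : ℕᵇ → Tree
encodeBinary zero     = nil
encodeBinary 1+[2 b ] = node (encodeBool false) (encodeBinary b)
encodeBinary 2[1+ b ] = node (encodeBool true)  (encodeBinary b)

encodeℤ : ℤ → Tree
encodeℤ (+ n)    = node (encodeBool false) (encodeBinary (fromℕ n))
encodeℤ -[1+ n ] = node (encodeBool true)  (encodeBinary (fromℕ n))

encodeSubset : ∀ {n} → Subset n → Tree
encodeSubset = encodeVec encodeBool

-- The rows of the adjacency matrix.
encodeGraph : ∀ {n} → Graph n → Tree
encodeGraph G = encodeVec encodeSubset (tabulate (Graph.N G))

Computable : (ℕ → ℕ) → Set
Computable f = Σ[ P ∈ Program 1 ] ∀ k →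
  ∃[ t ] P on (encodeUnary k ∷ []) returns encodeUnary (f k) inTime t

-- Fix the order of the cover S.  Outside S only twins are adjacent, so the twin classes interact with each
-- other only through S, and permuting twins is an automorphism: we may assume that the members of a class
-- appear in the order of their indices.  A layout is then described, for every class, by the index at which
-- the class passes each vertex of S, which is one of (n+1)^k guesses.  A dynamic program over the classes
-- computes the reachable vectors consisting of the cost spent outside S and, for each s ∈ S, the number
-- of vertices outside S to its left; there are at most (n²+1)^(k+1) of them.  Conversely, any guess of keys
-- for S and of passing indices is realized by sorting the vertices by their keys, even if keys repeat.
--
-- The program is an interpreter applied to the code of this algorithm.  Codes are built from combinators
-- that carry their running times; a fold runs in polynomial time if its intermediate results stay small.
module Submission where

open import Defs
open import Data.Bool using (Bool; true; false; _∧_; _∨_; not; if_then_else_; T)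
open import Data.Bool.ListAction using (any)
open import Data.Bool.Properties using (T-∧; T-∨; ∧-zeroʳ)
open import Data.Empty using (⊥-elim)
open import Data.Fin using (Fin; zero; suc; #_; toℕ; fromℕ<; punchOut) renaming (_<?_ to _<?ᶠ_)
open import Data.Fin.Permutation using (Permutation′; _⟨$⟩ʳ_; _⟨$⟩ˡ_; _∘ₚ_; permutation; transpose; inverseˡ)
open import Data.Fin.Properties using (_≟_; any?; toℕ<n; toℕ≤n; toℕ-injective; toℕ-fromℕ<; punchOut-injective; injective⇒≤)
open import Data.Fin.Subset using (Subset; ∣_∣; _∈_; _∩_; ⁅_⁆)
open import Data.Fin.Subset.Properties using (x∈p∪q⁻; x∈p∪q⁺; x∈⁅y⁆⇒x≡y)
open import Data.Integer using (ℤ; +_; -[1+_]; _≤?_; +≤+)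
open import Data.Integer.Properties using (drop‿+≤+)
open import Data.List using (List; []; _∷_; [_]; _++_; length; concatMap; cartesianProductWith; filterᵇ; applyUpTo; upTo)
import Data.List.Extrema
open import Data.List.Membership.Propositional using () renaming (_∈_ to _∈ˡ_)
open import Data.List.Membership.Propositional.Properties using (∈-upTo⁺; ∈-upTo⁻; ∈-cartesianProductWith⁺)
open import Data.List.Properties using (++-identityʳ; ++-assoc; length-++; length-map; length-upTo)
open import Data.List.Relation.Unary.All as All using (All; []; _∷_)
open import Data.List.Relation.Unary.All.Properties using (cartesianProductWith⁺)
open import Data.List.Relation.Unary.Any using (here; there)
open import Data.Nat using (ℕ; zero; suc; _+_; _*_; _∸_; _^_; _⊔_; _⊓_; _≤_; _<_; _≤ᵇ_; _<ᵇ_; _<?_; ∣_-_∣; z≤n; s≤s)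
open import Data.Nat.Binary using (ℕᵇ; zero; 2[1+_]; 1+[2_]; fromℕ) renaming (toℕ to toℕᵇ)
open import Data.Nat.Binary.Properties using (toℕ-fromℕ)
open import Data.Nat.Properties hiding (_≟_; _≤?_; _<?_)
open import Data.Nat.Tactic.RingSolver using (solve-∀)
open import Data.Product using (Σ-syntax; ∃-syntax; _×_; _,_; proj₁; proj₂)
open import Data.Sum using (_⊎_; inj₁; inj₂)
open import Data.Unit using (tt)
open import Data.Vec using (Vec; []; _∷_; lookup; tabulate; map)
open import Data.Vec.Properties using (lookup-zipWith; lookup∘tabulate; tabulate∘lookup; []=⇒lookup; lookup⇒[]=)
open import Function using (_∘_; id; Equivalence)
open import Relation.Binary using (tri<; tri≈; tri>)
open import Relation.Binary.Construct.Closure.ReflexiveTransitive using (Star; ε; _◅_)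
open import Relation.Binary.PropositionalEquality using (_≡_; _≢_; refl; sym; trans; subst; subst₂; cong; cong₂; setoid; module ≡-Reasoning)
open import Relation.Nullary using (¬_; Dec; yes; no; does; contradiction)
open import Relation.Nullary.Decidable using (_×-dec_; ¬?; T?)
open import Algebra.Properties.CommutativeMonoid.Sum +-0-commutativeMonoid using (sum; sum-cong-≗; ∑-distrib-+; ∑-comm; ∑-permute)
open Data.List.Extrema ≤-totalOrder using (argmin)

-- An interpreter for a combinator language

-- The language has no higher-order functions and each program fixes its function table, so gluing
-- programs together would mean renumbering calls and variables. With one fixed interpreter
-- algorithms are trees, composition is tree building, and every combinator adds a bounded overhead.
-- Running times compose only together with output sizes, and a fold can iterate a size-doubling
-- step; this is why folds carry bounds on their intermediate results. Two parts need a measure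
-- other than the input size. The list of candidate states is exponential in k: its construction is
-- measured by `scale`, and whatever consumes the list is polynomial in the list. The integer t is
-- not bounded by n and k: since the imbalance is at most n², t can be capped at n², and n² of its
-- digits suffice for this. On the combinatorial side the imbalance depends only on the order of
-- adjacent vertices, so the search never decides how two classes interleave.

foldTree : (Tree → Tree → Tree) → Tree → Tree → Tree
foldTree f z nil        = z
foldTree f z (node h t) = f h (foldTree f z t)

headTree tailTree : Tree → Tree
headTree nil        = nil
headTree (node x y) = x
tailTree nil        = nil
tailTree (node x y) = y

ifTree : Tree → Tree → Tree → Tree
ifTree nil        a b = b
ifTree (node _ _) a b = a

interpreterArity : Fin 2 → ℕ
interpreterArity zero       = 2
interpreterArity (suc zero) = 4

evalCall : ∀ {n} → (code env : Expr interpreterArity n) → Expr interpreterArity n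
evalCall c e = call zero (c ∷ e ∷ [])

foldCall : ∀ {n} → (step base list env : Expr interpreterArity n) → Expr interpreterArity n
foldCall f z l e = call (suc zero) (f ∷ z ∷ l ∷ e ∷ [])

nilCode headCode tailCode : Tree
nilCode  = nil
headCode = node (encodeUnary 0) nil
tailCode = node (encodeUnary 1) nil

nodeCode composeCode : Tree → Tree → Tree
nodeCode    f g = node (encodeUnary 2) (node f g)
composeCode f g = node (encodeUnary 3) (node f g)

ifCode foldCode : Tree → Tree → Tree → Tree
ifCode   c f g = node (encodeUnary 4) (node c (node f g))
foldCode l z f = node (encodeUnary 5) (node l (node z f))

-- The tag is inspected one digit at a time; every test adds two variables.
interpreterBody : (f : Fin 2) → Expr interpreterArity (interpreterArity f)
interpreterBody zero =
  case (var (# 0)) nil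
  (case (var (# 0)) (case (var (# 3)) nil (var (# 0)))
  (case (var (# 1)) (case (var (# 5)) nil (var (# 1)))
  (case (var (# 1)) (case (var (# 5)) nil
      (node (evalCall (var (# 0)) (var (# 9))) (evalCall (var (# 1)) (var (# 9)))))
  (case (var (# 1)) (case (var (# 7)) nil
      (evalCall (var (# 0)) (evalCall (var (# 1)) (var (# 11)))))
  (case (var (# 1)) (case (var (# 9)) nil (case (var (# 1)) nil
      (case (evalCall (var (# 2)) (var (# 15)))
        (evalCall (var (# 1)) (var (# 15)))
        (evalCall (var (# 2)) (var (# 17))))))
  (case (var (# 11)) nil (case (var (# 1)) nil
      (foldCall (var (# 1)) (evalCall (var (# 0)) (var (# 17)))
        (evalCall (var (# 2)) (var (# 17))) (var (# 17))))))))))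
interpreterBody (suc zero) =
  case (var (# 2)) (var (# 1))
    (evalCall (var (# 2))
      (node (var (# 0)) (node (foldCall (var (# 2)) (var (# 3)) (var (# 1)) (var (# 5))) (var (# 5)))))

open Semantics interpreterBody

infix 4 ⟨_,_⟩⇓_within_

⟨_,_⟩⇓_within_ : Tree → Tree → Tree → ℕ → Set
⟨ c , e ⟩⇓ x within T = ∃[ t ] t ≤ T × (c ∷ e ∷ [] ⊢ interpreterBody zero ⇓ x cost t)

-- Interpreting one combinator costs at most 25 steps beyond its subevaluations, the maximum
-- occurring for a fold; 40 is a common upper bound.
eval-nil : ∀ {e} → ⟨ nilCode , e ⟩⇓ nil within 40
eval-nil = _ , ≤ᵇ⇒≤ _ 40 _ , case-nil var nil

eval-head : ∀ {e} → ⟨ headCode , e ⟩⇓ headTree e within 40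
eval-head {nil}      = _ , ≤ᵇ⇒≤ _ 40 _ , case-node var (case-nil var (case-nil var nil))
eval-head {node _ _} = _ , ≤ᵇ⇒≤ _ 40 _ , case-node var (case-nil var (case-node var var))

eval-tail : ∀ {e} → ⟨ tailCode , e ⟩⇓ tailTree e within 40
eval-tail {nil}      = _ , ≤ᵇ⇒≤ _ 40 _ ,
  case-node var (case-node var (case-nil var (case-nil var nil)))
eval-tail {node _ _} = _ , ≤ᵇ⇒≤ _ 40 _ ,
  case-node var (case-node var (case-nil var (case-node var var)))

eval-node : ∀ {f g e x y S T} → ⟨ f , e ⟩⇓ x within S → ⟨ g , e ⟩⇓ y within T →
            ⟨ nodeCode f g , e ⟩⇓ node x y within 40 + (S + T)
eval-node (s , s≤ , d) (t , t≤ , d′) = _ , bound 11 3 3 _ s≤ t≤ ,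
  case-node var (case-node var (case-node var (case-nil var
    (case-node var (node (call (var ∷ var ∷ []) d) (call (var ∷ var ∷ []) d′))))))
  where
  bound : ∀ m i j {s S t U} → T (m + (i + j) ≤ᵇ 40) → s ≤ S → t ≤ U → m + ((i + s) + (j + t)) ≤ 40 + (S + U)
  bound m i j {s} {S} {t} {U} h s≤ t≤ = ≤-trans (≤-reflexive (eq m i j s t))
     (+-mono-≤ (≤ᵇ⇒≤ (m + (i + j)) 40 h) (+-mono-≤ s≤ t≤))
   where eq : ∀ m i j s t → m + ((i + s) + (j + t)) ≡ (m + (i + j)) + (s + t)
         eq = solve-∀

eval-compose : ∀ {f g e x y S T} → ⟨ g , e ⟩⇓ x within S → ⟨ f , x ⟩⇓ y within T →
               ⟨ composeCode f g , e ⟩⇓ y within 40 + (S + T)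
eval-compose (s , s≤ , d) (t , t≤ , d′) = _ , bound s t s≤ t≤ ,
  case-node var (case-node var (case-node var (case-node var (case-nil var
    (case-node var (call (var ∷ call (var ∷ var ∷ []) d ∷ []) d′))))))
  where
  eq : ∀ s t → 12 + (2 + ((3 + s + 0) + t)) ≡ 17 + (s + t)
  eq = solve-∀
  bound : ∀ s t {S T} → s ≤ S → t ≤ T → 12 + (2 + ((3 + s + 0) + t)) ≤ 40 + (S + T)
  bound s t s≤ t≤ = ≤-trans (≤-reflexive (eq s t)) (+-mono-≤ (≤ᵇ⇒≤ 17 40 _) (+-mono-≤ s≤ t≤))

-- Both branches are charged although one is run, so the bound does not depend on the outcome of the
-- test.
eval-if : ∀ {c f g e x y z S T U} →
          ⟨ c , e ⟩⇓ x within S → ⟨ f , e ⟩⇓ y within T → ⟨ g , e ⟩⇓ z within U →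
          ⟨ ifCode c f g , e ⟩⇓ ifTree x y z within 40 + (S + (T + U))
eval-if {x = node _ _} {T = T} (s , s≤ , d) (t , t≤ , d′) _ = _ , bound s t s≤ t≤ ,
  case-node var (case-node var (case-node var (case-node var (case-node var (case-nil var
    (case-node var (case-node var
      (case-node (call (var ∷ var ∷ []) d) (call (var ∷ var ∷ []) d′)))))))))
  where
  eq : ∀ s t → 16 + (1 + ((3 + s) + (3 + t))) ≡ 23 + (s + t)
  eq = solve-∀
  bound : ∀ s t {S T U} → s ≤ S → t ≤ T → 16 + (1 + ((3 + s) + (3 + t))) ≤ 40 + (S + (T + U))
  bound s t {U = U} s≤ t≤ = ≤-trans (≤-reflexive (eq s t))
    (+-mono-≤ (≤ᵇ⇒≤ 23 40 _) (+-mono-≤ s≤ (≤-trans t≤ (m≤m+n _ U))))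
eval-if {x = nil} {T = T} (s , s≤ , d) _ (t , t≤ , d′) = _ , bound s t s≤ t≤ ,
  case-node var (case-node var (case-node var (case-node var (case-node var (case-nil var
    (case-node var (case-node var
      (case-nil (call (var ∷ var ∷ []) d) (call (var ∷ var ∷ []) d′)))))))))
  where
  eq : ∀ s t → 16 + (1 + ((3 + s) + (3 + t))) ≡ 23 + (s + t)
  eq = solve-∀
  bound : ∀ s t {S T U} → s ≤ S → t ≤ U → 16 + (1 + ((3 + s) + (3 + t))) ≤ 40 + (S + (T + U))
  bound s t {T = T} s≤ t≤ = ≤-trans (≤-reflexive (eq s t))
    (+-mono-≤ (≤ᵇ⇒≤ 23 40 _) (+-mono-≤ s≤ (≤-trans t≤ (m≤n+m _ T))))

-- Each step is charged at the accumulator that it really receives; 20 covers the 13 steps that the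
-- loop itself spends per element.
foldTime : (Tree → Tree → Tree) → Tree → (Tree → Tree → ℕ) → Tree → ℕ
foldTime f z T nil        = 20
foldTime f z T (node h t) = 20 + (T h (foldTree f z t) + foldTime f z T t)

run-fold : ∀ {c e z} (f : Tree → Tree → Tree) (T : Tree → Tree → ℕ) →
           (∀ h r → ⟨ c , node h (node r e) ⟩⇓ f h r within T h r) →
           ∀ l → ∃[ t ] t ≤ foldTime f z T l ×
             (c ∷ z ∷ l ∷ e ∷ [] ⊢ interpreterBody (suc zero) ⇓ foldTree f z l cost t)
run-fold f T step nil = _ , ≤ᵇ⇒≤ _ 20 _ , case-nil var var
run-fold {z = z} f T step (node h t) with step h (foldTree f z t) | run-fold {z = z} f T step t
... | s , s≤ , d | u , u≤ , d′ = _ , bound s u s≤ u≤ ,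
  case-node var (call (var ∷ node var (node (call (var ∷ var ∷ var ∷ var ∷ []) d′) var) ∷ []) d)
  where
  eq : ∀ s u → 3 + (1 + (2 + (1 + ((5 + u) + 1)) + 0) + s) ≡ 13 + (s + u)
  eq = solve-∀
  bound : ∀ s u {S U} → s ≤ S → u ≤ U → 3 + (1 + (2 + (1 + ((5 + u) + 1)) + 0) + s) ≤ 20 + (S + U)
  bound s u s≤ u≤ = ≤-trans (≤-reflexive (eq s u)) (+-mono-≤ (≤ᵇ⇒≤ 13 20 _) (+-mono-≤ s≤ u≤))

eval-fold : ∀ {c cl cz e l z S U} (f : Tree → Tree → Tree) (T : Tree → Tree → ℕ) →
            ⟨ cl , e ⟩⇓ l within S → ⟨ cz , e ⟩⇓ z within U →
            (∀ h r → ⟨ c , node h (node r e) ⟩⇓ f h r within T h r) →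
            ⟨ foldCode cl cz c , e ⟩⇓ foldTree f z l within 40 + (S + (U + foldTime f z T l))
eval-fold {l = l} {z = z} f T (s , s≤ , d) (u , u≤ , d′) step with run-fold {z = z} f T step l
... | t , t≤ , d″ = _ , bound s u t s≤ u≤ t≤ ,
  case-node var (case-node var (case-node var (case-node var (case-node var (case-node var
    (case-node var (case-node var
      (call (var ∷ call (var ∷ var ∷ []) d′ ∷ call (var ∷ var ∷ []) d ∷ var ∷ []) d″))))))))
  where
  eq : ∀ s u t → 16 + (1 + ((1 + ((3 + u) + ((3 + s) + 1))) + t)) ≡ 25 + (s + (u + t))
  eq = solve-∀
  bound : ∀ s u t {S U T} → s ≤ S → u ≤ U → t ≤ T →
          16 + (1 + ((1 + ((3 + u) + ((3 + s) + 1))) + t)) ≤ 40 + (S + (U + T))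
  bound s u t s≤ u≤ t≤ = ≤-trans (≤-reflexive (eq s u t))
    (+-mono-≤ (≤ᵇ⇒≤ 25 40 _) (+-mono-≤ s≤ (+-mono-≤ u≤ t≤)))

-- The point where code becomes program text: `main` rebuilds the code as a value, at a cost that
-- depends on the code alone.
quoteTree : Tree → ∀ {n} → Expr interpreterArity n
quoteTree nil        = nil
quoteTree (node x y) = node (quoteTree x) (quoteTree y)

size : Tree → ℕ
size nil        = 0
size (node x y) = suc (size x + size y)

run-quote : ∀ c {n} {ρ : Vec Tree n} → ρ ⊢ quoteTree c ⇓ c cost suc (size c + size c)
run-quote nil        = nil
run-quote (node x y) {ρ = ρ} = subst (ρ ⊢ quoteTree (node x y) ⇓ node x y cost_) (eq (size x) (size y)) (node (run-quote x) (run-quote y))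
  where
  eq : ∀ a b → 1 + ((1 + (a + a)) + (1 + (b + b))) ≡ 1 + ((1 + (a + b)) + (1 + (a + b)))
  eq = solve-∀

environment : ∀ {n} → Vec Tree n → Tree
environment = encodeVec (λ x → x)

variables : ∀ {n m} → (Fin n → Fin m) → Expr interpreterArity m
variables {zero}  f = nil
variables {suc n} f = node (var (f zero)) (variables (λ i → f (suc i)))

run-variables : ∀ {m} (ρ : Vec Tree m) {n} (f : Fin n → Fin m) →
  ∃[ t ] t ≤ suc (n + n) × (ρ ⊢ variables f ⇓ environment (tabulate (λ i → lookup ρ (f i))) cost t)
run-variables ρ {zero}  f = _ , ≤-refl , nil
run-variables ρ {suc n} f with run-variables ρ (λ i → f (suc i))
... | t , t≤ , d = _ , s≤s (s≤s (≤-trans t≤ (≤-reflexive (sym (+-suc n n))))) , node var d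

interpreterProgram : ∀ {n} → Tree → Program n
interpreterProgram c = record
  { #functions = 2
  ; arity      = interpreterArity
  ; body       = interpreterBody
  ; main       = evalCall (quoteTree c) (variables (λ i → i))
  }

run-interpreter : ∀ {n c x T} (ρ : Vec Tree n) → ⟨ c , environment ρ ⟩⇓ x within T →
                  interpreterProgram c on ρ returns x within (3 + (size c + size c) + (n + n) + T)
run-interpreter {n} {c} {x} ρ (t , t≤ , d) with run-variables ρ (λ i → i)
... | s , s≤ , e rewrite tabulate∘lookup ρ =
  _ , bound (size c) s t s≤ t≤ , call (run-quote c ∷ e ∷ []) d
  where
  eq : ∀ a s t → 1 + ((1 + (a + a) + (s + 0)) + t) ≡ 2 + (a + a) + s + t
  eq = solve-∀
  bound : ∀ a s t {N T} → s ≤ suc N → t ≤ T → suc ((suc (a + a) + (s + 0)) + t) ≤ 3 + (a + a) + N + T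
  bound a s t {N} s≤ t≤ = ≤-trans (≤-reflexive (eq a s t))
    (+-mono-≤ (≤-trans (+-monoʳ-≤ (2 + (a + a)) s≤) (≤-reflexive (+-suc (2 + (a + a)) N))) t≤)

-- Polynomial bounds

infix 4 _≼_

-- Polynomial growth with a single exponent. The base is at least 2, so constants and sums are
-- absorbed by raising the exponent and no coefficients are carried along.
_≼_ : {X : Set} → (X → ℕ) → (X → ℕ) → Set
T ≼ μ = ∃[ c ] ∀ x → T x ≤ (2 + μ x) ^ c

module _ {X : Set} {μ : X → ℕ} where

  1≤base^ : ∀ c x → 1 ≤ (2 + μ x) ^ c
  1≤base^ c x = m^n>0 (2 + μ x) c

  ≼-refl : μ ≼ μ
  ≼-refl = 1 , λ x → ≤-trans (m≤n+m (μ x) 2) (≤-reflexive (sym (*-identityʳ _)))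

  ≼-const : ∀ k → (λ _ → k) ≼ μ
  ≼-const k = k , λ x → ≤-trans (<⇒≤ (n<2^n k)) (^-monoˡ-≤ k (m≤m+n 2 (μ x)))
    where
    n<2^n : ∀ k → k Data.Nat.< 2 ^ k
    n<2^n zero    = s≤s z≤n
    n<2^n (suc k) = ≤-trans (≤-reflexive (+-comm 1 (suc k)))
      (≤-trans (+-mono-≤ (n<2^n k) (m^n>0 2 k)) (≤-reflexive (cong (_+_ (2 ^ k)) (sym (+-identityʳ _)))))

  ≼-≤ : {T U : X → ℕ} → (∀ x → T x ≤ U x) → U ≼ μ → T ≼ μ
  ≼-≤ T≤U (c , b) = c , λ x → ≤-trans (T≤U x) (b x)

  ≼-* : {T U : X → ℕ} → T ≼ μ → U ≼ μ → (λ x → T x * U x) ≼ μ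
  ≼-* (c , b) (d , b′) = c + d , λ x →
    ≤-trans (*-mono-≤ (b x) (b′ x)) (≤-reflexive (sym (^-distribˡ-+-* (2 + μ x) c d)))

  -- Both powers are at least 1, so y + z ≤ 2yz, and the factor 2 costs one more power of the base.
  ≼-+ : {T U : X → ℕ} → T ≼ μ → U ≼ μ → (λ x → T x + U x) ≼ μ
  ≼-+ {T} {U} (c , b) (d , b′) = 1 + (c + d) , λ x →
    let y = (2 + μ x) ^ c ; z = (2 + μ x) ^ d in
    begin
      T x + U x                        ≤⟨ +-mono-≤ (b x) (b′ x) ⟩
      y + z                            ≡⟨ cong (_+ z) (sym (*-identityʳ y)) ⟩
      y * 1 + z                        ≤⟨ +-monoˡ-≤ z (*-monoʳ-≤ y (1≤base^ d x)) ⟩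
      y * z + z                        ≡⟨ cong (_+_ (y * z)) (sym (*-identityˡ z)) ⟩
      y * z + 1 * z                    ≤⟨ +-monoʳ-≤ (y * z) (*-monoˡ-≤ z (1≤base^ c x)) ⟩
      y * z + y * z                    ≡⟨ cong (_+_ (y * z)) (sym (+-identityʳ (y * z))) ⟩
      2 * (y * z)                      ≤⟨ *-monoˡ-≤ (y * z) (m≤m+n 2 (μ x)) ⟩
      (2 + μ x) * (y * z)              ≡⟨ cong ((2 + μ x) *_) (sym (^-distribˡ-+-* (2 + μ x) c d)) ⟩
      (2 + μ x) ^ (1 + (c + d))        ∎
    where open ≤-Reasoning

  ≼-^ : {T : X → ℕ} → T ≼ μ → ∀ d → (λ x → T x ^ d) ≼ μ
  ≼-^ (c , b) d = c * d , λ x →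
    ≤-trans (^-monoˡ-≤ d (b x)) (≤-reflexive (^-*-assoc (2 + μ x) c d))

≼-trans : {X : Set} {T μ ν : X → ℕ} → T ≼ μ → μ ≼ ν → T ≼ ν
≼-trans {ν = ν} (c , b) μ≼ν = ≼-≤ {μ = ν} b (≼-^ {μ = ν} (≼-+ {μ = ν} (≼-const 2) μ≼ν) c)

≼-∘ : {X Y : Set} {T μ : X → ℕ} → T ≼ μ → (f : Y → X) → T ∘ f ≼ μ ∘ f
≼-∘ (c , b) f = c , b ∘ f

-- Algorithms as codes with a meaning and a running time

record Algorithm (n : ℕ) : Set where
  field
    fun  : Vec Tree n → Tree
    code : Tree
    time : Vec Tree n → ℕ
    runs : ∀ ρ → ⟨ code , environment ρ ⟩⇓ fun ρ within time ρ

open Algorithm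

argᴬ : ∀ {n} → Fin n → Algorithm n
argᴬ {n} i .fun ρ = lookup ρ i
argᴬ zero .code = headCode
argᴬ (suc i) .code = composeCode (argᴬ i .code) tailCode
argᴬ zero .time _ = 40
argᴬ (suc i) .time (x ∷ ρ) = 40 + (40 + argᴬ i .time ρ)
argᴬ zero .runs (x ∷ ρ) = eval-head
argᴬ (suc i) .runs (x ∷ ρ) = eval-compose eval-tail (argᴬ i .runs ρ)

nilᴬ : ∀ {n} → Algorithm n
nilᴬ .fun _  = nil
nilᴬ .code   = nilCode
nilᴬ .time _ = 40
nilᴬ .runs _ = eval-nil

headᴬ tailᴬ : ∀ {n} → Algorithm n → Algorithm n
headᴬ a .fun ρ  = headTree (a .fun ρ)
headᴬ a .code   = composeCode headCode (a .code)
headᴬ a .time ρ = 40 + (a .time ρ + 40)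
headᴬ a .runs ρ = eval-compose (a .runs ρ) eval-head
tailᴬ a .fun ρ  = tailTree (a .fun ρ)
tailᴬ a .code   = composeCode tailCode (a .code)
tailᴬ a .time ρ = 40 + (a .time ρ + 40)
tailᴬ a .runs ρ = eval-compose (a .runs ρ) eval-tail

nodeᴬ : ∀ {n} → Algorithm n → Algorithm n → Algorithm n
nodeᴬ a b .fun ρ  = node (a .fun ρ) (b .fun ρ)
nodeᴬ a b .code   = nodeCode (a .code) (b .code)
nodeᴬ a b .time ρ = 40 + (a .time ρ + b .time ρ)
nodeᴬ a b .runs ρ = eval-node (a .runs ρ) (b .runs ρ)

ifᴬ : ∀ {n} → Algorithm n → Algorithm n → Algorithm n → Algorithm n
ifᴬ c a b .fun ρ  = ifTree (c .fun ρ) (a .fun ρ) (b .fun ρ)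
ifᴬ c a b .code   = ifCode (c .code) (a .code) (b .code)
ifᴬ c a b .time ρ = 40 + (c .time ρ + (a .time ρ + b .time ρ))
ifᴬ c a b .runs ρ = eval-if (c .runs ρ) (a .runs ρ) (b .runs ρ)

argumentsCode : ∀ {n m} → Vec (Algorithm n) m → Tree
argumentsCode []       = nilCode
argumentsCode (a ∷ as) = nodeCode (a .code) (argumentsCode as)

argumentsTime : ∀ {n m} → Vec (Algorithm n) m → Vec Tree n → ℕ
argumentsTime []       ρ = 40
argumentsTime (a ∷ as) ρ = 40 + (a .time ρ + argumentsTime as ρ)

values : ∀ {n m} → Vec (Algorithm n) m → Vec Tree n → Vec Tree m
values as ρ = map (λ a → a .fun ρ) as

run-arguments : ∀ {n m} (as : Vec (Algorithm n) m) ρ →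
                ⟨ argumentsCode as , environment ρ ⟩⇓ environment (values as ρ) within argumentsTime as ρ
run-arguments []       ρ = eval-nil
run-arguments (a ∷ as) ρ = eval-node (a .runs ρ) (run-arguments as ρ)

applyᴬ : ∀ {n m} → Algorithm m → Vec (Algorithm n) m → Algorithm n
applyᴬ f as .fun ρ  = f .fun (values as ρ)
applyᴬ f as .code   = composeCode (f .code) (argumentsCode as)
applyᴬ f as .time ρ = 40 + (argumentsTime as ρ + f .time (values as ρ))
applyᴬ f as .runs ρ = eval-compose (run-arguments as ρ) (f .runs (values as ρ))

foldᴬ : ∀ {n} → Algorithm n → Algorithm n → Algorithm (suc (suc n)) → Algorithm n
foldᴬ l z f .fun ρ  = foldTree (λ h r → f .fun (h ∷ r ∷ ρ)) (z .fun ρ) (l .fun ρ)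
foldᴬ l z f .code   = foldCode (l .code) (z .code) (f .code)
foldᴬ l z f .time ρ = 40 + (l .time ρ + (z .time ρ +
  foldTime (λ h r → f .fun (h ∷ r ∷ ρ)) (z .fun ρ) (λ h r → f .time (h ∷ r ∷ ρ)) (l .fun ρ)))
foldᴬ l z f .runs ρ = eval-fold _ _ (l .runs ρ) (z .runs ρ) (λ h r → f .runs (h ∷ r ∷ ρ))

-- Feasibility with respect to a measure

totalSize : ∀ {n} → Vec Tree n → ℕ
totalSize ρ = size (environment ρ)

-- Inputs range over a family `ρ` and are measured by an arbitrary `μ`, since some algorithms are
-- polynomial only on particular inputs or in a quantity other than the input size. Output sizes are
-- recorded because composition needs them.
record Feasible {X : Set} {n} (ρ : X → Vec Tree n) (μ : X → ℕ) (a : Algorithm n) : Set where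
  constructor feasible
  field
    time≼ : a .time ∘ ρ ≼ μ
    size≼ : size ∘ a .fun ∘ ρ ≼ μ

open Feasible

PolynomialTime : ∀ {n} → Algorithm n → Set
PolynomialTime = Feasible (λ ρ → ρ) totalSize

-- The intermediate results of a right fold are its values on the suffixes of the list.
data Suffix (t : Tree) : Tree → Set where
  here  : Suffix t t
  there : ∀ {x l} → Suffix t l → Suffix t (node x l)

suffix-tail : ∀ {x t l} → Suffix (node x t) l → Suffix t l
suffix-tail here      = there here
suffix-tail (there s) = there (suffix-tail s)

size-suffix : ∀ {t l} → Suffix t l → size t ≤ size l
size-suffix here              = ≤-refl
size-suffix (there {x} {l} s) = ≤-trans (size-suffix s) (≤-trans (m≤n+m (size l) (size x)) (n≤1+n _))

-- A list has at most `size l` elements, and one bound `W` serves all steps.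
foldTime-bound : ∀ f z T W l → (∀ h t → Suffix (node h t) l → T h (foldTree f z t) ≤ W) →
                 foldTime f z T l ≤ 20 + size l * (20 + W)
foldTime-bound f z T W nil        b = ≤ᵇ⇒≤ 20 20 _
foldTime-bound f z T W (node h t) b = begin
  20 + (T h (foldTree f z t) + foldTime f z T t)
    ≤⟨ +-monoʳ-≤ 20 (+-mono-≤ (b h t here) (foldTime-bound f z T W t (λ x s r → b x s (there r)))) ⟩
  20 + (W + (20 + size t * (20 + W)))
    ≡⟨ eq W (size t) ⟩
  20 + (20 + W) + size t * (20 + W)
    ≤⟨ m≤m+n _ (size h * (20 + W)) ⟩
  20 + (20 + W) + size t * (20 + W) + size h * (20 + W)
    ≡⟨ eq′ W (size t) (size h) ⟩
  20 + (1 + (size h + size t)) * (20 + W) ∎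
  where
  open ≤-Reasoning
  eq : ∀ W t → 20 + (W + (20 + t * (20 + W))) ≡ 20 + (20 + W) + t * (20 + W)
  eq = solve-∀
  eq′ : ∀ W t h → 20 + (20 + W) + t * (20 + W) + h * (20 + W) ≡ 20 + (1 + (h + t)) * (20 + W)
  eq′ = solve-∀

argTime-constant : ∀ {n} (i : Fin n) ρ → argᴬ i .time ρ ≤ 40 + 80 * n
argTime-constant {suc n} zero    ρ       = m≤m+n 40 _
argTime-constant {suc n} (suc i) (x ∷ ρ) =
  ≤-trans (+-monoʳ-≤ 80 (argTime-constant i ρ)) (≤-reflexive (eq n))
  where
  eq : ∀ n → 80 + (40 + 80 * n) ≡ 40 + 80 * (1 + n)
  eq = solve-∀

size-head : ∀ t → size (headTree t) ≤ size t
size-head nil        = z≤n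
size-head (node x y) = ≤-trans (m≤m+n (size x) (size y)) (n≤1+n _)

size-tail : ∀ t → size (tailTree t) ≤ size t
size-tail nil        = z≤n
size-tail (node x y) = ≤-trans (m≤n+m (size y) (size x)) (n≤1+n _)

size-if : ∀ c x y → size (ifTree c x y) ≤ size x + size y
size-if nil        x y = m≤n+m _ _
size-if (node _ _) x y = m≤m+n _ _

module _ {X : Set} {n : ℕ} {ρ : X → Vec Tree n} {μ : X → ℕ} where

  private
    F : Algorithm n → Set
    F = Feasible ρ μ

  feasible-arg : ∀ i → (λ x → size (lookup (ρ x) i)) ≼ μ → F (argᴬ i)
  feasible-arg i s = feasible (≼-≤ {μ = μ} (λ x → argTime-constant i (ρ x)) (≼-const _)) s

  feasible-nil : F nilᴬ
  feasible-nil = feasible (≼-const 40) (≼-const 0)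

  feasible-head : ∀ {a} → F a → F (headᴬ a)
  feasible-head (feasible t s) = feasible (≼-+ {μ = μ} (≼-const 40) (≼-+ {μ = μ} t (≼-const 40)))
    (≼-≤ {μ = μ} (λ x → size-head _) s)

  feasible-tail : ∀ {a} → F a → F (tailᴬ a)
  feasible-tail (feasible t s) = feasible (≼-+ {μ = μ} (≼-const 40) (≼-+ {μ = μ} t (≼-const 40)))
    (≼-≤ {μ = μ} (λ x → size-tail _) s)

  feasible-node : ∀ {a b} → F a → F b → F (nodeᴬ a b)
  feasible-node (feasible t s) (feasible t′ s′) = feasible
    (≼-+ {μ = μ} (≼-const 40) (≼-+ {μ = μ} t t′)) (≼-+ {μ = μ} (≼-const 1) (≼-+ {μ = μ} s s′))

  feasible-if : ∀ {c a b} → F c → F a → F b → F (ifᴬ c a b)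
  feasible-if {c} {a} {b} (feasible tc _) (feasible t s) (feasible t′ s′) = feasible
    (≼-+ {μ = μ} (≼-const 40) (≼-+ {μ = μ} tc (≼-+ {μ = μ} t t′)))
    (≼-≤ {μ = μ} (λ x → size-if (c .fun (ρ x)) _ _) (≼-+ {μ = μ} s s′))

  data AllFeasible : ∀ {m} → Vec (Algorithm n) m → Set where
    []  : AllFeasible []
    _∷_ : ∀ {m a} {as : Vec (Algorithm n) m} → F a → AllFeasible as → AllFeasible (a ∷ as)

  argumentsTime≼ : ∀ {m} {as : Vec (Algorithm n) m} → AllFeasible as → argumentsTime as ∘ ρ ≼ μ
  argumentsTime≼ []       = ≼-const 40
  argumentsTime≼ (p ∷ ps) = ≼-+ {μ = μ} (≼-const 40) (≼-+ {μ = μ} (p .time≼) (argumentsTime≼ ps))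

  argumentsSize≼ : ∀ {m} {as : Vec (Algorithm n) m} → AllFeasible as →
                   (λ x → totalSize (values as (ρ x))) ≼ μ
  argumentsSize≼ []       = ≼-const 0
  argumentsSize≼ (p ∷ ps) = ≼-+ {μ = μ} (≼-const 1) (≼-+ {μ = μ} (p .size≼) (argumentsSize≼ ps))

  feasible-apply : ∀ {m} {f : Algorithm m} {as : Vec (Algorithm n) m} →
                   PolynomialTime f → AllFeasible as → F (applyᴬ f as)
  feasible-apply {as = as} (feasible t s) ps = feasible
    (≼-+ {μ = μ} (≼-const 40) (≼-+ {μ = μ} (argumentsTime≼ ps)
      (≼-trans (≼-∘ t (λ x → values as (ρ x))) (argumentsSize≼ ps))))
    (≼-trans (≼-∘ s (λ x → values as (ρ x))) (argumentsSize≼ ps))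

  -- A polynomial step iterated along a list can grow exponentially, so polynomiality of `f` does
  -- not suffice; `M` bounds the accumulator on every suffix.
  feasible-fold : ∀ {l z f} → F l → F z → PolynomialTime f → (λ x → totalSize (ρ x)) ≼ μ →
    ∀ (M : X → ℕ) → M ≼ μ →
    (∀ x t → Suffix t (l .fun (ρ x)) →
       size (foldTree (λ h r → f .fun (h ∷ r ∷ ρ x)) (z .fun (ρ x)) t) ≤ M x) →
    F (foldᴬ l z f)
  feasible-fold {l} {z} {f} (feasible tl sl) (feasible tz _) (feasible (c , bf) _) sρ M sM bounded = feasible
    (≼-+ {μ = μ} (≼-const 40) (≼-+ {μ = μ} tl (≼-+ {μ = μ} tz
      (≼-≤ {μ = μ} loop (≼-+ {μ = μ} (≼-const 20) (≼-* {μ = μ} sl (≼-+ {μ = μ} (≼-const 20) sW)))))))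
    (≼-≤ {μ = μ} (λ x → bounded x (l .fun (ρ x)) here) sM)
    where
    -- Bounds the size of the environment `h ∷ r ∷ ρ x` of any step: `h` is part of the list, and
    -- `r` has size at most `M x`.
    V : X → ℕ
    V x = 1 + (size (l .fun (ρ x)) + (1 + (M x + totalSize (ρ x))))

    W : X → ℕ
    W x = (2 + V x) ^ c

    sW : W ≼ μ
    sW = ≼-^ {μ = μ} (≼-+ {μ = μ} (≼-const 2)
           (≼-+ {μ = μ} (≼-const 1) (≼-+ {μ = μ} sl (≼-+ {μ = μ} (≼-const 1) (≼-+ {μ = μ} sM sρ))))) c

    loop : ∀ x → _ ≤ 20 + size (l .fun (ρ x)) * (20 + W x)
    loop x = foldTime-bound _ (z .fun (ρ x)) (λ h r → f .time (h ∷ r ∷ ρ x)) (W x) (l .fun (ρ x)) λ h t r →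
      ≤-trans (bf _) (^-monoˡ-≤ c (+-monoʳ-≤ 2 (s≤s (+-mono-≤
        (≤-trans (size-head (node h t)) (size-suffix r))
        (s≤s (+-monoˡ-≤ (totalSize (ρ x)) (bounded x t (suffix-tail r))))))))

record PolyFun (n : ℕ) : Set where
  constructor polyFun
  field
    algorithm  : Algorithm n
    polynomial : PolynomialTime algorithm

open PolyFun

⟦_⟧ : ∀ {n} → PolyFun n → Vec Tree n → Tree
⟦ p ⟧ = p .algorithm .fun

size-lookup : ∀ {n} (ρ : Vec Tree n) i → size (lookup ρ i) ≤ totalSize ρ
size-lookup (x ∷ ρ) zero    = ≤-trans (m≤m+n _ _) (n≤1+n _)
size-lookup (x ∷ ρ) (suc i) = ≤-trans (size-lookup ρ i) (≤-trans (m≤n+m _ (size x)) (n≤1+n _))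

arg : ∀ {n} → Fin n → PolyFun n
arg i .algorithm  = argᴬ i
arg i .polynomial = feasible-arg i (≼-≤ {μ = totalSize} (λ ρ → size-lookup ρ i) ≼-refl)

nilᴾ : ∀ {n} → PolyFun n
nilᴾ .algorithm  = nilᴬ
nilᴾ .polynomial = feasible-nil

headᴾ tailᴾ : ∀ {n} → PolyFun n → PolyFun n
headᴾ a .algorithm  = headᴬ (a .algorithm)
headᴾ a .polynomial = feasible-head (a .polynomial)
tailᴾ a .algorithm  = tailᴬ (a .algorithm)
tailᴾ a .polynomial = feasible-tail (a .polynomial)

nodeᴾ : ∀ {n} → PolyFun n → PolyFun n → PolyFun n
nodeᴾ a b .algorithm  = nodeᴬ (a .algorithm) (b .algorithm)
nodeᴾ a b .polynomial = feasible-node (a .polynomial) (b .polynomial)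

ifᴾ : ∀ {n} → PolyFun n → PolyFun n → PolyFun n → PolyFun n
ifᴾ c a b .algorithm  = ifᴬ (c .algorithm) (a .algorithm) (b .algorithm)
ifᴾ c a b .polynomial = feasible-if (c .polynomial) (a .polynomial) (b .polynomial)

infixl 20 _$ᴾ_

_$ᴾ_ : ∀ {n m} → PolyFun m → Vec (PolyFun n) m → PolyFun n
(f $ᴾ as) .algorithm  = applyᴬ (f .algorithm) (map algorithm as)
(f $ᴾ as) .polynomial = feasible-apply (f .polynomial) (all as)
  where
  all : ∀ {m} (as : Vec (PolyFun _) m) → AllFeasible (map algorithm as)
  all []       = []
  all (a ∷ as) = a .polynomial ∷ all as

foldᴾ : ∀ {n} (l z : PolyFun n) (f : PolyFun (suc (suc n))) (M : Vec Tree n → ℕ) → M ≼ totalSize →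
        (∀ ρ t → Suffix t (⟦ l ⟧ ρ) → size (foldTree (λ h r → ⟦ f ⟧ (h ∷ r ∷ ρ)) (⟦ z ⟧ ρ) t) ≤ M ρ) →
        PolyFun n
foldᴾ l z f M M≼ bounded .algorithm  = foldᴬ (l .algorithm) (z .algorithm) (f .algorithm)
foldᴾ l z f M M≼ bounded .polynomial =
  feasible-fold (l .polynomial) (z .polynomial) (f .polynomial) ≼-refl M M≼ bounded

-- Lets the body of a comprehension see the current element but not the accumulator; the size of its
-- output is then bounded without knowing how the accumulator grows.
skipᴬ : ∀ {n} → Algorithm (suc n) → Algorithm (suc (suc n))
skipᴬ a .fun (h ∷ _ ∷ ρ)  = a .fun (h ∷ ρ)
skipᴬ a .code             = composeCode (a .code) (nodeCode headCode (composeCode tailCode tailCode))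
skipᴬ a .time (h ∷ _ ∷ ρ) = 40 + (40 + (40 + (40 + (40 + 40))) + a .time (h ∷ ρ))
skipᴬ a .runs (h ∷ _ ∷ ρ) =
  eval-compose (eval-node eval-head (eval-compose eval-tail eval-tail)) (a .runs (h ∷ ρ))

skipᴾ : ∀ {n} → PolyFun (suc n) → PolyFun (suc (suc n))
skipᴾ {n} a .algorithm = skipᴬ (a .algorithm)
skipᴾ {n} a .polynomial = feasible
  (≼-≤ {μ = totalSize} {U = λ ρ → 240 + (2 + totalSize ρ) ^ proj₁ (a .polynomial .time≼)}
    (λ { (h ∷ r ∷ ρ) → +-monoʳ-≤ 240 (≤-trans (proj₂ (a .polynomial .time≼) (h ∷ ρ))
        (^-monoˡ-≤ (proj₁ (a .polynomial .time≼)) (s≤s (s≤s (skip≤ h r ρ))))) })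
    (≼-+ {μ = totalSize} (≼-const 240)
      (≼-^ {μ = totalSize} (≼-+ {μ = totalSize} (≼-const 2) ≼-refl) (proj₁ (a .polynomial .time≼)))))
  (proj₁ (a .polynomial .size≼) , λ { (h ∷ r ∷ ρ) → ≤-trans (proj₂ (a .polynomial .size≼) (h ∷ ρ))
        (^-monoˡ-≤ (proj₁ (a .polynomial .size≼)) (s≤s (s≤s (skip≤ h r ρ)))) })
  where
  skip≤ : ∀ h r (ρ : Vec Tree n) → totalSize (h ∷ ρ) ≤ totalSize (h ∷ r ∷ ρ)
  skip≤ h r ρ = s≤s (+-monoʳ-≤ (size h) (≤-trans (m≤n+m (totalSize ρ) (size r)) (n≤1+n _)))

size≼ᴾ : ∀ {n} (a : PolyFun n) → size ∘ ⟦ a ⟧ ≼ totalSize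
size≼ᴾ a = a .polynomial .size≼

-- Polynomial-time programs on numerals, Booleans and lists

opaque
  appendᴾ : PolyFun 2
  appendᴾ = foldᴾ (arg (# 0)) (arg (# 1)) (nodeᴾ (arg (# 0)) (arg (# 1)))
    (λ ρ → size (lookup ρ (# 0)) + size (lookup ρ (# 1)))
    (≼-+ {μ = totalSize} (size≼ᴾ (arg (# 0))) (size≼ᴾ (arg (# 1))))
    (λ { (x ∷ y ∷ []) t s → ≤-trans (bound y t) (+-monoˡ-≤ (size y) (size-suffix s)) })
    where
    bound : ∀ y t → size (foldTree node y t) ≤ size t + size y
    bound y nil        = ≤-refl
    bound y (node h t) = s≤s (≤-trans (+-monoʳ-≤ (size h) (bound y t))
      (≤-reflexive (sym (+-assoc (size h) (size t) (size y)))))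

opaque
  unfolding appendᴾ
  size-append : ∀ x y → size (⟦ appendᴾ ⟧ (x ∷ y ∷ [])) ≤ size x + size y
  size-append nil        y = ≤-refl
  size-append (node h x) y = s≤s (≤-trans (+-monoʳ-≤ (size h) (size-append x y))
    (≤-reflexive (sym (+-assoc (size h) (size x) (size y)))))

opaque
  -- Drops one node per element of the second list: truncated subtraction on numerals and, followed
  -- by a head, indexing into a list.
  monusᴾ : PolyFun 2
  monusᴾ = foldᴾ (arg (# 1)) (arg (# 0)) (tailᴾ (arg (# 1)))
    (λ ρ → size (lookup ρ (# 0))) (size≼ᴾ (arg (# 0)))
    (λ { (x ∷ y ∷ []) t s → bound x t })
    where
    bound : ∀ x t → size (foldTree (λ _ r → tailTree r) x t) ≤ size x
    bound x nil        = ≤-refl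
    bound x (node h t) = ≤-trans (size-tail (foldTree (λ _ r → tailTree r) x t)) (bound x t)

trueᴾ : ∀ {n} → PolyFun n
trueᴾ = nodeᴾ nilᴾ nilᴾ

opaque
  unfolding monusᴾ
  size-monus : ∀ x y → size (⟦ monusᴾ ⟧ (x ∷ y ∷ [])) ≤ size x
  size-monus x nil        = ≤-refl
  size-monus x (node h y) = ≤-trans (size-tail (foldTree (λ _ r → tailTree r) x y)) (size-monus x y)

opaque
  notᴾ : PolyFun 1
  notᴾ = ifᴾ (arg (# 0)) nilᴾ trueᴾ

opaque
  andᴾ orᴾ : PolyFun 2
  andᴾ = ifᴾ (arg (# 0)) (arg (# 1)) nilᴾ
  orᴾ  = ifᴾ (arg (# 0)) trueᴾ (arg (# 1))

opaque
  leqᴾ lessᴾ absDiffᴾ nthᴾ : PolyFun 2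
  leqᴾ     = notᴾ $ᴾ (monusᴾ ∷ [])
  lessᴾ    = leqᴾ $ᴾ (nodeᴾ nilᴾ (arg (# 0)) ∷ arg (# 1) ∷ [])
  absDiffᴾ = appendᴾ $ᴾ (monusᴾ ∷ (monusᴾ $ᴾ (arg (# 1) ∷ arg (# 0) ∷ [])) ∷ [])
  nthᴾ     = headᴾ monusᴾ

size-filter : ∀ (f : Tree → Tree) t → size (foldTree (λ h r → ifTree (f h) (node h r) r) nil t) ≤ size t
size-filter f nil        = z≤n
size-filter f (node h t) with f h
... | nil      = ≤-trans (size-filter f t) (≤-trans (m≤n+m (size t) (size h)) (n≤1+n _))
... | node _ _ = s≤s (+-monoʳ-≤ (size h) (size-filter f t))

-- Unary numerals are lists of `nil` and `appendᴾ` adds them, so `concatMapᴾ` is also the summation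
-- over a list. Its result consists of one body value per element, each of polynomial size.
anyᴾ filterᴾ concatMapᴾ : ∀ {n} → PolyFun n → PolyFun (suc n) → PolyFun n
anyᴾ l f = foldᴾ l nilᴾ (ifᴾ (skipᴾ f) trueᴾ (arg (# 1))) (λ _ → 1) (≼-const 1) (λ ρ t _ → bound ρ t)
  where
  bound : ∀ ρ t → size (foldTree (λ h r → ifTree (⟦ f ⟧ (h ∷ ρ)) (node nil nil) r) nil t) ≤ 1
  bound ρ nil        = z≤n
  bound ρ (node h t) with ⟦ f ⟧ (h ∷ ρ)
  ... | nil      = bound ρ t
  ... | node _ _ = ≤-refl
filterᴾ l f = foldᴾ l nilᴾ (ifᴾ (skipᴾ f) (nodeᴾ (arg (# 0)) (arg (# 1))) (arg (# 1)))
  (size ∘ ⟦ l ⟧) (size≼ᴾ l) (λ ρ t s → ≤-trans (size-filter (λ h → ⟦ f ⟧ (h ∷ ρ)) t) (size-suffix s))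
concatMapᴾ {n} l f = foldᴾ l nilᴾ (appendᴾ $ᴾ (skipᴾ f ∷ arg (# 1) ∷ []))
  (λ ρ → size (⟦ l ⟧ ρ) * W ρ)
  (≼-* {μ = totalSize} (size≼ᴾ l) (≼-^ {μ = totalSize}
    (≼-+ {μ = totalSize} (≼-const 3) (≼-+ {μ = totalSize} (size≼ᴾ l) ≼-refl)) c))
  (λ ρ t s → ≤-trans (bound ρ t (size-suffix s)) (*-monoˡ-≤ (W ρ) (size-suffix s)))
  where
  c : ℕ
  c = proj₁ (size≼ᴾ f)

  W : Vec Tree n → ℕ
  W ρ = (3 + (size (⟦ l ⟧ ρ) + totalSize ρ)) ^ c

  bound : ∀ ρ t → size t ≤ size (⟦ l ⟧ ρ) →
          size (foldTree (λ h r → ⟦ appendᴾ ⟧ (⟦ f ⟧ (h ∷ ρ) ∷ r ∷ [])) nil t) ≤ size t * W ρ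
  bound ρ nil        _ = z≤n
  bound ρ (node h t) s = ≤-trans (size-append (⟦ f ⟧ (h ∷ ρ)) _)
    (+-mono-≤
      (≤-trans (proj₂ (size≼ᴾ f) (h ∷ ρ)) (^-monoˡ-≤ c (+-monoʳ-≤ 3 (+-monoˡ-≤ (totalSize ρ)
        (≤-trans (size-head (node h t)) s)))))
      (≤-trans (bound ρ t (≤-trans (size-tail (node h t)) s))
        (*-monoˡ-≤ (W ρ) (m≤n+m (size t) (size h)))))

spine : Tree → ℕ
spine nil        = 0
spine (node _ t) = suc (spine t)

spine≤size : ∀ t → spine t ≤ size t
spine≤size nil        = z≤n
spine≤size (node h t) = s≤s (≤-trans (spine≤size t) (m≤n+m (size t) (size h)))

sucsTree : Tree → Tree
sucsTree = foldTree (λ h r → node (node nil h) r) nil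

spine-sucs : ∀ t → spine (sucsTree t) ≡ spine t
spine-sucs nil        = refl
spine-sucs (node h t) = cong suc (spine-sucs t)

size-sucs : ∀ t → size (sucsTree t) ≡ size t + spine t
size-sucs nil        = refl
size-sucs (node h t) = cong suc (trans (cong (λ s → suc (size h + s)) (size-sucs t)) (eq (size h) (size t) (spine t)))
  where
  eq : ∀ h t s → 1 + (h + (t + s)) ≡ h + t + (1 + s)
  eq = solve-∀

opaque
  sucsᴾ : PolyFun 1
  sucsᴾ = foldᴾ (arg (# 0)) nilᴾ (nodeᴾ (nodeᴾ nilᴾ (arg (# 0))) (arg (# 1)))
    (λ ρ → size (lookup ρ (# 0)) + size (lookup ρ (# 0)))
    (≼-+ {μ = totalSize} (size≼ᴾ (arg (# 0))) (size≼ᴾ (arg (# 0))))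
    (λ { (x ∷ []) t s → ≤-trans (≤-reflexive (size-sucs t))
      (≤-trans (+-monoʳ-≤ (size t) (spine≤size t)) (+-mono-≤ (size-suffix s) (size-suffix s))) })

-- Uses that 0, ..., m is 0 followed by the successors of 0, ..., m - 1. Only the length of the
-- argument matters, so the encoded cover yields the list of all vertices.
rangeTree : Tree → Tree
rangeTree = foldTree (λ _ r → node nil (sucsTree r)) nil

opaque
  unfolding sucsᴾ
  rangeᴾ : PolyFun 1
  rangeᴾ = foldᴾ (arg (# 0)) nilᴾ (nodeᴾ nilᴾ (sucsᴾ $ᴾ (arg (# 1) ∷ [])))
    (λ ρ → size (lookup ρ (# 0)) * (1 + size (lookup ρ (# 0))))
    (≼-* {μ = totalSize} (size≼ᴾ (arg (# 0))) (≼-+ {μ = totalSize} (≼-const 1) (size≼ᴾ (arg (# 0)))))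
    (λ { (x ∷ []) t s → ≤-trans (bound t) (*-mono-≤ (size-suffix s) (s≤s (size-suffix s))) })
    where
    open ≤-Reasoning
    spine-range : ∀ t → spine (rangeTree t) ≡ spine t
    spine-range nil        = refl
    spine-range (node h t) = cong suc (trans (spine-sucs (rangeTree t)) (spine-range t))

    eq : ∀ s → 1 + (s * (1 + s) + s) + (1 + s) ≡ (1 + s) * (1 + (1 + s))
    eq = solve-∀

    bound : ∀ t → size (rangeTree t) ≤ size t * (1 + size t)
    bound nil        = z≤n
    bound (node h t) = begin
      suc (size (sucsTree (rangeTree t)))          ≡⟨ cong suc (size-sucs (rangeTree t)) ⟩
      suc (size (rangeTree t) + spine (rangeTree t)) ≡⟨ cong (λ s → suc (size (rangeTree t) + s)) (spine-range t) ⟩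
      suc (size (rangeTree t) + spine t)           ≤⟨ s≤s (+-mono-≤ (bound t) (spine≤size t)) ⟩
      suc (size t * (1 + size t) + size t)         ≤⟨ m≤m+n _ (1 + size t) ⟩
      1 + (size t * (1 + size t) + size t) + (1 + size t) ≡⟨ eq (size t) ⟩
      (1 + size t) * (1 + (1 + size t))            ≤⟨ *-mono-≤ (s≤s (m≤n+m (size t) (size h))) (s≤s (s≤s (m≤n+m (size t) (size h)))) ⟩
      (1 + (size h + size t)) * (1 + (1 + (size h + size t))) ∎

-- Encodings and the values of the programs on them

bit : Bool → ℕ
bit b = if b then 1 else 0

-- Truth values are the numerals 0 and 1, so concatenating the results of tests counts the
-- successful ones.
encodeBool-bit : ∀ b → encodeBool b ≡ encodeUnary (bit b)
encodeBool-bit true  = refl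
encodeBool-bit false = refl

if-unary : ∀ {x} b → (if b then encodeUnary x else nil) ≡ encodeUnary (if b then x else 0)
if-unary true  = refl
if-unary false = refl

encodeList : {A : Set} → (A → Tree) → List A → Tree
encodeList enc []       = nil
encodeList enc (x ∷ xs) = node (enc x) (encodeList enc xs)

encodeVertex : ∀ {n} → Fin n → Tree
encodeVertex i = encodeUnary (toℕ i)

encodeTable : ∀ {n} → (Fin n → Tree) → Tree
encodeTable f = environment (tabulate f)

vertices : ℕ → Tree
vertices n = encodeTable {n} encodeVertex

opaque
  unfolding appendᴾ
  append-unary : ∀ {x y} a b → x ≡ encodeUnary a → y ≡ encodeUnary b →
                 ⟦ appendᴾ ⟧ (x ∷ y ∷ []) ≡ encodeUnary (a + b)
  append-unary zero    b refl refl = refl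
  append-unary (suc a) b refl refl = cong (node nil) (append-unary a b refl refl)

opaque
  unfolding appendᴾ
  append-list : ∀ {A : Set} {enc : A → Tree} {x y} xs ys → x ≡ encodeList enc xs → y ≡ encodeList enc ys →
                ⟦ appendᴾ ⟧ (x ∷ y ∷ []) ≡ encodeList enc (xs ++ ys)
  append-list []       ys refl refl = refl
  append-list (x ∷ xs) ys refl refl = cong (node _) (append-list xs ys refl refl)

private
  drop : Tree → Tree → Tree
  drop = foldTree (λ _ r → tailTree r)

  -- Taking the extra tail innermost instead of outermost lets inductions peel both arguments at the
  -- front.
  drop-tail : ∀ x j → drop x (encodeUnary (suc j)) ≡ drop (tailTree x) (encodeUnary j)
  drop-tail x zero    = refl
  drop-tail x (suc j) = cong tailTree (drop-tail x j)

  drop-nil : ∀ j → drop nil (encodeUnary j) ≡ nil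
  drop-nil zero    = refl
  drop-nil (suc j) = cong tailTree (drop-nil j)

opaque
  unfolding monusᴾ
  monus-unary : ∀ {x y} a b → x ≡ encodeUnary a → y ≡ encodeUnary b →
                ⟦ monusᴾ ⟧ (x ∷ y ∷ []) ≡ encodeUnary (a ∸ b)
  monus-unary a       zero    refl refl = refl
  monus-unary zero    (suc b) refl refl = drop-nil (suc b)
  monus-unary (suc a) (suc b) refl refl = trans (drop-tail (encodeUnary (suc a)) b) (monus-unary a b refl refl)

opaque
  unfolding nthᴾ monusᴾ
  nth-vec : ∀ {A : Set} {n} {enc : A → Tree} {x y} (xs : Vec A n) i →
            x ≡ encodeVec enc xs → y ≡ encodeVertex i → ⟦ nthᴾ ⟧ (x ∷ y ∷ []) ≡ enc (lookup xs i)
  nth-vec (x ∷ xs) zero    refl refl = refl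
  nth-vec (x ∷ xs) (suc i) refl refl =
    trans (cong headTree (drop-tail (encodeVec _ (x ∷ xs)) (toℕ i))) (nth-vec xs i refl refl)

opaque
  unfolding notᴾ
  not-bool : ∀ {x} a → x ≡ encodeBool a → ⟦ notᴾ ⟧ (x ∷ []) ≡ encodeBool (not a)
  not-bool true  refl = refl
  not-bool false refl = refl

opaque
  unfolding andᴾ
  and-bool : ∀ {x y} a b → x ≡ encodeBool a → y ≡ encodeBool b → ⟦ andᴾ ⟧ (x ∷ y ∷ []) ≡ encodeBool (a ∧ b)
  and-bool true  b refl refl = refl
  and-bool false b refl refl = refl

opaque
  unfolding orᴾ
  or-bool : ∀ {x y} a b → x ≡ encodeBool a → y ≡ encodeBool b → ⟦ orᴾ ⟧ (x ∷ y ∷ []) ≡ encodeBool (a ∨ b)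
  or-bool true  b refl refl = refl
  or-bool false b refl refl = refl

if-bool : ∀ {x y z s t} a → x ≡ encodeBool a → y ≡ s → z ≡ t → ifTree x y z ≡ (if a then s else t)
if-bool true  refl refl refl = refl
if-bool false refl refl refl = refl

isZero : ℕ → Bool
isZero zero    = true
isZero (suc _) = false

opaque
  unfolding notᴾ
  not-unary : ∀ {x} a → x ≡ encodeUnary a → ⟦ notᴾ ⟧ (x ∷ []) ≡ encodeBool (isZero a)
  not-unary zero    refl = refl
  not-unary (suc a) refl = refl

isZero-∸ : ∀ a b → isZero (a ∸ b) ≡ (a ≤ᵇ b)
isZero-∸ zero          zero    = refl
isZero-∸ zero          (suc b) = refl
isZero-∸ (suc a)       zero    = refl
isZero-∸ (suc zero)    (suc b) = isZero-∸ zero b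
isZero-∸ (suc (suc a)) (suc b) = isZero-∸ (suc a) b

opaque
  unfolding leqᴾ
  leq-unary : ∀ {x y} a b → x ≡ encodeUnary a → y ≡ encodeUnary b →
              ⟦ leqᴾ ⟧ (x ∷ y ∷ []) ≡ encodeBool (a ≤ᵇ b)
  leq-unary a b p q = trans (not-unary (a ∸ b) (monus-unary a b p q)) (cong encodeBool (isZero-∸ a b))

opaque
  unfolding lessᴾ
  less-unary : ∀ {x y} a b → x ≡ encodeUnary a → y ≡ encodeUnary b →
               ⟦ lessᴾ ⟧ (x ∷ y ∷ []) ≡ encodeBool (a <ᵇ b)
  less-unary a b p q = leq-unary (suc a) b (cong (node nil) p) q

opaque
  unfolding absDiffᴾ
  absDiff-unary : ∀ {x y} a b → x ≡ encodeUnary a → y ≡ encodeUnary b →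
                  ⟦ absDiffᴾ ⟧ (x ∷ y ∷ []) ≡ encodeUnary ∣ a - b ∣
  absDiff-unary a b p q =
    trans (append-unary (a ∸ b) (b ∸ a) (monus-unary a b p q) (monus-unary b a q p)) (cong encodeUnary (eq a b))
    where
    eq : ∀ a b → (a ∸ b) + (b ∸ a) ≡ ∣ a - b ∣
    eq zero    zero    = refl
    eq zero    (suc b) = refl
    eq (suc a) zero    = +-identityʳ _
    eq (suc a) (suc b) = eq a b

any-list : ∀ {A : Set} {enc : A → Tree} {l} {f : Tree → Tree} xs (b : A → Bool) →
           l ≡ encodeList enc xs → (∀ x → f (enc x) ≡ encodeBool (b x)) →
           foldTree (λ h r → ifTree (f h) (node nil nil) r) nil l ≡ encodeBool (any b xs)
any-list []       b refl q = refl
any-list (x ∷ xs) b refl q rewrite q x with b x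
... | true  = refl
... | false = any-list xs b refl q

filter-list : ∀ {A : Set} {enc : A → Tree} {l} {f : Tree → Tree} xs (b : A → Bool) →
              l ≡ encodeList enc xs → (∀ x → f (enc x) ≡ encodeBool (b x)) →
              foldTree (λ h r → ifTree (f h) (node h r) r) nil l ≡ encodeList enc (filterᵇ b xs)
filter-list []       b refl q = refl
filter-list (x ∷ xs) b refl q rewrite q x with b x
... | true  = cong (node _) (filter-list xs b refl q)
... | false = filter-list xs b refl q

concatMap-list : ∀ {A B : Set} {enc : A → Tree} {enc′ : B → Tree} {l} {f : Tree → Tree} xs (g : A → List B) →
                 l ≡ encodeList enc xs → (∀ x → f (enc x) ≡ encodeList enc′ (g x)) →
                 foldTree (λ h r → ⟦ appendᴾ ⟧ (f h ∷ r ∷ [])) nil l ≡ encodeList enc′ (concatMap g xs)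
concatMap-list []       g refl q = refl
concatMap-list (x ∷ xs) g refl q = append-list (g x) (concatMap g xs) (q x) (concatMap-list xs g refl q)

sum-table : ∀ {n l} {f : Tree → Tree} {e : Fin n → Tree} (g : Fin n → ℕ) →
            l ≡ encodeTable e → (∀ i → f (e i) ≡ encodeUnary (g i)) →
            foldTree (λ h r → ⟦ appendᴾ ⟧ (f h ∷ r ∷ [])) nil l ≡ encodeUnary (sum g)
sum-table {zero}  g refl q = refl
sum-table {suc n} g refl q = append-unary (g zero) (sum (g ∘ suc)) (q zero) (sum-table (g ∘ suc) refl (q ∘ suc))

sucs-table : ∀ {n} (f : Fin n → ℕ) → sucsTree (encodeTable (encodeUnary ∘ f)) ≡ encodeTable (encodeUnary ∘ suc ∘ f)
sucs-table {zero}  f = refl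
sucs-table {suc n} f = cong (node _) (sucs-table (f ∘ suc))

opaque
  unfolding rangeᴾ sucsᴾ
  range-vec : ∀ {A : Set} {n} {enc : A → Tree} (xs : Vec A n) → ⟦ rangeᴾ ⟧ (encodeVec enc xs ∷ []) ≡ vertices n
  range-vec []       = refl
  range-vec (x ∷ xs) = cong (node nil) (trans (cong sucsTree (range-vec xs)) (sucs-table toℕ))

opaque
  unfolding rangeᴾ sucsᴾ
  range-unary : ∀ b → ⟦ rangeᴾ ⟧ (encodeUnary b ∷ []) ≡ encodeList encodeUnary (upTo b)
  range-unary b = go b
    where
    sucs-upTo : ∀ (f : ℕ → ℕ) b → sucsTree (encodeList encodeUnary (applyUpTo f b))
                                  ≡ encodeList encodeUnary (applyUpTo (suc ∘ f) b)
    sucs-upTo f zero    = refl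
    sucs-upTo f (suc b) = cong (node _) (sucs-upTo (f ∘ suc) b)

    go : ∀ b → rangeTree (encodeUnary b) ≡ encodeList encodeUnary (upTo b)
    go zero    = refl
    go (suc b) = cong (node nil) (trans (cong sucsTree (go b)) (sucs-upTo (λ x → x) b))

-- The search

module Search {n : ℕ} (A : Fin n → Fin n → Bool) (S : Fin n → Bool) where

  -- Coordinate zero holds a cost, coordinate suc v belongs to the vertex v and is zero outside the cover.
  -- States serve as dynamic programming states, as guesses p of an order of the cover (p ‼ s is the key
  -- of s), and as guesses θ for one twin class (its members with index at least θ ‼ s are to the right of s).
  State : Set
  State = Vec ℕ (suc n)

  infixl 8 _‼_
  _‼_ : State → Fin n → ℕ
  x ‼ v = lookup x (suc v)

  cost : State → ℕ
  cost x = lookup x zero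

  -- The number of cover vertices to the left of `v` according to the guess `θ`.
  key : State → Fin n → ℕ
  key θ v = sum λ s → bit (S s ∧ (θ ‼ s ≤ᵇ toℕ v))

  -- v lies to the left of u ∈ S iff key θ v ≤ p ‼ u; twins are ordered by their indices.
  precedes : State → State → Fin n → Fin n → Bool
  precedes θ p v u = if S u then not (key θ v ≤ᵇ p ‼ u) else (toℕ u <ᵇ toℕ v)

  degree : Fin n → ℕ
  degree v = sum λ u → bit (A v u)

  leftOf : State → State → Fin n → ℕ
  leftOf θ p v = sum λ u → bit (A v u ∧ precedes θ p v u)

  -- The imbalance of a vertex of degree `d` with `l` neighbours to its left.
  discrepancy : ℕ → ℕ → ℕ
  discrepancy l d = ∣ l - (d ∸ l) ∣

  vertexCost : State → State → Fin n → ℕ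
  vertexCost θ p v = discrepancy (leftOf θ p v) (degree v)

  smallerTwins : Fin n → ℕ
  smallerTwins r = sum λ u → bit ((toℕ u <ᵇ toℕ r) ∧ (not (S u) ∧ A r u))

  same : Fin n → Fin n → Bool
  same r v = (toℕ r ≤ᵇ toℕ v) ∧ (toℕ v ≤ᵇ toℕ r)

  -- A class is represented by its member of least index, so inClass r is empty for all other r.
  inClass : Fin n → Fin n → Bool
  inClass r v = not (S r) ∧ (not (S v) ∧ ((same r v ∨ A r v) ∧ isZero (smallerTwins r)))

  classCost : State → State → Fin n → ℕ
  classCost θ p r = sum λ v → if inClass r v then vertexCost θ p v else 0

  classLeft : State → State → Fin n → Fin n → ℕ
  classLeft θ p r s = sum λ v → bit (inClass r v ∧ (A s v ∧ (S s ∧ (key θ v ≤ᵇ p ‼ s))))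

  -- Vanishes iff u is l plus the contribution of the class of r.
  mismatch : State → State → Fin n → State → State → ℕ
  mismatch θ p r l u = ∣ cost u - (cost l + classCost θ p r) ∣
                       + sum λ s → ∣ u ‼ s - (l ‼ s + classLeft θ p r s) ∣

  weight : State → ℕ
  weight x = cost x + sum (x ‼_)

  coverPrecedes : State → Fin n → Fin n → Bool
  coverPrecedes p s s′ =
    S s ∧ ((p ‼ s <ᵇ p ‼ s′) ∨ ((p ‼ s ≤ᵇ p ‼ s′) ∧ (toℕ s <ᵇ toℕ s′)))

  coverLeft : State → State → Fin n → ℕ
  coverLeft p x s = x ‼ s + sum λ u → bit (A s u ∧ coverPrecedes p u s)

  total : State → State → ℕ
  total p x = cost x + sum λ s → if S s then discrepancy (coverLeft p x s) (degree s) else 0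

  module _ (U : List State) where

    -- Selects states from `U` instead of building new ones, so that no stage is longer than `U`.
    step : State → Fin n → List State → List State
    step p r L = filterᵇ (λ u → any (λ l → any (λ θ → isZero (mismatch θ p r l u)) U) L) U

    -- Runs over all vertices. At a vertex that represents no class both contributions vanish, and a
    -- step can only keep a state as it is.
    reach : State → ∀ {m} → (Fin m → Fin n) → List State
    reach p {zero}  e = filterᵇ (isZero ∘ weight) U
    reach p {suc m} e = step p (e zero) (reach p (e ∘ suc))

    accept : ℕ → Bool
    accept τ = any (λ p → any (λ x → total p x ≤ᵇ τ) (reach p id)) U

-- The letters above a program list its arguments: M is the adjacency matrix, S the cover,
-- V the list of vertices and U the list of all candidate states.
opaque
  coordinateᴾ : PolyFun 2
  coordinateᴾ = nthᴾ $ᴾ (arg (# 0) ∷ nodeᴾ nilᴾ (arg (# 1)) ∷ [])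

opaque
  adjacentᴾ : PolyFun 3
  adjacentᴾ = nthᴾ $ᴾ ((nthᴾ $ᴾ (arg (# 0) ∷ arg (# 1) ∷ [])) ∷ arg (# 2) ∷ [])

opaque
  keyᴾ : PolyFun 4
  keyᴾ = concatMapᴾ (arg (# 1))
    (andᴾ $ᴾ ((nthᴾ $ᴾ (arg (# 1) ∷ arg (# 0) ∷ []))
            ∷ (leqᴾ $ᴾ ((coordinateᴾ $ᴾ (arg (# 3) ∷ arg (# 0) ∷ [])) ∷ arg (# 4) ∷ [])) ∷ []))

-- S V θ p v u
opaque
  precedesᴾ : PolyFun 6
  precedesᴾ = ifᴾ (nthᴾ $ᴾ (arg (# 0) ∷ arg (# 5) ∷ []))
    (notᴾ $ᴾ ((leqᴾ $ᴾ ((keyᴾ $ᴾ (arg (# 0) ∷ arg (# 1) ∷ arg (# 2) ∷ arg (# 4) ∷ []))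
                      ∷ (coordinateᴾ $ᴾ (arg (# 3) ∷ arg (# 5) ∷ [])) ∷ [])) ∷ []))
    (lessᴾ $ᴾ (arg (# 5) ∷ arg (# 4) ∷ []))

-- M V v
opaque
  degreeᴾ : PolyFun 3
  degreeᴾ = concatMapᴾ (arg (# 1)) (adjacentᴾ $ᴾ (arg (# 1) ∷ arg (# 3) ∷ arg (# 0) ∷ []))

-- M S V θ p v
opaque
  leftOfᴾ : PolyFun 6
  leftOfᴾ = concatMapᴾ (arg (# 2))
    (andᴾ $ᴾ ((adjacentᴾ $ᴾ (arg (# 1) ∷ arg (# 6) ∷ arg (# 0) ∷ []))
            ∷ (precedesᴾ $ᴾ (arg (# 2) ∷ arg (# 3) ∷ arg (# 4) ∷ arg (# 5) ∷ arg (# 6) ∷ arg (# 0) ∷ [])) ∷ []))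

opaque
  discrepancyᴾ : PolyFun 2
  discrepancyᴾ = absDiffᴾ $ᴾ (arg (# 0) ∷ (monusᴾ $ᴾ (arg (# 1) ∷ arg (# 0) ∷ [])) ∷ [])

-- M S V θ p v
opaque
  vertexCostᴾ : PolyFun 6
  vertexCostᴾ = discrepancyᴾ $ᴾ (leftOfᴾ ∷ (degreeᴾ $ᴾ (arg (# 0) ∷ arg (# 2) ∷ arg (# 5) ∷ [])) ∷ [])

-- M S V r
opaque
  smallerTwinsᴾ : PolyFun 4
  smallerTwinsᴾ = concatMapᴾ (arg (# 2))
    (andᴾ $ᴾ ((lessᴾ $ᴾ (arg (# 0) ∷ arg (# 4) ∷ []))
            ∷ (andᴾ $ᴾ ((notᴾ $ᴾ ((nthᴾ $ᴾ (arg (# 2) ∷ arg (# 0) ∷ [])) ∷ []))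
                      ∷ (adjacentᴾ $ᴾ (arg (# 1) ∷ arg (# 4) ∷ arg (# 0) ∷ [])) ∷ [])) ∷ []))

opaque
  sameᴾ : PolyFun 2
  sameᴾ = andᴾ $ᴾ (leqᴾ ∷ (leqᴾ $ᴾ (arg (# 1) ∷ arg (# 0) ∷ [])) ∷ [])

-- M S V r v
opaque
  inClassᴾ : PolyFun 5
  inClassᴾ = andᴾ $ᴾ ((notᴾ $ᴾ ((nthᴾ $ᴾ (arg (# 1) ∷ arg (# 3) ∷ [])) ∷ []))
    ∷ (andᴾ $ᴾ ((notᴾ $ᴾ ((nthᴾ $ᴾ (arg (# 1) ∷ arg (# 4) ∷ [])) ∷ []))
    ∷ (andᴾ $ᴾ ((orᴾ $ᴾ ((sameᴾ $ᴾ (arg (# 3) ∷ arg (# 4) ∷ []))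
                       ∷ (adjacentᴾ $ᴾ (arg (# 0) ∷ arg (# 3) ∷ arg (# 4) ∷ [])) ∷ []))
    ∷ (notᴾ $ᴾ ((smallerTwinsᴾ $ᴾ (arg (# 0) ∷ arg (# 1) ∷ arg (# 2) ∷ arg (# 3) ∷ [])) ∷ [])) ∷ [])) ∷ [])) ∷ [])

-- M S V θ p r
opaque
  classCostᴾ : PolyFun 6
  classCostᴾ = concatMapᴾ (arg (# 2))
    (ifᴾ (inClassᴾ $ᴾ (arg (# 1) ∷ arg (# 2) ∷ arg (# 3) ∷ arg (# 6) ∷ arg (# 0) ∷ []))
      (vertexCostᴾ $ᴾ (arg (# 1) ∷ arg (# 2) ∷ arg (# 3) ∷ arg (# 4) ∷ arg (# 5) ∷ arg (# 0) ∷ []))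
      nilᴾ)

-- M S V θ p r s
opaque
  classLeftᴾ : PolyFun 7
  classLeftᴾ = concatMapᴾ (arg (# 2))
    (andᴾ $ᴾ ((inClassᴾ $ᴾ (arg (# 1) ∷ arg (# 2) ∷ arg (# 3) ∷ arg (# 6) ∷ arg (# 0) ∷ []))
    ∷ (andᴾ $ᴾ ((adjacentᴾ $ᴾ (arg (# 1) ∷ arg (# 7) ∷ arg (# 0) ∷ []))
    ∷ (andᴾ $ᴾ ((nthᴾ $ᴾ (arg (# 2) ∷ arg (# 7) ∷ []))
    ∷ (leqᴾ $ᴾ ((keyᴾ $ᴾ (arg (# 2) ∷ arg (# 3) ∷ arg (# 4) ∷ arg (# 0) ∷ []))
              ∷ (coordinateᴾ $ᴾ (arg (# 5) ∷ arg (# 7) ∷ [])) ∷ [])) ∷ [])) ∷ [])) ∷ []))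

-- M S V θ p r l u
opaque
  mismatchᴾ : PolyFun 8
  mismatchᴾ = appendᴾ $ᴾ
    ((absDiffᴾ $ᴾ (headᴾ (arg (# 7))
       ∷ (appendᴾ $ᴾ (headᴾ (arg (# 6))
          ∷ (classCostᴾ $ᴾ (arg (# 0) ∷ arg (# 1) ∷ arg (# 2) ∷ arg (# 3) ∷ arg (# 4) ∷ arg (# 5) ∷ [])) ∷ [])) ∷ []))
    ∷ concatMapᴾ (arg (# 2))
        (absDiffᴾ $ᴾ ((coordinateᴾ $ᴾ (arg (# 8) ∷ arg (# 0) ∷ []))
          ∷ (appendᴾ $ᴾ ((coordinateᴾ $ᴾ (arg (# 7) ∷ arg (# 0) ∷ []))
          ∷ (classLeftᴾ $ᴾ (arg (# 1) ∷ arg (# 2) ∷ arg (# 3) ∷ arg (# 4) ∷ arg (# 5) ∷ arg (# 6) ∷ arg (# 0) ∷ []))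
          ∷ [])) ∷ []))
    ∷ [])

-- M S V U p r L
opaque
  stepᴾ : PolyFun 7
  stepᴾ = filterᴾ (arg (# 3)) (anyᴾ (arg (# 7)) (anyᴾ (arg (# 5))
    (notᴾ $ᴾ ((mismatchᴾ $ᴾ (arg (# 3) ∷ arg (# 4) ∷ arg (# 5) ∷ arg (# 0) ∷ arg (# 7) ∷ arg (# 8) ∷ arg (# 1) ∷ arg (# 2) ∷ []))
             ∷ []))))

opaque
  unfolding stepᴾ
  -- Being free of `L`, this bound is an invariant of the fold in `reachᴾ`.
  size-step : ∀ M S V U p r L → size (⟦ stepᴾ ⟧ (M ∷ S ∷ V ∷ U ∷ p ∷ r ∷ L ∷ [])) ≤ size U
  size-step M S V U p r L = size-filter _ U

-- V x
opaque
  weightᴾ : PolyFun 2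
  weightᴾ = appendᴾ $ᴾ (headᴾ (arg (# 1))
    ∷ concatMapᴾ (arg (# 0)) (coordinateᴾ $ᴾ (arg (# 2) ∷ arg (# 0) ∷ [])) ∷ [])

-- M S V U p
opaque
  reachᴾ : PolyFun 5
  reachᴾ = foldᴾ (arg (# 2)) (filterᴾ (arg (# 3)) (notᴾ $ᴾ ((weightᴾ $ᴾ (arg (# 3) ∷ arg (# 0) ∷ [])) ∷ [])))
    (stepᴾ $ᴾ (arg (# 2) ∷ arg (# 3) ∷ arg (# 4) ∷ arg (# 5) ∷ arg (# 6) ∷ arg (# 0) ∷ arg (# 1) ∷ []))
    (λ ρ → size (lookup ρ (# 3))) (size≼ᴾ (arg (# 3)))
    (λ { (M ∷ S ∷ V ∷ U ∷ p ∷ []) nil        _ → size-filter _ U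
       ; (M ∷ S ∷ V ∷ U ∷ p ∷ []) (node h t) _ → size-step M S V U p h _ })

-- S p s s′
opaque
  coverPrecedesᴾ : PolyFun 4
  coverPrecedesᴾ = andᴾ $ᴾ ((nthᴾ $ᴾ (arg (# 0) ∷ arg (# 2) ∷ []))
    ∷ (orᴾ $ᴾ ((lessᴾ $ᴾ ((coordinateᴾ $ᴾ (arg (# 1) ∷ arg (# 2) ∷ [])) ∷ (coordinateᴾ $ᴾ (arg (# 1) ∷ arg (# 3) ∷ [])) ∷ []))
    ∷ (andᴾ $ᴾ ((leqᴾ $ᴾ ((coordinateᴾ $ᴾ (arg (# 1) ∷ arg (# 2) ∷ [])) ∷ (coordinateᴾ $ᴾ (arg (# 1) ∷ arg (# 3) ∷ [])) ∷ []))
              ∷ (lessᴾ $ᴾ (arg (# 2) ∷ arg (# 3) ∷ [])) ∷ [])) ∷ [])) ∷ [])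

-- M S V p x s
opaque
  coverLeftᴾ : PolyFun 6
  coverLeftᴾ = appendᴾ $ᴾ ((coordinateᴾ $ᴾ (arg (# 4) ∷ arg (# 5) ∷ []))
    ∷ concatMapᴾ (arg (# 2))
        (andᴾ $ᴾ ((adjacentᴾ $ᴾ (arg (# 1) ∷ arg (# 6) ∷ arg (# 0) ∷ []))
                ∷ (coverPrecedesᴾ $ᴾ (arg (# 2) ∷ arg (# 4) ∷ arg (# 0) ∷ arg (# 6) ∷ [])) ∷ []))
    ∷ [])

-- M S V p x
opaque
  totalᴾ : PolyFun 5
  totalᴾ = appendᴾ $ᴾ (headᴾ (arg (# 4))
    ∷ concatMapᴾ (arg (# 2))
        (ifᴾ (nthᴾ $ᴾ (arg (# 2) ∷ arg (# 0) ∷ []))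
          (discrepancyᴾ $ᴾ
            ((coverLeftᴾ $ᴾ (arg (# 1) ∷ arg (# 2) ∷ arg (# 3) ∷ arg (# 4) ∷ arg (# 5) ∷ arg (# 0) ∷ []))
            ∷ (degreeᴾ $ᴾ (arg (# 1) ∷ arg (# 3) ∷ arg (# 0) ∷ [])) ∷ []))
          nilᴾ)
    ∷ [])

-- M S V U τ
opaque
  acceptᴾ : PolyFun 5
  acceptᴾ = anyᴾ (arg (# 3))
    (anyᴾ (reachᴾ $ᴾ (arg (# 1) ∷ arg (# 2) ∷ arg (# 3) ∷ arg (# 4) ∷ arg (# 0) ∷ []))
      (leqᴾ $ᴾ ((totalᴾ $ᴾ (arg (# 2) ∷ arg (# 3) ∷ arg (# 4) ∷ arg (# 1) ∷ arg (# 0) ∷ [])) ∷ arg (# 6) ∷ [])))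

-- The search programs compute the search functions

module SearchCorrect {n : ℕ} (rows : Vec (Subset n) n) (S : Subset n) where

  open Search (λ u v → lookup (lookup rows u) v) (lookup S)

  private
    M̂ Ŝ V̂ : Tree
    M̂ = encodeVec encodeSubset rows
    Ŝ = encodeSubset S
    V̂ = vertices n

    ⌜_⌝ : State → Tree
    ⌜_⌝ = encodeVec encodeUnary

    ⌞_⌟ : Fin n → Tree
    ⌞_⌟ = encodeVertex

    sum-bits : ∀ {l} {f : Tree → Tree} (b : Fin n → Bool) →
               l ≡ V̂ → (∀ i → f ⌞ i ⌟ ≡ encodeBool (b i)) →
               foldTree (λ h r → ⟦ appendᴾ ⟧ (f h ∷ r ∷ [])) nil l ≡ encodeUnary (sum (bit ∘ b))
    sum-bits b p q = sum-table (bit ∘ b) p λ i → trans (q i) (encodeBool-bit (b i))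

  opaque
    unfolding coordinateᴾ
    coordinate-spec : ∀ x v → ⟦ coordinateᴾ ⟧ (⌜ x ⌝ ∷ ⌞ v ⌟ ∷ []) ≡ encodeUnary (x ‼ v)
    coordinate-spec x v = nth-vec {enc = encodeUnary} x (suc v) refl refl

  cover-spec : ∀ v → ⟦ nthᴾ ⟧ (Ŝ ∷ ⌞ v ⌟ ∷ []) ≡ encodeBool (lookup S v)
  cover-spec v = nth-vec {enc = encodeBool} S v refl refl

  opaque
    unfolding adjacentᴾ
    adjacent-spec : ∀ u v → ⟦ adjacentᴾ ⟧ (M̂ ∷ ⌞ u ⌟ ∷ ⌞ v ⌟ ∷ []) ≡ encodeBool (lookup (lookup rows u) v)
    adjacent-spec u v = nth-vec {enc = encodeBool} (lookup rows u) v (nth-vec {enc = encodeSubset} rows u refl refl) refl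

  opaque
    unfolding keyᴾ
    key-spec : ∀ θ v → ⟦ keyᴾ ⟧ (Ŝ ∷ V̂ ∷ ⌜ θ ⌝ ∷ ⌞ v ⌟ ∷ []) ≡ encodeUnary (key θ v)
    key-spec θ v = sum-bits _ refl λ s →
      and-bool (lookup S s) _ (cover-spec s) (leq-unary (θ ‼ s) (toℕ v) (coordinate-spec θ s) refl)

  opaque
    unfolding precedesᴾ
    precedes-spec : ∀ θ p v u → ⟦ precedesᴾ ⟧ (Ŝ ∷ V̂ ∷ ⌜ θ ⌝ ∷ ⌜ p ⌝ ∷ ⌞ v ⌟ ∷ ⌞ u ⌟ ∷ []) ≡ encodeBool (precedes θ p v u)
    precedes-spec θ p v u = trans
      (if-bool (lookup S u) (cover-spec u)
        (not-bool (key θ v ≤ᵇ p ‼ u) (leq-unary (key θ v) (p ‼ u) (key-spec θ v) (coordinate-spec p u)))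
        (less-unary (toℕ u) (toℕ v) refl refl))
      (if-encode (lookup S u))
      where
      if-encode : ∀ {x y} b → (if b then encodeBool x else encodeBool y) ≡ encodeBool (if b then x else y)
      if-encode true  = refl
      if-encode false = refl

  opaque
    unfolding degreeᴾ
    degree-spec : ∀ v → ⟦ degreeᴾ ⟧ (M̂ ∷ V̂ ∷ ⌞ v ⌟ ∷ []) ≡ encodeUnary (degree v)
    degree-spec v = sum-bits _ refl (adjacent-spec v)

  opaque
    unfolding leftOfᴾ
    leftOf-spec : ∀ θ p v → ⟦ leftOfᴾ ⟧ (M̂ ∷ Ŝ ∷ V̂ ∷ ⌜ θ ⌝ ∷ ⌜ p ⌝ ∷ ⌞ v ⌟ ∷ []) ≡ encodeUnary (leftOf θ p v)
    leftOf-spec θ p v = sum-bits _ refl λ u →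
      and-bool _ _ (adjacent-spec v u) (precedes-spec θ p v u)

  opaque
    unfolding discrepancyᴾ
    discrepancy-spec : ∀ {x y} l d → x ≡ encodeUnary l → y ≡ encodeUnary d →
                       ⟦ discrepancyᴾ ⟧ (x ∷ y ∷ []) ≡ encodeUnary (discrepancy l d)
    discrepancy-spec l d p q = absDiff-unary l (d ∸ l) p (monus-unary d l q p)

  opaque
    unfolding vertexCostᴾ
    vertexCost-spec : ∀ θ p v → ⟦ vertexCostᴾ ⟧ (M̂ ∷ Ŝ ∷ V̂ ∷ ⌜ θ ⌝ ∷ ⌜ p ⌝ ∷ ⌞ v ⌟ ∷ []) ≡ encodeUnary (vertexCost θ p v)
    vertexCost-spec θ p v = discrepancy-spec (leftOf θ p v) (degree v) (leftOf-spec θ p v) (degree-spec v)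

  opaque
    unfolding smallerTwinsᴾ
    smallerTwins-spec : ∀ r → ⟦ smallerTwinsᴾ ⟧ (M̂ ∷ Ŝ ∷ V̂ ∷ ⌞ r ⌟ ∷ []) ≡ encodeUnary (smallerTwins r)
    smallerTwins-spec r = sum-bits _ refl λ u →
      and-bool _ _ (less-unary (toℕ u) (toℕ r) refl refl)
        (and-bool _ _ (not-bool (lookup S u) (cover-spec u)) (adjacent-spec r u))

  opaque
    unfolding inClassᴾ sameᴾ
    inClass-spec : ∀ r v → ⟦ inClassᴾ ⟧ (M̂ ∷ Ŝ ∷ V̂ ∷ ⌞ r ⌟ ∷ ⌞ v ⌟ ∷ []) ≡ encodeBool (inClass r v)
    inClass-spec r v =
      and-bool _ _ (not-bool (lookup S r) (cover-spec r))
      (and-bool _ _ (not-bool (lookup S v) (cover-spec v))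
      (and-bool _ _ (or-bool (same r v) _
          (and-bool _ _ (leq-unary (toℕ r) (toℕ v) refl refl) (leq-unary (toℕ v) (toℕ r) refl refl))
          (adjacent-spec r v))
        (not-unary (smallerTwins r) (smallerTwins-spec r))))

  opaque
    unfolding classCostᴾ
    classCost-spec : ∀ θ p r → ⟦ classCostᴾ ⟧ (M̂ ∷ Ŝ ∷ V̂ ∷ ⌜ θ ⌝ ∷ ⌜ p ⌝ ∷ ⌞ r ⌟ ∷ []) ≡ encodeUnary (classCost θ p r)
    classCost-spec θ p r = sum-table _ refl λ v → trans
      (if-bool (inClass r v) (inClass-spec r v) (vertexCost-spec θ p v) refl)
      (if-unary (inClass r v))

  opaque
    unfolding classLeftᴾ
    classLeft-spec : ∀ θ p r s →
      ⟦ classLeftᴾ ⟧ (M̂ ∷ Ŝ ∷ V̂ ∷ ⌜ θ ⌝ ∷ ⌜ p ⌝ ∷ ⌞ r ⌟ ∷ ⌞ s ⌟ ∷ []) ≡ encodeUnary (classLeft θ p r s)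
    classLeft-spec θ p r s = sum-bits _ refl λ v →
      and-bool _ _ (inClass-spec r v) (and-bool _ _ (adjacent-spec s v) (and-bool _ _ (cover-spec s)
        (leq-unary (key θ v) (p ‼ s) (key-spec θ v) (coordinate-spec p s))))

  cost-spec : ∀ x → headTree ⌜ x ⌝ ≡ encodeUnary (cost x)
  cost-spec (c ∷ _) = refl

  opaque
    unfolding mismatchᴾ
    mismatch-spec : ∀ θ p r l u →
      ⟦ mismatchᴾ ⟧ (M̂ ∷ Ŝ ∷ V̂ ∷ ⌜ θ ⌝ ∷ ⌜ p ⌝ ∷ ⌞ r ⌟ ∷ ⌜ l ⌝ ∷ ⌜ u ⌝ ∷ []) ≡ encodeUnary (mismatch θ p r l u)
    mismatch-spec θ p r l u = append-unary ∣ cost u - (cost l + classCost θ p r) ∣ _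
      (absDiff-unary (cost u) _ (cost-spec u)
        (append-unary (cost l) (classCost θ p r) (cost-spec l) (classCost-spec θ p r)))
      (sum-table _ refl λ s →
        absDiff-unary (u ‼ s) _ (coordinate-spec u s)
          (append-unary (l ‼ s) _ (coordinate-spec l s) (classLeft-spec θ p r s)))

  opaque
    unfolding weightᴾ
    weight-spec : ∀ x → ⟦ weightᴾ ⟧ (V̂ ∷ ⌜ x ⌝ ∷ []) ≡ encodeUnary (weight x)
    weight-spec x = append-unary (cost x) _ (cost-spec x)
      (sum-table _ refl (coordinate-spec x))

  opaque
    unfolding coverPrecedesᴾ
    coverPrecedes-spec : ∀ p s s′ →
      ⟦ coverPrecedesᴾ ⟧ (Ŝ ∷ ⌜ p ⌝ ∷ ⌞ s ⌟ ∷ ⌞ s′ ⌟ ∷ []) ≡ encodeBool (coverPrecedes p s s′)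
    coverPrecedes-spec p s s′ = and-bool _ _ (cover-spec s)
      (or-bool (p ‼ s <ᵇ p ‼ s′) _ (less-unary (p ‼ s) (p ‼ s′) (coordinate-spec p s) (coordinate-spec p s′))
        (and-bool _ _ (leq-unary (p ‼ s) (p ‼ s′) (coordinate-spec p s) (coordinate-spec p s′))
          (less-unary (toℕ s) (toℕ s′) refl refl)))

  opaque
    unfolding coverLeftᴾ
    coverLeft-spec : ∀ p x s →
      ⟦ coverLeftᴾ ⟧ (M̂ ∷ Ŝ ∷ V̂ ∷ ⌜ p ⌝ ∷ ⌜ x ⌝ ∷ ⌞ s ⌟ ∷ []) ≡ encodeUnary (coverLeft p x s)
    coverLeft-spec p x s = append-unary (x ‼ s) _ (coordinate-spec x s)
      (sum-bits _ refl λ u →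
        and-bool _ _ (adjacent-spec s u) (coverPrecedes-spec p u s))

  opaque
    unfolding totalᴾ
    total-spec : ∀ p x → ⟦ totalᴾ ⟧ (M̂ ∷ Ŝ ∷ V̂ ∷ ⌜ p ⌝ ∷ ⌜ x ⌝ ∷ []) ≡ encodeUnary (total p x)
    total-spec p x = append-unary (cost x) _ (cost-spec x)
      (sum-table _ refl λ s → trans
        (if-bool (lookup S s) (cover-spec s)
          (discrepancy-spec (coverLeft p x s) (degree s) (coverLeft-spec p x s) (degree-spec s)) refl)
        (if-unary (lookup S s)))

  module _ (U : List State) where

    private
      Û : Tree
      Û = encodeList ⌜_⌝ U

    opaque
      unfolding stepᴾ
      step-spec : ∀ p r L → ⟦ stepᴾ ⟧ (M̂ ∷ Ŝ ∷ V̂ ∷ Û ∷ ⌜ p ⌝ ∷ ⌞ r ⌟ ∷ encodeList ⌜_⌝ L ∷ [])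
                            ≡ encodeList ⌜_⌝ (step U p r L)
      step-spec p r L = filter-list {enc = ⌜_⌝} U _ refl λ u →
        any-list {enc = ⌜_⌝} L _ refl λ l →
          any-list {enc = ⌜_⌝} U _ refl λ θ →
            not-unary (mismatch θ p r l u) (mismatch-spec θ p r l u)

    opaque
      unfolding reachᴾ
      reach-spec : ∀ p → ⟦ reachᴾ ⟧ (M̂ ∷ Ŝ ∷ V̂ ∷ Û ∷ ⌜ p ⌝ ∷ []) ≡ encodeList ⌜_⌝ (reach U p id)
      reach-spec p = go id
        where
        ρ : Vec Tree 5
        ρ = M̂ ∷ Ŝ ∷ V̂ ∷ Û ∷ ⌜ p ⌝ ∷ []

        go : ∀ {m} (e : Fin m → Fin n) →
             foldTree (λ r L → ⟦ stepᴾ ⟧ (M̂ ∷ Ŝ ∷ V̂ ∷ Û ∷ ⌜ p ⌝ ∷ r ∷ L ∷ []))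
               (⟦ filterᴾ (arg (# 3)) (notᴾ $ᴾ ((weightᴾ $ᴾ (arg (# 3) ∷ arg (# 0) ∷ [])) ∷ [])) ⟧ ρ)
               (encodeTable (encodeVertex ∘ e))
             ≡ encodeList ⌜_⌝ (reach U p e)
        go {zero}  e = filter-list {enc = ⌜_⌝} U _ refl λ x → not-unary (weight x) (weight-spec x)
        go {suc m} e = trans
          (cong (λ L → ⟦ stepᴾ ⟧ (M̂ ∷ Ŝ ∷ V̂ ∷ Û ∷ ⌜ p ⌝ ∷ ⌞ e zero ⌟ ∷ L ∷ [])) (go (e ∘ suc)))
          (step-spec p (e zero) (reach U p (e ∘ suc)))

    opaque
      unfolding acceptᴾ
      accept-spec : ∀ τ → ⟦ acceptᴾ ⟧ (M̂ ∷ Ŝ ∷ V̂ ∷ Û ∷ encodeUnary τ ∷ []) ≡ encodeBool (accept U τ)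
      accept-spec τ = any-list {enc = ⌜_⌝} U _ refl λ p →
        any-list {enc = ⌜_⌝} (reach U p id) _ (reach-spec p) λ x →
          leq-unary (total p x) τ (total-spec p x) refl

-- Counting and layouts

T-iff : ∀ {a b} → (T a → T b) → (T b → T a) → a ≡ b
T-iff {true}  {true}  f g = refl
T-iff {true}  {false} f g = ⊥-elim (f tt)
T-iff {false} {true}  f g = ⊥-elim (g tt)
T-iff {false} {false} f g = refl

T⇒≡ : ∀ {a} → T a → a ≡ true
T⇒≡ {true} _ = refl

≡⇒T : ∀ {a} → a ≡ true → T a
≡⇒T refl = tt

¬T⇒≡ : ∀ {a} → ¬ T a → a ≡ false
¬T⇒≡ {true}  ¬t = ⊥-elim (¬t tt)
¬T⇒≡ {false} _  = refl

∧-split : ∀ {a b} → T (a ∧ b) → T a × T b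
∧-split = Equivalence.to T-∧

∧-join : ∀ {a b} → T a → T b → T (a ∧ b)
∧-join p q = Equivalence.from T-∧ (p , q)

∨-split : ∀ {a b} → T (a ∨ b) → T a ⊎ T b
∨-split = Equivalence.to T-∨

∨-join : ∀ {a b} → T a ⊎ T b → T (a ∨ b)
∨-join = Equivalence.from T-∨

not-split : ∀ {a} → T (not a) → ¬ T a
not-split {false} _ ()

not-join : ∀ {a} → ¬ T a → T (not a)
not-join {true}  f = f tt
not-join {false} f = tt

does-T : ∀ {P : Set} (d : Dec P) → T (does d) → P
does-T (yes p) _ = p

T-does : ∀ {P : Set} (d : Dec P) → P → T (does d)
T-does (yes _) _ = tt
T-does (no ¬p) p = ¬p p

∧-congʳ : ∀ a {b c} → (T a → b ≡ c) → a ∧ b ≡ a ∧ c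
∧-congʳ true  h = h tt
∧-congʳ false h = refl

any⁺ : ∀ {A : Set} (b : A → Bool) {x xs} → x ∈ˡ xs → T (b x) → T (any b xs)
any⁺ b (here refl) t = ∨-join (inj₁ t)
any⁺ b {xs = y ∷ _} (there x∈) t = ∨-join {b y} (inj₂ (any⁺ b x∈ t))

any⁻ : ∀ {A : Set} (b : A → Bool) xs → T (any b xs) → ∃[ x ] x ∈ˡ xs × T (b x)
any⁻ b (x ∷ xs) t with ∨-split {b x} t
... | inj₁ p = x , here refl , p
... | inj₂ q with any⁻ b xs q
...   | y , y∈ , p = y , there y∈ , p

filter⁺ : ∀ {A : Set} (b : A → Bool) {x xs} → x ∈ˡ xs → T (b x) → x ∈ˡ filterᵇ b xs
filter⁺ b {xs = y ∷ xs} (here refl) t with b y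
... | true = here refl
filter⁺ b {xs = y ∷ xs} (there x∈) t with b y
... | true  = there (filter⁺ b x∈ t)
... | false = filter⁺ b x∈ t

filter⁻ : ∀ {A : Set} (b : A → Bool) {x} xs → x ∈ˡ filterᵇ b xs → x ∈ˡ xs × T (b x)
filter⁻ b (y ∷ xs) x∈ with b y in eq
filter⁻ b (y ∷ xs) (here refl) | true = here refl , ≡⇒T eq
filter⁻ b (y ∷ xs) (there x∈)  | true with filter⁻ b xs x∈
... | p , q = there p , q
filter⁻ b (y ∷ xs) x∈ | false with filter⁻ b xs x∈
... | p , q = there p , q

isZero⁺ : ∀ {m} → m ≡ 0 → T (isZero m)
isZero⁺ refl = tt

isZero⁻ : ∀ m → T (isZero m) → m ≡ 0
isZero⁻ zero _ = refl

sum-mono : ∀ {n} {f g : Fin n → ℕ} → (∀ i → f i ≤ g i) → sum f ≤ sum g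
sum-mono {zero}  h = z≤n
sum-mono {suc n} h = +-mono-≤ (h zero) (sum-mono (h ∘ suc))

sum-strict : ∀ {n} {f g : Fin n → ℕ} → (∀ i → f i ≤ g i) → ∀ i → f i < g i → sum f < sum g
sum-strict h zero    l = +-mono-<-≤ l (sum-mono (h ∘ suc))
sum-strict h (suc i) l = +-mono-≤-< (h zero) (sum-strict (h ∘ suc) i l)

sum-const : ∀ n c → sum {n} (λ _ → c) ≡ n * c
sum-const zero    c = refl
sum-const (suc n) c = cong (_+_ c) (sum-const n c)

sum-bounded : ∀ {n} {f : Fin n → ℕ} c → (∀ i → f i ≤ c) → sum f ≤ n * c
sum-bounded {n} c h = ≤-trans (sum-mono h) (≤-reflexive (sum-const n c))

bit≤1 : ∀ b → bit b ≤ 1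
bit≤1 true  = ≤-refl
bit≤1 false = z≤n

bit-mono : ∀ {a b} → (T a → T b) → bit a ≤ bit b
bit-mono {false}         h = z≤n
bit-mono {true}  {true}  h = ≤-refl
bit-mono {true}  {false} h = ⊥-elim (h tt)

bit-true : ∀ {a} → T a → bit a ≡ 1
bit-true {true} _ = refl

bit-false : ∀ {a} → ¬ T a → bit a ≡ 0
bit-false {true}  h = ⊥-elim (h tt)
bit-false {false} h = refl

count : ∀ {n} → (Fin n → Bool) → ℕ
count b = sum (bit ∘ b)

count≤ : ∀ {n} (b : Fin n → Bool) → count b ≤ n
count≤ {n} b = ≤-trans (sum-bounded 1 (bit≤1 ∘ b)) (≤-reflexive (*-identityʳ n))

count-mono : ∀ {n} {b c : Fin n → Bool} → (∀ i → T (b i) → T (c i)) → count b ≤ count c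
count-mono h = sum-mono (λ i → bit-mono (h i))

count-strict : ∀ {n} {b c : Fin n → Bool} → (∀ i → T (b i) → T (c i)) →
               ∀ i → ¬ T (b i) → T (c i) → count b < count c
count-strict h i p q = sum-strict (λ j → bit-mono (h j)) i
  (≤-reflexive (trans (cong suc (bit-false p)) (sym (bit-true q))))

count-zero⁻ : ∀ {n} (b : Fin n → Bool) → count b ≡ 0 → ∀ i → ¬ T (b i)
count-zero⁻ b p zero    t with b zero
count-zero⁻ b () zero   t | true
count-zero⁻ b p (suc i) t = count-zero⁻ (b ∘ suc) (m+n≡0⇒n≡0 (bit (b zero)) p) i t

count-zero⁺ : ∀ {n} {b : Fin n → Bool} → (∀ i → ¬ T (b i)) → count b ≡ 0
count-zero⁺ {n} h = trans (sum-cong-≗ (λ i → bit-false (h i))) (trans (sum-const n 0) (*-zeroʳ n))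

sum-zero⁻ : ∀ {n} (f : Fin n → ℕ) → sum f ≡ 0 → ∀ i → f i ≡ 0
sum-zero⁻ f p zero    = m+n≡0⇒m≡0 (f zero) p
sum-zero⁻ f p (suc i) = sum-zero⁻ (f ∘ suc) (m+n≡0⇒n≡0 (f zero) p) i

sum-zero⁺ : ∀ {n} {f : Fin n → ℕ} → (∀ i → f i ≡ 0) → sum f ≡ 0
sum-zero⁺ {n} h = trans (sum-cong-≗ h) (trans (sum-const n 0) (*-zeroʳ n))

sum-pick : ∀ {n} (b : Fin n → Bool) (f : Fin n → ℕ) i → T (b i) → (∀ j → T (b j) → j ≡ i) →
           sum (λ j → if b j then f j else 0) ≡ f i
sum-pick b f zero p u with b zero
... | true = trans (cong (_+_ (f zero)) (sum-zero⁺ (λ j → rest j))) (+-identityʳ _)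
  where
  rest : ∀ j → (if b (suc j) then f (suc j) else 0) ≡ 0
  rest j with b (suc j) in eq
  ... | false = refl
  ... | true  with u (suc j) (≡⇒T eq)
  ...   | ()
sum-pick b f (suc i) p u with b zero in eq
... | true  with u zero (≡⇒T eq)
...   | ()
sum-pick b f (suc i) p u | false = sum-pick (b ∘ suc) (f ∘ suc) i p (λ j t → suc-inj (u (suc j) t))
  where
  suc-inj : ∀ {n} {i j : Fin n} → Fin.suc i ≡ suc j → i ≡ j
  suc-inj refl = refl

-- The value `n` signals that no index qualifies; as a threshold it lies above all indices.
leastIndex : ∀ {n} (b : Fin n → Bool) →
  ∃[ m ] m ≤ n × (∀ i → T (b i) → m ≤ toℕ i) × (m < n → ∃[ i ] toℕ i ≡ m × T (b i))
leastIndex {zero}  b = 0 , z≤n , (λ ()) , λ ()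
leastIndex {suc n} b with b zero in eq
... | true  = 0 , z≤n , (λ _ _ → z≤n) , λ _ → zero , refl , ≡⇒T eq
... | false with leastIndex (b ∘ suc)
...   | m , m≤n , low , wit = suc m , s≤s m≤n
        , (λ { zero t → ⊥-elim (subst T eq t) ; (suc i) t → s≤s (low i t) })
        , λ { (s≤s m<n) → let i , p , q = wit m<n in suc i , cong suc p , q }

-- A missed value could be punched out of the codomain, leaving an injection into a smaller set.
injection⇒surjection : ∀ {n} (f : Fin n → Fin n) → (∀ {i j} → f i ≡ f j → i ≡ j) → ∀ y → ∃[ x ] f x ≡ y
injection⇒surjection {suc n} f inj y with any? (λ x → f x ≟ y)
... | yes p = p
... | no ¬p = contradiction (injective⇒≤ {f = g} g-injective) 1+n≰n
  where
  y≢ : ∀ x → y ≢ f x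
  y≢ x eq = ¬p (x , sym eq)
  g : Fin (suc n) → Fin n
  g x = punchOut (y≢ x)
  g-injective : ∀ {i j} → g i ≡ g j → i ≡ j
  g-injective {i} {j} eq = inj (punchOut-injective (y≢ i) (y≢ j) eq)

injection⇒permutation : ∀ {n} (f : Fin n → Fin n) → (∀ {i j} → f i ≡ f j → i ≡ j) →
                        Σ[ π ∈ Permutation′ n ] (∀ i → π ⟨$⟩ʳ i ≡ f i)
injection⇒permutation f inj =
  permutation f (proj₁ ∘ onto) (proj₂ ∘ onto) (λ x → inj (proj₂ (onto (f x)))) , λ i → refl
  where
  onto : ∀ y → ∃[ x ] f x ≡ y
  onto = injection⇒surjection f inj

-- Ties are broken by index, so any keys, repeated or not, give a strict linear order.
lexᵇ : ∀ {n} → (Fin n → ℕ) → Fin n → Fin n → Bool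
lexᵇ k u v = (k u <ᵇ k v) ∨ ((k u ≤ᵇ k v) ∧ (toℕ u <ᵇ toℕ v))

lex-split : ∀ {n} (k : Fin n → ℕ) u v → T (lexᵇ k u v) → k u < k v ⊎ (k u ≤ k v × toℕ u < toℕ v)
lex-split k u v t with ∨-split {k u <ᵇ k v} t
... | inj₁ p = inj₁ (<ᵇ⇒< _ _ p)
... | inj₂ q with ∧-split {k u ≤ᵇ k v} q
...   | a , b = inj₂ (≤ᵇ⇒≤ _ _ a , <ᵇ⇒< _ _ b)

lex-join : ∀ {n} (k : Fin n → ℕ) u v → k u < k v ⊎ (k u ≤ k v × toℕ u < toℕ v) → T (lexᵇ k u v)
lex-join k u v (inj₁ p)       = ∨-join (inj₁ (<⇒<ᵇ p))
lex-join k u v (inj₂ (p , q)) = ∨-join {k u <ᵇ k v} (inj₂ (∧-join (≤⇒≤ᵇ p) (<⇒<ᵇ q)))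

lex-irreflexive : ∀ {n} (k : Fin n → ℕ) v → ¬ T (lexᵇ k v v)
lex-irreflexive k v t with lex-split k v v t
... | inj₁ p       = <-irrefl refl p
... | inj₂ (_ , p) = <-irrefl refl p

lex-trans : ∀ {n} (k : Fin n → ℕ) u v w → T (lexᵇ k u v) → T (lexᵇ k v w) → T (lexᵇ k u w)
lex-trans k u v w s t with lex-split k u v s | lex-split k v w t
... | inj₁ p       | inj₁ q       = lex-join k u w (inj₁ (<-trans p q))
... | inj₁ p       | inj₂ (q , _) = lex-join k u w (inj₁ (<-≤-trans p q))
... | inj₂ (p , _) | inj₁ q       = lex-join k u w (inj₁ (≤-<-trans p q))
... | inj₂ (p , x) | inj₂ (q , y) = lex-join k u w (inj₂ (≤-trans p q , <-trans x y))

lex-total : ∀ {n} (k : Fin n → ℕ) u v → u ≢ v → T (lexᵇ k u v) ⊎ T (lexᵇ k v u)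
lex-total k u v u≢v with <-cmp (k u) (k v) | <-cmp (toℕ u) (toℕ v)
... | tri< p _ _ | _          = inj₁ (lex-join k u v (inj₁ p))
... | tri> _ _ p | _          = inj₂ (lex-join k v u (inj₁ p))
... | tri≈ _ e _ | tri< p _ _ = inj₁ (lex-join k u v (inj₂ (≤-reflexive e , p)))
... | tri≈ _ e _ | tri> _ _ p = inj₂ (lex-join k v u (inj₂ (≤-reflexive (sym e) , p)))
... | tri≈ _ _ _ | tri≈ _ e _ = ⊥-elim (u≢v (toℕ-injective e))

-- The position of a vertex is its number of predecessors. By transitivity and irreflexivity this is
-- strictly monotone along the order; totality then makes it injective and order-reflecting.
layoutOf : ∀ {n} (k : Fin n → ℕ) →
           Σ[ σ ∈ Permutation′ n ] ∀ u v → does ((σ ⟨$⟩ʳ u) <?ᶠ (σ ⟨$⟩ʳ v)) ≡ lexᵇ k u v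
layoutOf {n} k = proj₁ perm , λ u v → T-iff (fwd u v ∘ does-T ((proj₁ perm ⟨$⟩ʳ u) <?ᶠ (proj₁ perm ⟨$⟩ʳ v)))
                                            (T-does ((proj₁ perm ⟨$⟩ʳ u) <?ᶠ (proj₁ perm ⟨$⟩ʳ v)) ∘ bwd u v)
  where
  rank : Fin n → ℕ
  rank v = count (λ u → lexᵇ k u v)

  rank<n : ∀ v → rank v < n
  rank<n v = <-≤-trans
    (count-strict {b = λ u → lexᵇ k u v} {c = λ _ → true} (λ _ _ → tt) v (lex-irreflexive k v) tt)
    (count≤ (λ _ → true))

  rank-mono : ∀ u v → T (lexᵇ k u v) → rank u < rank v
  rank-mono u v t = count-strict (λ w s → lex-trans k w u v s t) u (lex-irreflexive k u) t

  rank-reflects : ∀ u v → rank u < rank v → T (lexᵇ k u v)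
  rank-reflects u v p with u ≟ v
  ... | yes refl = ⊥-elim (<-irrefl refl p)
  ... | no  u≢v with lex-total k u v u≢v
  ...   | inj₁ t = t
  ...   | inj₂ t = ⊥-elim (<-asym p (rank-mono v u t))

  position : Fin n → Fin n
  position v = fromℕ< (rank<n v)

  position-rank : ∀ {u v} → position u ≡ position v → rank u ≡ rank v
  position-rank {u} {v} e = trans (sym (toℕ-fromℕ< (rank<n u))) (trans (cong toℕ e) (toℕ-fromℕ< (rank<n v)))

  position-injective : ∀ {u v} → position u ≡ position v → u ≡ v
  position-injective {u} {v} e with u ≟ v
  ... | yes u≡v = u≡v
  ... | no  u≢v with lex-total k u v u≢v
  ...   | inj₁ t = ⊥-elim (<-irrefl (position-rank e) (rank-mono u v t))
  ...   | inj₂ t = ⊥-elim (<-irrefl (sym (position-rank e)) (rank-mono v u t))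

  perm : Σ[ π ∈ Permutation′ n ] ∀ i → π ⟨$⟩ʳ i ≡ position i
  perm = injection⇒permutation position position-injective

  at : ∀ v → toℕ (proj₁ perm ⟨$⟩ʳ v) ≡ rank v
  at v = trans (cong toℕ (proj₂ perm v)) (toℕ-fromℕ< (rank<n v))

  fwd : ∀ u v → toℕ (proj₁ perm ⟨$⟩ʳ u) < toℕ (proj₁ perm ⟨$⟩ʳ v) → T (lexᵇ k u v)
  fwd u v p = rank-reflects u v (subst (_< rank v) (at u) (subst (toℕ (proj₁ perm ⟨$⟩ʳ u) <_) (at v) p))

  bwd : ∀ u v → T (lexᵇ k u v) → toℕ (proj₁ perm ⟨$⟩ʳ u) < toℕ (proj₁ perm ⟨$⟩ʳ v)
  bwd u v t = subst (_< toℕ (proj₁ perm ⟨$⟩ʳ v)) (sym (at u)) (subst (rank u <_) (sym (at v)) (rank-mono u v t))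

-- Twin classes and the dynamic program

-- Comparison of interleaved keys, 2a outside the cover and 2b + 1 inside, with `z` as tie test.
-- Keys of different parity never tie, so the tie test survives only between keys of equal parity.
odd-odd : ∀ a b z → ((suc (2 * a) <ᵇ suc (2 * b)) ∨ ((suc (2 * a) ≤ᵇ suc (2 * b)) ∧ z)) ≡ ((a <ᵇ b) ∨ ((a ≤ᵇ b) ∧ z))
odd-odd a b z = T-iff fwd bwd
  where
  fwd : T ((suc (2 * a) <ᵇ suc (2 * b)) ∨ ((suc (2 * a) ≤ᵇ suc (2 * b)) ∧ z)) → T ((a <ᵇ b) ∨ ((a ≤ᵇ b) ∧ z))
  fwd t with ∨-split {suc (2 * a) <ᵇ suc (2 * b)} t
  ... | inj₁ q = ∨-join (inj₁ (<⇒<ᵇ (*-cancelˡ-< 2 a b (≤-pred (<ᵇ⇒< (suc (2 * a)) (suc (2 * b)) q)))))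
  ... | inj₂ q with ∧-split {suc (2 * a) ≤ᵇ suc (2 * b)} q
  ...   | x , y = ∨-join {a <ᵇ b} (inj₂ (∧-join (≤⇒≤ᵇ {a} (*-cancelˡ-≤ {a} 2 (≤-pred (≤ᵇ⇒≤ (suc (2 * a)) (suc (2 * b)) x)))) y))
  bwd : T ((a <ᵇ b) ∨ ((a ≤ᵇ b) ∧ z)) → T ((suc (2 * a) <ᵇ suc (2 * b)) ∨ ((suc (2 * a) ≤ᵇ suc (2 * b)) ∧ z))
  bwd t with ∨-split {a <ᵇ b} t
  ... | inj₁ q = ∨-join (inj₁ (<⇒<ᵇ (s≤s (*-monoʳ-< 2 (<ᵇ⇒< a b q)))))
  ... | inj₂ q with ∧-split {a ≤ᵇ b} q
  ...   | x , y = ∨-join {suc (2 * a) <ᵇ suc (2 * b)} (inj₂ (∧-join (≤⇒≤ᵇ {suc (2 * a)} (s≤s (*-monoʳ-≤ 2 (≤ᵇ⇒≤ a b x)))) y))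

even-odd : ∀ a b z → ((2 * a <ᵇ suc (2 * b)) ∨ ((2 * a ≤ᵇ suc (2 * b)) ∧ z)) ≡ (a ≤ᵇ b)
even-odd a b z = T-iff fwd bwd
  where
  fwd : T ((2 * a <ᵇ suc (2 * b)) ∨ ((2 * a ≤ᵇ suc (2 * b)) ∧ z)) → T (a ≤ᵇ b)
  fwd t with ∨-split {2 * a <ᵇ suc (2 * b)} t
  ... | inj₁ q = ≤⇒≤ᵇ {a} (*-cancelˡ-≤ {a} 2 (≤-pred (<ᵇ⇒< (2 * a) (suc (2 * b)) q)))
  ... | inj₂ q = ≤⇒≤ᵇ {a} (≤-pred (*-cancelˡ-< 2 a (suc b) (≤-trans (s≤s (≤ᵇ⇒≤ (2 * a) _ (proj₁ (∧-split {2 * a ≤ᵇ suc (2 * b)} q))))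
      (≤-reflexive (sym (*-suc 2 b))))))
  bwd : T (a ≤ᵇ b) → T ((2 * a <ᵇ suc (2 * b)) ∨ ((2 * a ≤ᵇ suc (2 * b)) ∧ z))
  bwd t = ∨-join (inj₁ (<⇒<ᵇ (s≤s (*-monoʳ-≤ 2 (≤ᵇ⇒≤ a b t)))))

odd-even : ∀ b a z → ((suc (2 * b) <ᵇ 2 * a) ∨ ((suc (2 * b) ≤ᵇ 2 * a) ∧ z)) ≡ not (a ≤ᵇ b)
odd-even b a z = T-iff fwd bwd
  where
  fwd : T ((suc (2 * b) <ᵇ 2 * a) ∨ ((suc (2 * b) ≤ᵇ 2 * a) ∧ z)) → T (not (a ≤ᵇ b))
  fwd t = not-join λ a≤b → <⇒≱ (b<a (∨-split {suc (2 * b) <ᵇ 2 * a} t)) (≤ᵇ⇒≤ a b a≤b)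
    where
    b<a : T (suc (2 * b) <ᵇ 2 * a) ⊎ T ((suc (2 * b) ≤ᵇ 2 * a) ∧ z) → b < a
    b<a (inj₁ q) = *-cancelˡ-< 2 b a (<⇒≤ (<ᵇ⇒< (suc (2 * b)) _ q))
    b<a (inj₂ q) = *-cancelˡ-< 2 b a (≤ᵇ⇒≤ _ _ (proj₁ (∧-split {suc (2 * b) ≤ᵇ 2 * a} q)))
  bwd : T (not (a ≤ᵇ b)) → T ((suc (2 * b) <ᵇ 2 * a) ∨ ((suc (2 * b) ≤ᵇ 2 * a) ∧ z))
  bwd t = ∨-join (inj₁ (<⇒<ᵇ (≤-trans (≤-reflexive (sym (*-suc 2 b)))
    (*-monoʳ-≤ 2 (≰⇒> (λ a≤b → not-split t (≤⇒≤ᵇ {a} a≤b)))))))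

-- Within a class keys are weakly monotone in the index, so comparing keys and then indices amounts
-- to comparing indices.
even-even : ∀ a b u v → u ≢ v → (u < v → a ≤ b) → (v < u → b ≤ a) →
            ((2 * a <ᵇ 2 * b) ∨ ((2 * a ≤ᵇ 2 * b) ∧ (u <ᵇ v))) ≡ (u <ᵇ v)
even-even a b u v u≢v up down = T-iff fwd bwd
  where
  fwd : T ((2 * a <ᵇ 2 * b) ∨ ((2 * a ≤ᵇ 2 * b) ∧ (u <ᵇ v))) → T (u <ᵇ v)
  fwd t with ∨-split {2 * a <ᵇ 2 * b} t
  ... | inj₂ q = proj₂ (∧-split {2 * a ≤ᵇ 2 * b} q)
  ... | inj₁ q with <-cmp u v
  ...   | tri< l _ _ = <⇒<ᵇ l
  ...   | tri≈ _ e _ = ⊥-elim (u≢v e)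
  ...   | tri> _ _ g = ⊥-elim (<⇒≱ (*-cancelˡ-< 2 a b (<ᵇ⇒< (2 * a) (2 * b) q)) (down g))
  bwd : T (u <ᵇ v) → T ((2 * a <ᵇ 2 * b) ∨ ((2 * a ≤ᵇ 2 * b) ∧ (u <ᵇ v)))
  bwd t = ∨-join {2 * a <ᵇ 2 * b} (inj₂ (∧-join (≤⇒≤ᵇ {2 * a} (*-monoʳ-≤ 2 (up (<ᵇ⇒< u v t)))) t))

module TwinCover {n : ℕ} (A : Fin n → Fin n → Bool) (S : Fin n → Bool)
  (A-symmetric   : ∀ {u v} → T (A u v) → T (A v u))
  (A-irreflexive : ∀ {v} → ¬ T (A v v))
  (twins         : ∀ {u v} → ¬ T (S u) → ¬ T (S v) → T (A u v) →
                   ∀ {w} → w ≢ v → T (A u w) → T (A v w))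
  where

  open Search A S public

  Relation : Set
  Relation = Fin n → Fin n → Bool

  leftCount : Relation → Fin n → ℕ
  leftCount R v = count (λ u → A v u ∧ R u v)

  relationImbalance : Relation → ℕ
  relationImbalance R = sum (λ v → discrepancy (leftCount R v) (degree v))

  -- Agreement on adjacent pairs is enough, so a relation that is not a linear order can stand in
  -- for a layout.
  relationImbalance-cong : ∀ {R Q} → (∀ u v → T (A v u) → R u v ≡ Q u v) →
                           relationImbalance R ≡ relationImbalance Q
  relationImbalance-cong {R} {Q} h = sum-cong-≗ λ v → cong (λ l → discrepancy l (degree v))
    (sum-cong-≗ λ u → cong bit (∧-congʳ (A v u) (h u v)))

  same⁻ : ∀ {r v} → T (same r v) → r ≡ v
  same⁻ {r} {v} t with ∧-split {toℕ r ≤ᵇ toℕ v} t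
  ... | p , q = toℕ-injective (≤-antisym (≤ᵇ⇒≤ _ _ p) (≤ᵇ⇒≤ _ _ q))

  same⁺ : ∀ v → T (same v v)
  same⁺ v = ∧-join (≤⇒≤ᵇ {toℕ v} ≤-refl) (≤⇒≤ᵇ {toℕ v} ≤-refl)

  record InClass (r v : Fin n) : Set where
    constructor inClass-of
    field
      r∉S     : ¬ T (S r)
      v∉S     : ¬ T (S v)
      twin    : r ≡ v ⊎ T (A r v)
      minimal : ∀ u → toℕ u < toℕ r → ¬ T (S u) → ¬ T (A r u)

  inClass⁻ : ∀ {r v} → T (inClass r v) → InClass r v
  inClass⁻ {r} {v} t with ∧-split {not (S r)} t
  ... | r∉ , t₁ with ∧-split {not (S v)} t₁
  ... | v∉ , t₂ with ∧-split {same r v ∨ A r v} t₂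
  ... | tw , z = inClass-of (not-split r∉) (not-split v∉) (twin (∨-split {same r v} tw))
    λ u u<r u∉ a → count-zero⁻ _ (isZero⁻ (smallerTwins r) z) u
      (∧-join (<⇒<ᵇ u<r) (∧-join (not-join u∉) a))
    where
    twin : T (same r v) ⊎ T (A r v) → r ≡ v ⊎ T (A r v)
    twin (inj₁ s) = inj₁ (same⁻ s)
    twin (inj₂ a) = inj₂ a

  inClass⁺ : ∀ {r v} → InClass r v → T (inClass r v)
  inClass⁺ {r} {v} (inClass-of r∉ v∉ tw mn) =
    ∧-join (not-join r∉) (∧-join (not-join v∉) (∧-join (∨-join {same r v} (twin tw))
      (isZero⁺ (count-zero⁺ none))))
    where
    twin : r ≡ v ⊎ T (A r v) → T (same r v) ⊎ T (A r v)
    twin (inj₁ refl) = inj₁ (same⁺ r)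
    twin (inj₂ a)    = inj₂ a

    none : ∀ u → ¬ T ((toℕ u <ᵇ toℕ r) ∧ (not (S u) ∧ A r u))
    none u t with ∧-split {toℕ u <ᵇ toℕ r} t
    ... | p , q with ∧-split {not (S u)} q
    ... | u∉ , a = mn u (<ᵇ⇒< _ _ p) (not-split u∉) a

  classmates : ∀ {r u v} → InClass r u → InClass r v → u ≢ v → T (A u v)
  classmates (inClass-of _ _ (inj₁ refl) _) (inClass-of _ _ (inj₁ refl) _) u≢v = ⊥-elim (u≢v refl)
  classmates (inClass-of _ _ (inj₁ refl) _) (inClass-of _ _ (inj₂ a) _)    u≢v = a
  classmates (inClass-of _ _ (inj₂ a) _)    (inClass-of _ _ (inj₁ refl) _) u≢v = A-symmetric a
  classmates (inClass-of r∉ u∉ (inj₂ a) _)  (inClass-of _ _ (inj₂ b) _)    u≢v =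
    twins r∉ u∉ a (u≢v ∘ sym) b

  inClass-neighbour : ∀ {r u v} → InClass r v → ¬ T (S u) → T (A v u) → InClass r u
  inClass-neighbour (inClass-of r∉ v∉ (inj₁ refl) mn) u∉ a = inClass-of r∉ u∉ (inj₂ a) mn
  inClass-neighbour {r} {u} (inClass-of r∉ v∉ (inj₂ b) mn) u∉ a with r ≟ u
  ... | yes r≡u = inClass-of r∉ u∉ (inj₁ r≡u) mn
  ... | no  r≢u = inClass-of r∉ u∉ (inj₂ (twins v∉ r∉ (A-symmetric b) (r≢u ∘ sym) a)) mn

  representatives-adjacent : ∀ {r q v} → InClass r v → InClass q v → r ≢ q → T (A r q)
  representatives-adjacent {r} {q} {v} c d r≢q = adjacent (flip c) (flip d)
    where
    flip : ∀ {r} → InClass r v → r ≡ v ⊎ T (A v r)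
    flip (inClass-of _ _ (inj₁ e) _) = inj₁ e
    flip (inClass-of _ _ (inj₂ a) _) = inj₂ (A-symmetric a)
    adjacent : r ≡ v ⊎ T (A v r) → q ≡ v ⊎ T (A v q) → T (A r q)
    adjacent (inj₁ refl) (inj₁ refl) = ⊥-elim (r≢q refl)
    adjacent (inj₁ refl) (inj₂ a)    = a
    adjacent (inj₂ a)    (inj₁ refl) = A-symmetric a
    adjacent (inj₂ a)    (inj₂ b)    = twins (InClass.v∉S c) (InClass.r∉S c) a (r≢q ∘ sym) b

  -- Distinct representatives of one vertex would be adjacent to each other, and the larger one
  -- would violate its minimality.
  inClass-unique : ∀ {r q v} → InClass r v → InClass q v → r ≡ q
  inClass-unique {r} {q} c d with r ≟ q
  ... | yes r≡q = r≡q
  ... | no  r≢q with <-cmp (toℕ r) (toℕ q)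
  ...   | tri≈ _ e _ = toℕ-injective e
  ...   | tri< l _ _ =
    ⊥-elim (InClass.minimal d r l (InClass.r∉S c) (A-symmetric (representatives-adjacent c d r≢q)))
  ...   | tri> _ _ g = ⊥-elim (InClass.minimal c q g (InClass.r∉S d) (representatives-adjacent c d r≢q))

  -- Takes the least index among `v` and its neighbours outside `S`. A smaller neighbour of it
  -- outside `S` would, by the twin property, itself be `v` or adjacent to `v`.
  representative : ∀ v → ¬ T (S v) → ∃[ r ] InClass r v
  representative v v∉ with leastIndex (λ u → not (S u) ∧ (same u v ∨ A u v))
  ... | m , _ , low , wit = found
    where
    v-in : T (not (S v) ∧ (same v v ∨ A v v))
    v-in = ∧-join (not-join v∉) (∨-join (inj₁ (same⁺ v)))

    found : ∃[ r ] InClass r v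
    found with wit (≤-<-trans (low v v-in) (toℕ<n v))
    ... | r , refl , t with ∧-split {not (S r)} t
    ... | r∉ , e = r , inClass-of (not-split r∉) v∉ (twin (∨-split {same r v} e)) λ u u<r u∉ a →
      <⇒≱ u<r (low u (∧-join (not-join u∉) (near u u∉ a (∨-split {same r v} e))))
      where
      twin : T (same r v) ⊎ T (A r v) → r ≡ v ⊎ T (A r v)
      twin (inj₁ s) = inj₁ (same⁻ s)
      twin (inj₂ a) = inj₂ a

      near : ∀ u → ¬ T (S u) → T (A r u) → T (same r v) ⊎ T (A r v) → T (same u v ∨ A u v)
      near u u∉ a (inj₁ s) with same⁻ {r} {v} s
      ... | refl = ∨-join {same u v} (inj₂ (A-symmetric a))
      near u u∉ a (inj₂ b) with u ≟ v
      ... | yes refl = ∨-join (inj₁ (same⁺ u))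
      ... | no  u≢v  = ∨-join {same u v} (inj₂ (A-symmetric (twins (not-split r∉) v∉ b u≢v a)))

  opaque
    -- Made total by the default `v` inside the cover, where nothing is claimed about classes.
    represent : ∀ v → ∃[ r ] (¬ T (S v) → InClass r v)
    represent v with T? (S v)
    ... | yes v∈ = v , λ v∉ → ⊥-elim (v∉ v∈)
    ... | no  v∉ = proj₁ (representative v v∉) , λ _ → proj₂ (representative v v∉)

  rep : Fin n → Fin n
  rep v = proj₁ (represent v)

  rep-class : ∀ v → ¬ T (S v) → InClass (rep v) v
  rep-class v = proj₂ (represent v)

  sum-class : ∀ v (f : Fin n → ℕ) → sum (λ r → if inClass r v then f r else 0) ≡ (if S v then 0 else f (rep v))
  sum-class v f with T? (S v)
  ... | yes v∈ = trans
    (sum-zero⁺ (λ r → cong (λ b → if b then f r else 0) (¬T⇒≡ (λ t → InClass.v∉S (inClass⁻ {r} {v} t) v∈))))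
    (sym (cong (λ b → if b then 0 else f (rep v)) (T⇒≡ v∈)))
  ... | no  v∉ = trans
    (sum-pick (λ r → inClass r v) f (rep v) (inClass⁺ (rep-class v v∉))
      (λ r t → inClass-unique (inClass⁻ t) (rep-class v v∉)))
    (sym (cong (λ b → if b then 0 else f (rep v)) (¬T⇒≡ v∉)))

  -- After the sums are exchanged, only the unique class of each vertex outside the cover
  -- contributes.
  sum-classes : ∀ (f : Fin n → Fin n → ℕ) →
    sum (λ r → sum (λ v → if inClass r v then f r v else 0)) ≡ sum (λ v → if S v then 0 else f (rep v) v)
  sum-classes f = trans (∑-comm (λ r v → if inClass r v then f r v else 0))
    (sum-cong-≗ λ v → sum-class v (λ r → f r v))

  -- The relation whose left counts the search computes. It compares vertices outside the cover by
  -- index alone, which is meaningful only for twins, so it need not be a linear order.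
  order : State → (Fin n → State) → Relation
  order p θ u v =
    if S v then (if S u then coverPrecedes p u v else (key (θ (rep u)) u ≤ᵇ p ‼ v))
           else precedes (θ (rep v)) p v u

  record Collects {m} (p : State) (θ : Fin m → State) (e : Fin m → Fin n) (x : State) : Set where
    constructor collects
    field
      costs : cost x ≡ sum (λ i → classCost (θ i) p (e i))
      lefts : ∀ s → x ‼ s ≡ sum (λ i → classLeft (θ i) p (e i) s)

  if-∧ : ∀ a b → bit (a ∧ b) ≡ (if a then bit b else 0)
  if-∧ true  b = refl
  if-∧ false b = refl

  classCost-sum : ∀ p (θ : Fin n → State) → sum (λ r → classCost (θ r) p r) ≡
                  sum (λ v → if S v then 0 else vertexCost (θ (rep v)) p v)
  classCost-sum p θ = sum-classes (λ r v → vertexCost (θ r) p v)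

  classLeft-sum : ∀ p (θ : Fin n → State) s → sum (λ r → classLeft (θ r) p r s) ≡
    sum (λ u → if S u then 0 else bit (A s u ∧ (S s ∧ (key (θ (rep u)) u ≤ᵇ p ‼ s))))
  classLeft-sum p θ s = trans
    (sum-cong-≗ λ r → sum-cong-≗ λ u → if-∧ (inClass r u) _)
    (sum-classes (λ r u → bit (A s u ∧ (S s ∧ (key (θ r) u ≤ᵇ p ‼ s)))))

  -- The cost coordinate holds the imbalances outside the cover. For a cover vertex the state holds
  -- the number of left neighbours outside the cover, and `coverLeft` adds those inside.
  total-imbalance : ∀ p (θ : Fin n → State) x → Collects p θ id x → total p x ≡ relationImbalance (order p θ)
  total-imbalance p θ x (collects costs lefts) = begin
    cost x + sum coverPart                 ≡⟨ cong (_+ sum coverPart) (trans costs (classCost-sum p θ)) ⟩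
    sum outerPart + sum coverPart          ≡⟨ ∑-distrib-+ outerPart coverPart ⟨
    sum (λ v → outerPart v + coverPart v)  ≡⟨ sum-cong-≗ vertex ⟩
    relationImbalance (order p θ)          ∎
    where
    open ≡-Reasoning
    coverPart outerPart : Fin n → ℕ
    coverPart s = if S s then discrepancy (coverLeft p x s) (degree s) else 0
    outerPart v = if S v then 0 else vertexCost (θ (rep v)) p v

    R : Relation
    R = order p θ

    -- Each vertex contributes to at most one summand: the first vanishes inside the cover, the
    -- second outside.
    pointwise : ∀ su ss a l k z → ss ≡ true →
      (if su then 0 else bit (a ∧ (ss ∧ k))) + bit (a ∧ (su ∧ l)) ≡
      bit (a ∧ (if ss then (if su then su ∧ l else k) else z))
    pointwise true  true a l k z _ = refl
    pointwise false true a l k z _ = trans (cong (λ b → bit (a ∧ k) + bit b) (∧-zeroʳ a)) (+-identityʳ _)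

    cover-left : ∀ s → S s ≡ true → coverLeft p x s ≡ leftCount R s
    cover-left s s∈ = begin
      x ‼ s + inner                     ≡⟨ cong (_+ inner) (trans (lefts s) (classLeft-sum p θ s)) ⟩
      sum outer + inner                 ≡⟨ ∑-distrib-+ outer _ ⟨
      sum (λ u → outer u + bit (A s u ∧ coverPrecedes p u s))
        ≡⟨ sum-cong-≗ (λ u → pointwise (S u) (S s) (A s u) _ _ (precedes (θ (rep s)) p s u) s∈) ⟩
      leftCount R s                     ∎
      where
      inner : ℕ
      inner = sum (λ u → bit (A s u ∧ coverPrecedes p u s))
      outer : Fin n → ℕ
      outer u = if S u then 0 else bit (A s u ∧ (S s ∧ (key (θ (rep u)) u ≤ᵇ p ‼ s)))

    outer-left : ∀ v → S v ≡ false → leftOf (θ (rep v)) p v ≡ leftCount R v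
    outer-left v v∉ = sum-cong-≗ λ u → sym (cong
      (λ b → bit (A v u ∧ (if b then (if S u then coverPrecedes p u v else (key (θ (rep u)) u ≤ᵇ p ‼ v))
                                else precedes (θ (rep v)) p v u))) v∉)

    vertex : ∀ v → outerPart v + coverPart v ≡ discrepancy (leftCount R v) (degree v)
    vertex v with T? (S v)
    ... | yes v∈ = trans
      (cong (λ b → (if b then 0 else vertexCost (θ (rep v)) p v)
                 + (if b then discrepancy (coverLeft p x v) (degree v) else 0)) (T⇒≡ v∈))
      (cong (λ l → discrepancy l (degree v)) (cover-left v (T⇒≡ v∈)))
    ... | no  v∉ = trans
      (cong (λ b → (if b then 0 else vertexCost (θ (rep v)) p v)
                 + (if b then discrepancy (coverLeft p x v) (degree v) else 0)) (¬T⇒≡ v∉))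
      (trans (+-identityʳ _) (cong (λ l → discrepancy l (degree v)) (outer-left v (¬T⇒≡ v∉))))

  -- Odd keys for cover vertices and even keys for the others: a vertex outside S with
  -- key i then sits between the cover vertices with keys less than i and the rest.
  orderKey : State → (Fin n → State) → Fin n → ℕ
  orderKey p θ v = if S v then suc (2 * (p ‼ v)) else 2 * key (θ (rep v)) v

  key-mono : ∀ θ {u v} → toℕ u ≤ toℕ v → key θ u ≤ key θ v
  key-mono θ {u} {v} u≤v = count-mono λ s t → let p , q = ∧-split {S s} t in
    ∧-join p (≤⇒≤ᵇ {θ ‼ s} (≤-trans (≤ᵇ⇒≤ (θ ‼ s) (toℕ u) q) u≤v))

  -- Adjacent vertices outside the cover share a representative, hence a guess, and `key` is
  -- monotone in the index for a fixed guess. The other cases are settled by parity or by the cover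
  -- keys themselves.
  orderKey-agrees : ∀ p θ u v → T (A v u) → lexᵇ (orderKey p θ) u v ≡ order p θ u v
  orderKey-agrees p θ u v a with S u in u≡ | S v in v≡
  ... | true  | true  = odd-odd (p ‼ u) (p ‼ v) _
  ... | false | true  = even-odd (key (θ (rep u)) u) (p ‼ v) _
  ... | true  | false = odd-even (p ‼ u) (key (θ (rep v)) v) _
  ... | false | false = even-even _ _ (toℕ u) (toℕ v) u≢v
    (λ u<v → subst (λ r → key (θ (rep u)) u ≤ key (θ r) v) rep≡ (key-mono (θ (rep u)) (<⇒≤ u<v)))
    (λ v<u → subst (λ r → key (θ r) v ≤ key (θ (rep u)) u) rep≡ (key-mono (θ (rep u)) (<⇒≤ v<u)))
    where
    u∉ : ¬ T (S u)
    u∉ = subst T u≡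
    v∉ : ¬ T (S v)
    v∉ = subst T v≡
    u≢v : toℕ u ≢ toℕ v
    u≢v e with toℕ-injective e
    ... | refl = A-irreflexive a
    rep≡ : rep u ≡ rep v
    rep≡ = inClass-unique (rep-class u u∉) (inClass-neighbour (rep-class v v∉) u∉ a)

  realize : ∀ p (θ : Fin n → State) x → Collects p θ id x →
            Σ[ σ ∈ Permutation′ n ]
              relationImbalance (λ u v → does ((σ ⟨$⟩ʳ u) <?ᶠ (σ ⟨$⟩ʳ v))) ≡ total p x
  realize p θ x c with layoutOf (orderKey p θ)
  ... | σ , h = σ , trans
    (relationImbalance-cong λ u v a → trans (h u v) (orderKey-agrees p θ u v a))
    (sym (total-imbalance p θ x c))

  module _ (U : List State) where

    reach-sound : ∀ p {m} (e : Fin m → Fin n) {x} → x ∈ˡ reach U p e →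
                  ∃[ θ ] Collects p θ e x
    reach-sound p {zero} e {x} x∈ with filter⁻ (isZero ∘ weight) U x∈
    ... | _ , t = (λ ()) , collects (m+n≡0⇒m≡0 (cost x) w≡0)
      (sum-zero⁻ _ (m+n≡0⇒n≡0 (cost x) w≡0))
      where
      w≡0 : weight x ≡ 0
      w≡0 = isZero⁻ (weight x) t
    reach-sound p {suc m} e {x} x∈ with filter⁻ _ U x∈
    ... | _ , t with any⁻ _ (reach U p (e ∘ suc)) t
    ... | l , l∈ , t′ with any⁻ _ U t′ | reach-sound p (e ∘ suc) l∈
    ... | θ , _ , z | θs , collects c h = θs′ , collects
      (trans (∣m-n∣≡0⇒m≡n (m+n≡0⇒m≡0 _ m≡0))
        (trans (+-comm (cost l) _) (cong (_+_ (classCost θ p (e zero))) c)))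
      (λ s → trans (∣m-n∣≡0⇒m≡n (sum-zero⁻ _ (m+n≡0⇒n≡0 ∣ cost x - (cost l + classCost θ p (e zero)) ∣ m≡0) s))
        (trans (+-comm (l ‼ s) _) (cong (_+_ (classLeft θ p (e zero) s)) (h s))))
      where
      θs′ : Fin (suc m) → State
      θs′ zero    = θ
      θs′ (suc i) = θs i
      m≡0 : mismatch θ p (e zero) l x ≡ 0
      m≡0 = isZero⁻ (mismatch θ p (e zero) l x) z

    collected : ∀ {m} → State → (Fin m → State) → (Fin m → Fin n) → State
    collected p θ e = sum (λ i → classCost (θ i) p (e i)) ∷ tabulate (λ s → sum (λ i → classLeft (θ i) p (e i) s))

    collected-lefts : ∀ {m} p θ (e : Fin m → Fin n) s → collected p θ e ‼ s ≡ sum (λ i → classLeft (θ i) p (e i) s)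
    collected-lefts p θ e s = lookup∘tabulate (λ s → sum (λ i → classLeft (θ i) p (e i) s)) s

    collected-collects : ∀ {m} p θ (e : Fin m → Fin n) → Collects p θ e (collected p θ e)
    collected-collects p θ e = collects refl (collected-lefts p θ e)

    classLeft-cover : ∀ θ p r s → ¬ T (S s) → classLeft θ p r s ≡ 0
    classLeft-cover θ p r s s∉ = count-zero⁺ λ v t →
      s∉ (proj₁ (∧-split {S s} (proj₂ (∧-split {A s v} (proj₂ (∧-split {inClass r v} t))))))

    module _ (B : ℕ)
      (U-complete : ∀ x → cost x ≤ B → (∀ s → x ‼ s ≤ B) → (∀ s → ¬ T (S s) → x ‼ s ≡ 0) → x ∈ˡ U)
      where

      -- Contributions are nonnegative, so the state after any final segment of the vertices obeys
      -- the bound `B` on the full sums. It also vanishes outside the cover, hence lies in `U`.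
      reach-complete : ∀ p {m} (θ : Fin m → State) (e : Fin m → Fin n) → (∀ i → θ i ∈ˡ U) →
        sum (λ i → classCost (θ i) p (e i)) ≤ B →
        (∀ s → sum (λ i → classLeft (θ i) p (e i) s) ≤ B) →
        collected p θ e ∈ˡ reach U p e
      reach-complete p {m} θ e θ∈ c h = go p θ e θ∈ c h (U-complete _ c
        (λ s → ≤-trans (≤-reflexive (collected-lefts p θ e s)) (h s))
        (λ s s∉ → trans (collected-lefts p θ e s) (sum-zero⁺ (λ i → classLeft-cover (θ i) p (e i) s s∉))))
        where
        go : ∀ p {m} (θ : Fin m → State) (e : Fin m → Fin n) → (∀ i → θ i ∈ˡ U) →
          sum (λ i → classCost (θ i) p (e i)) ≤ B →
          (∀ s → sum (λ i → classLeft (θ i) p (e i) s) ≤ B) →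
          collected p θ e ∈ˡ U → collected p θ e ∈ˡ reach U p e
        go p {zero} θ e θ∈ c h x∈ = filter⁺ _ x∈ (isZero⁺ (sum-zero⁺ (collected-lefts p θ e)))
        go p {suc m} θ e θ∈ c h x∈ = filter⁺ _ x∈
          (any⁺ _ (reach-complete p (θ ∘ suc) (e ∘ suc) (θ∈ ∘ suc)
                    (≤-trans (m≤n+m _ (classCost (θ zero) p (e zero))) c)
                    (λ s → ≤-trans (m≤n+m _ (classLeft (θ zero) p (e zero) s)) (h s)))
            (any⁺ _ (θ∈ zero) (isZero⁺ (cong₂ _+_
              (m≡n⇒∣m-n∣≡0 (+-comm (classCost (θ zero) p (e zero)) _))
              (sum-zero⁺ λ s → m≡n⇒∣m-n∣≡0 (trans (collected-lefts p θ e s)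
                (trans (+-comm (classLeft (θ zero) p (e zero) s) _)
                  (cong (_+ classLeft (θ zero) p (e zero) s) (sym (collected-lefts p (θ ∘ suc) (e ∘ suc) s))))))))))

-- Sorting twins by exchanges

data Transposed {n} (u v w : Fin n) : Fin n → Set where
  first  : w ≡ u → Transposed u v w v
  second : w ≡ v → Transposed u v w u
  other  : w ≢ u → w ≢ v → Transposed u v w w

transposed : ∀ {n} (u v w : Fin n) → Transposed u v w (transpose u v ⟨$⟩ʳ w)
transposed u v w with w ≟ u
... | yes w≡u = first w≡u
... | no  w≢u with w ≟ v
...   | yes w≡v = second w≡v
...   | no  w≢v = other w≢u w≢v

-- Avoids subtraction: adding the values of `g` at `u` and `v` to the sum of `f`, and those of `f`
-- to the sum of `g`, makes both sides equal.
sum-exchange : ∀ {n} (f g : Fin n → ℕ) u v → u ≢ v → (∀ w → w ≢ u → w ≢ v → f w ≡ g w) →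
               f u + f v < g u + g v → sum f < sum g
sum-exchange {n} f g u v u≢v agree less = +-cancelʳ-< (g u + g v) _ _
  (≤-<-trans (≤-reflexive balance) (+-monoʳ-< (sum g) less))
  where
  δ : Fin n → ℕ → Fin n → ℕ
  δ i c j = if does (j ≟ i) then c else 0

  sum-δ : ∀ i c → sum (δ i c) ≡ c
  sum-δ i c = sum-pick (λ j → does (j ≟ i)) (λ _ → c) i (T-does (i ≟ i) refl) (λ j → does-T (j ≟ i))

  pointwise : ∀ w → f w + (δ u (g u) w + δ v (g v) w) ≡ g w + (δ u (f u) w + δ v (f v) w)
  pointwise w with w ≟ u | w ≟ v
  ... | yes refl | yes refl = ⊥-elim (u≢v refl)
  ... | yes refl | no _     = eq (f w) (g w)
    where eq : ∀ a b → a + (b + 0) ≡ b + (a + 0)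
          eq = solve-∀
  ... | no _     | yes refl = +-comm (f w) (g w)
  ... | no w≢u   | no w≢v   = cong (_+ 0) (agree w w≢u w≢v)

  sum-δδ : ∀ (h : Fin n → ℕ) a b → sum (λ w → h w + (δ u a w + δ v b w)) ≡ sum h + (a + b)
  sum-δδ h a b = trans (∑-distrib-+ h _) (cong (_+_ (sum h))
    (trans (∑-distrib-+ (δ u a) (δ v b)) (cong₂ _+_ (sum-δ u a) (sum-δ v b))))

  balance : sum f + (g u + g v) ≡ sum g + (f u + f v)
  balance = trans (sym (sum-δδ f (g u) (g v))) (trans (sum-cong-≗ pointwise) (sum-δδ g (f u) (f v)))

-- The sides differ by (b - a)(c - d). With b = 1 + a + x and c = 1 + d + y this is (1 + x)(1 + y),
-- the 1 + (y + x(1 + y)) of the identity.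
rearrangement : ∀ {a b c d} → a < b → d < c → a * c + b * d < a * d + b * c
rearrangement {a} {b} {c} {d} a<b d<c with m≤n⇒∃[o]m+o≡n a<b | m≤n⇒∃[o]m+o≡n d<c
... | x , refl | y , refl = ≤-trans (m≤m+n _ (y + x * (1 + y))) (≤-reflexive (eq a x d y))
  where
  eq : ∀ a x d y → 1 + (a * (1 + (d + y)) + (1 + (a + x)) * d) + (y + x * (1 + y))
                   ≡ a * d + (1 + (a + x)) * (1 + (d + y))
  eq = solve-∀

module Sorting {n : ℕ} (A : Fin n → Fin n → Bool) (S : Fin n → Bool)
  (A-symmetric   : ∀ {u v} → T (A u v) → T (A v u))
  (A-irreflexive : ∀ {v} → ¬ T (A v v))
  (twins         : ∀ {u v} → ¬ T (S u) → ¬ T (S v) → T (A u v) →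
                   ∀ {w} → w ≢ v → T (A u w) → T (A v w))
  where

  open TwinCover A S A-symmetric A-irreflexive twins public

  before : Permutation′ n → Relation
  before σ u v = does ((σ ⟨$⟩ʳ u) <?ᶠ (σ ⟨$⟩ʳ v))

  -- Twins have the same other neighbours, so transposing them preserves adjacency. As a
  -- transposition is an involution, this direction also yields the converse in `A-τ`.
  swap-adjacent : ∀ {u v} → ¬ T (S u) → ¬ T (S v) → T (A u v) → ∀ {w x w′ x′} →
                  Transposed u v w w′ → Transposed u v x x′ → T (A w x) → T (A w′ x′)
  swap-adjacent u∉ v∉ a (first refl)  (first refl)  h = ⊥-elim (A-irreflexive h)
  swap-adjacent u∉ v∉ a (first refl)  (second refl) h = A-symmetric h
  swap-adjacent u∉ v∉ a (first refl)  (other _ x≢v) h = twins u∉ v∉ a x≢v h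
  swap-adjacent u∉ v∉ a (second refl) (first refl)  h = A-symmetric h
  swap-adjacent u∉ v∉ a (second refl) (second refl) h = ⊥-elim (A-irreflexive h)
  swap-adjacent u∉ v∉ a (second refl) (other x≢u _) h = twins v∉ u∉ (A-symmetric a) x≢u h
  swap-adjacent u∉ v∉ a (other _ w≢v) (first refl)  h = A-symmetric (twins u∉ v∉ a w≢v (A-symmetric h))
  swap-adjacent u∉ v∉ a (other w≢u _) (second refl) h = A-symmetric (twins v∉ u∉ (A-symmetric a) w≢u (A-symmetric h))
  swap-adjacent u∉ v∉ a (other _ _)   (other _ _)   h = h

  module _ {u v} (u∉ : ¬ T (S u)) (v∉ : ¬ T (S v)) (a : T (A u v)) where

    private
      τ : Fin n → Fin n
      τ w = transpose u v ⟨$⟩ʳ w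

      untransposed : ∀ w → Transposed u v (τ w) w
      untransposed w = flip (transposed u v w)
        where
        flip : ∀ {w w′} → Transposed u v w w′ → Transposed u v w′ w
        flip (first refl)  = second refl
        flip (second refl) = first refl
        flip (other p q)   = other p q

      A-τ : ∀ w x → A w x ≡ A (τ w) (τ x)
      A-τ w x = T-iff (swap-adjacent u∉ v∉ a (transposed u v w) (transposed u v x))
                      (swap-adjacent u∉ v∉ a (untransposed w) (untransposed x))

    -- An automorphism only permutes the summands, both in the outer sum and in the counts.
    swap-imbalance : ∀ R → relationImbalance (λ w x → R (τ w) (τ x)) ≡ relationImbalance R
    swap-imbalance R = trans
      (sum-cong-≗ λ w → cong₂ discrepancy
        (trans (sum-cong-≗ λ x → cong (λ b → bit (b ∧ R (τ x) (τ w))) (A-τ w x))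
               (sym (∑-permute (λ y → bit (A (τ w) y ∧ R y (τ w))) (transpose u v))))
        (trans (sum-cong-≗ λ x → cong bit (A-τ w x))
               (sym (∑-permute (λ y → bit (A (τ w) y)) (transpose u v)))))
      (sym (∑-permute (λ w → discrepancy (leftCount R w) (degree w)) (transpose u v)))

  potential : Permutation′ n → ℕ
  potential σ = sum (λ w → toℕ w * toℕ (σ ⟨$⟩ʳ w))

  potential-swap : ∀ σ {u v} → toℕ u < toℕ v → toℕ (σ ⟨$⟩ʳ v) < toℕ (σ ⟨$⟩ʳ u) →
                   potential σ < potential (transpose u v ∘ₚ σ)
  potential-swap σ {u} {v} u<v σv<σu = sum-exchange _ _ u v u≢v agree
    (subst₂ (λ x y → toℕ u * toℕ (σ ⟨$⟩ʳ u) + toℕ v * toℕ (σ ⟨$⟩ʳ v)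
                     < toℕ u * toℕ (σ ⟨$⟩ʳ x) + toℕ v * toℕ (σ ⟨$⟩ʳ y))
      (sym (at-first (transposed u v u) refl)) (sym (at-second (transposed u v v) refl))
      (rearrangement u<v σv<σu))
    where
    u≢v : u ≢ v
    u≢v refl = <-irrefl refl u<v
    at-first : ∀ {w w′} → Transposed u v w w′ → w ≡ u → w′ ≡ v
    at-first (first _)     _ = refl
    at-first (second refl) e = sym e
    at-first (other p _)   e = ⊥-elim (p e)
    at-second : ∀ {w w′} → Transposed u v w w′ → w ≡ v → w′ ≡ u
    at-second (first refl) e = sym e
    at-second (second _)   _ = refl
    at-second (other _ p)  e = ⊥-elim (p e)
    at-other : ∀ {w w′} → Transposed u v w w′ → w ≢ u → w ≢ v → w ≡ w′
    at-other (first e)   p q = ⊥-elim (p e)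
    at-other (second e)  p q = ⊥-elim (q e)
    at-other (other _ _) p q = refl
    agree : ∀ w → w ≢ u → w ≢ v → toℕ w * toℕ (σ ⟨$⟩ʳ w) ≡ toℕ w * toℕ (σ ⟨$⟩ʳ (transpose u v ⟨$⟩ʳ w))
    agree w p q = cong (λ x → toℕ w * toℕ (σ ⟨$⟩ʳ x)) (at-other (transposed u v w) p q)

  potential≤ : ∀ σ → potential σ ≤ n * (n * n)
  potential≤ σ = sum-bounded (n * n) (λ w → *-mono-≤ (toℕ≤n w) (toℕ≤n (σ ⟨$⟩ʳ w)))

  Sorted : Permutation′ n → Set
  Sorted σ = ∀ u v → ¬ T (S u) → ¬ T (S v) → T (A u v) → toℕ u < toℕ v → ¬ toℕ (σ ⟨$⟩ʳ v) < toℕ (σ ⟨$⟩ʳ u)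

  -- Exchanging two twins is an automorphism of the graph, and it raises the potential if the twins were inverted.
  sort : ∀ σ → Σ[ ρ ∈ Permutation′ n ] Sorted ρ × relationImbalance (before ρ) ≡ relationImbalance (before σ)
  sort σ = go (n * (n * n)) σ (m≤m+n _ _)
    where
    go : ∀ fuel σ → n * (n * n) ≤ fuel + potential σ →
         Σ[ ρ ∈ Permutation′ n ] Sorted ρ × relationImbalance (before ρ) ≡ relationImbalance (before σ)
    go fuel σ enough with any? (λ u → any? (λ v →
      ¬? (T? (S u)) ×-dec ¬? (T? (S v)) ×-dec T? (A u v) ×-dec (toℕ u <? toℕ v) ×-dec
      (toℕ (σ ⟨$⟩ʳ v) <? toℕ (σ ⟨$⟩ʳ u))))
    ... | no sorted = σ , (λ u v u∉ v∉ a l i → sorted (u , v , u∉ , v∉ , a , l , i)) , refl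
    -- Without fuel the potential is already at its upper bound, which one more exchange would
    -- exceed.
    go zero σ enough | yes (u , v , u∉ , v∉ , a , l , i) =
      ⊥-elim (<⇒≱ (≤-<-trans enough (potential-swap σ l i)) (potential≤ (transpose u v ∘ₚ σ)))
    go (suc fuel) σ enough | yes (u , v , u∉ , v∉ , a , l , i)
      with go fuel (transpose u v ∘ₚ σ) (≤-trans enough (≤-trans (≤-reflexive (sym (+-suc fuel _)))
             (+-monoʳ-≤ fuel (potential-swap σ l i))))
    ... | ρ , s , e = ρ , s , trans e (swap-imbalance u∉ v∉ a (before σ))

  -- Reading keys and thresholds off a sorted layout

  module _ (σ : Permutation′ n) (sorted : Sorted σ) where

    private
      pos : Fin n → ℕ
      pos v = toℕ (σ ⟨$⟩ʳ v)

      before⁻ : ∀ {u v} → T (before σ u v) → pos u < pos v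
      before⁻ {u} {v} = does-T ((σ ⟨$⟩ʳ u) <?ᶠ (σ ⟨$⟩ʳ v))

      before⁺ : ∀ {u v} → pos u < pos v → T (before σ u v)
      before⁺ {u} {v} = T-does ((σ ⟨$⟩ʳ u) <?ᶠ (σ ⟨$⟩ʳ v))

      pos-injective : ∀ {u v} → pos u ≡ pos v → u ≡ v
      pos-injective {u} {v} e = trans (sym (inverseˡ σ)) (trans (cong (σ ⟨$⟩ˡ_) (toℕ-injective e)) (inverseˡ σ))

      pos-total : ∀ {u v} → u ≢ v → ¬ pos v < pos u → pos u < pos v
      pos-total {u} {v} u≢v ¬l with <-cmp (pos u) (pos v)
      ... | tri< l _ _ = l
      ... | tri≈ _ e _ = ⊥-elim (u≢v (pos-injective e))
      ... | tri> _ _ g = ⊥-elim (¬l g)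

      adjacent-≢ : ∀ {u v} → T (A v u) → u ≢ v
      adjacent-≢ a refl = A-irreflexive a

    rank : Fin n → ℕ
    rank v = count (λ s → S s ∧ before σ s v)

    rank-mono : ∀ {u v} → pos u < pos v → rank u ≤ rank v
    rank-mono l = count-mono λ s t → let p , q = ∧-split {S s} t in
      ∧-join p (before⁺ (<-trans (before⁻ q) l))

    rank-strict : ∀ {u v} → T (S u) → pos u < pos v → rank u < rank v
    rank-strict {u} u∈ l = count-strict
      (λ s t → let p , q = ∧-split {S s} t in ∧-join p (before⁺ (<-trans (before⁻ q) l)))
      u (λ t → <-irrefl refl (before⁻ (proj₂ (∧-split {S u} t)))) (∧-join u∈ (before⁺ l))

    threshold : Fin n → Fin n → ℕ
    threshold r s = proj₁ (leastIndex (λ v → inClass r v ∧ before σ s v))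

    threshold≤n : ∀ r s → threshold r s ≤ n
    threshold≤n r s = proj₁ (proj₂ (leastIndex (λ v → inClass r v ∧ before σ s v)))

    -- In a sorted layout a class appears in index order, so its members to the right of `s` are
    -- exactly those from some index on.
    threshold-spec : ∀ r s v → InClass r v → (threshold r s ≤ᵇ toℕ v) ≡ before σ s v
    threshold-spec r s v c with leastIndex (λ v → inClass r v ∧ before σ s v)
    ... | m , _ , low , wit = T-iff fwd (λ t → ≤⇒≤ᵇ {m} (low v (∧-join (inClass⁺ c) t)))
      where
      fwd : T (m ≤ᵇ toℕ v) → T (before σ s v)
      fwd t with wit (≤-<-trans (≤ᵇ⇒≤ m (toℕ v) t) (toℕ<n v))
      ... | i , refl , q with ∧-split {inClass r i} q | i ≟ v
      ... | _ , b | yes refl = b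
      ... | d , b | no i≢v = before⁺ (<-trans (before⁻ b) (pos-total i≢v
        (sorted i v (InClass.v∉S (inClass⁻ {r} {i} d)) (InClass.v∉S c) (classmates (inClass⁻ {r} {i} d) c i≢v)
          (≤∧≢⇒< (≤ᵇ⇒≤ (toℕ i) (toℕ v) t) (i≢v ∘ toℕ-injective)))))

    coverKeys : State
    coverKeys = 0 ∷ tabulate (λ s → if S s then rank s else 0)

    thresholds : Fin n → State
    thresholds r = 0 ∷ tabulate (λ s → if S s then threshold r s else 0)

    coverKeys-at : ∀ s → T (S s) → coverKeys ‼ s ≡ rank s
    coverKeys-at s s∈ = trans (lookup∘tabulate _ s) (cong (λ b → if b then rank s else 0) (T⇒≡ s∈))

    thresholds-at : ∀ r s → T (S s) → thresholds r ‼ s ≡ threshold r s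
    thresholds-at r s s∈ = trans (lookup∘tabulate _ s) (cong (λ b → if b then threshold r s else 0) (T⇒≡ s∈))

    -- Every threshold test reproduces the true comparison with its cover vertex, so the guessed key
    -- is the true count.
    key-rank : ∀ v → ¬ T (S v) → key (thresholds (rep v)) v ≡ rank v
    key-rank v v∉ = sum-cong-≗ λ s → cong bit (∧-congʳ (S s) λ s∈ →
      trans (cong (_≤ᵇ toℕ v) (thresholds-at (rep v) s s∈)) (threshold-spec (rep v) s v (rep-class v v∉)))

    -- Ranks increase strictly across a cover vertex, so they decide every comparison that involves
    -- one; a vertex outside the cover precedes a cover vertex iff its rank is not larger. Adjacent
    -- vertices outside the cover are twins and stand in index order.
    before-agrees : ∀ u v → T (A v u) → before σ u v ≡ order coverKeys thresholds u v
    before-agrees u v a with S u in u≡ | S v in v≡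
    ... | true | true = trans (T-iff fwd bwd) (cong₂ (λ x y → (x <ᵇ y) ∨ ((x ≤ᵇ y) ∧ (toℕ u <ᵇ toℕ v)))
            (sym (coverKeys-at u u∈)) (sym (coverKeys-at v v∈)))
      where
      u∈ : T (S u)
      u∈ = ≡⇒T u≡
      v∈ : T (S v)
      v∈ = ≡⇒T v≡
      fwd : T (before σ u v) → T ((rank u <ᵇ rank v) ∨ ((rank u ≤ᵇ rank v) ∧ (toℕ u <ᵇ toℕ v)))
      fwd t = ∨-join (inj₁ (<⇒<ᵇ (rank-strict u∈ (before⁻ t))))
      below : T (rank u <ᵇ rank v) ⊎ T ((rank u ≤ᵇ rank v) ∧ (toℕ u <ᵇ toℕ v)) → rank u ≤ rank v
      below (inj₁ q) = <⇒≤ (<ᵇ⇒< (rank u) (rank v) q)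
      below (inj₂ q) = ≤ᵇ⇒≤ (rank u) (rank v) (proj₁ (∧-split {rank u ≤ᵇ rank v} q))
      bwd : T ((rank u <ᵇ rank v) ∨ ((rank u ≤ᵇ rank v) ∧ (toℕ u <ᵇ toℕ v))) → T (before σ u v)
      bwd t = before⁺ (pos-total (adjacent-≢ a)
        (λ l → <⇒≱ (rank-strict v∈ l) (below (∨-split {rank u <ᵇ rank v} t))))
    ... | false | true = trans (T-iff fwd bwd) (cong₂ _≤ᵇ_ (sym (key-rank u u∉)) (sym (coverKeys-at v v∈)))
      where
      u∉ : ¬ T (S u)
      u∉ = subst T u≡
      v∈ : T (S v)
      v∈ = ≡⇒T v≡
      fwd : T (before σ u v) → T (rank u ≤ᵇ rank v)
      fwd t = ≤⇒≤ᵇ {rank u} (rank-mono (before⁻ t))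
      bwd : T (rank u ≤ᵇ rank v) → T (before σ u v)
      bwd t = before⁺ (pos-total (adjacent-≢ a) (λ l → <⇒≱ (rank-strict v∈ l) (≤ᵇ⇒≤ (rank u) (rank v) t)))
    ... | true | false = trans (T-iff fwd bwd)
            (cong₂ (λ x y → not (x ≤ᵇ y)) (sym (key-rank v v∉)) (sym (coverKeys-at u u∈)))
      where
      u∈ : T (S u)
      u∈ = ≡⇒T u≡
      v∉ : ¬ T (S v)
      v∉ = subst T v≡
      fwd : T (before σ u v) → T (not (rank v ≤ᵇ rank u))
      fwd t = not-join λ q → <⇒≱ (rank-strict u∈ (before⁻ t)) (≤ᵇ⇒≤ (rank v) (rank u) q)
      bwd : T (not (rank v ≤ᵇ rank u)) → T (before σ u v)
      bwd t = before⁺ (pos-total (adjacent-≢ a) (λ l → not-split t (≤⇒≤ᵇ {rank v} (rank-mono l))))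
    ... | false | false = T-iff fwd bwd
      where
      u∉ : ¬ T (S u)
      u∉ = subst T u≡
      v∉ : ¬ T (S v)
      v∉ = subst T v≡
      fwd : T (before σ u v) → T (toℕ u <ᵇ toℕ v)
      fwd t with <-cmp (toℕ u) (toℕ v)
      ... | tri< l _ _ = <⇒<ᵇ l
      ... | tri≈ _ e _ = ⊥-elim (adjacent-≢ a (toℕ-injective e))
      ... | tri> _ _ g = ⊥-elim (sorted v u v∉ u∉ a g (before⁻ t))
      bwd : T (toℕ u <ᵇ toℕ v) → T (before σ u v)
      bwd t = before⁺ (pos-total (adjacent-≢ a) (sorted u v u∉ v∉ (A-symmetric a) (<ᵇ⇒< (toℕ u) (toℕ v) t)))

  -- Completeness and soundness of acceptance

  module _ (U : List State)
    (U-complete : ∀ x → cost x ≤ n * n → (∀ s → x ‼ s ≤ n * n) → (∀ s → ¬ T (S s) → x ‼ s ≡ 0) → x ∈ˡ U)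
    where

    private
      n≤n² : n ≤ n * n
      n≤n² = square n
        where
        square : ∀ n → n ≤ n * n
        square zero    = z≤n
        square (suc n) = m≤m+n (suc n) _

      table∈U : ∀ (f : Fin n → ℕ) → (∀ s → f s ≤ n) → 0 ∷ tabulate (λ s → if S s then f s else 0) ∈ˡ U
      table∈U f f≤n = U-complete _ z≤n
        (λ s → ≤-trans (≤-reflexive (lookup∘tabulate _ s)) (≤-trans (if≤ (S s) (f≤n s)) n≤n²))
        (λ s s∉ → trans (lookup∘tabulate _ s) (cong (λ b → if b then f s else 0) (¬T⇒≡ s∉)))
        where
        if≤ : ∀ b {m} → m ≤ n → (if b then m else 0) ≤ n
        if≤ true  m≤n = m≤n
        if≤ false _   = z≤n

      vertexCost≤n : ∀ θ p v → vertexCost θ p v ≤ n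
      vertexCost≤n θ p v = ≤-trans (∣m-n∣≤m⊔n (leftOf θ p v) _)
        (⊔-lub (count≤ _) (≤-trans (m∸n≤m (degree v) (leftOf θ p v)) (count≤ _)))

    accept-complete : ∀ σ {τ} → relationImbalance (before σ) ≤ τ → T (accept U τ)
    accept-complete σ {τ} σ≤τ with sort σ
    ... | ρ , sorted , e = any⁺ _ p∈U (any⁺ _ x∈reach (≤⇒≤ᵇ {total p x} (≤-trans (≤-reflexive total≡) σ≤τ)))
      where
      p : State
      p = coverKeys ρ sorted
      θ : Fin n → State
      θ = thresholds ρ sorted
      x : State
      x = collected U p θ id
      p∈U : p ∈ˡ U
      p∈U = table∈U (rank ρ sorted) (λ s → count≤ _)
      -- The bound n² comes from the cost, a sum of n terms of at most n each; the other coordinates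
      -- count vertices and are at most n.
      x∈reach : x ∈ˡ reach U p id
      x∈reach = reach-complete U (n * n) U-complete p θ id (λ r → table∈U (threshold ρ sorted r) (threshold≤n ρ sorted r))
        (≤-trans (≤-reflexive (classCost-sum p θ)) (sum-bounded n (λ v → if≤ (S v) (vertexCost≤n (θ (rep v)) p v))))
        (λ s → ≤-trans (≤-reflexive (classLeft-sum p θ s))
          (≤-trans (sum-bounded 1 (λ u → if≤ (S u) (bit≤1 _))) (≤-trans (≤-reflexive (*-identityʳ n)) n≤n²)))
        where
        if≤ : ∀ b {m c} → m ≤ c → (if b then 0 else m) ≤ c
        if≤ true  _ = z≤n
        if≤ false h = h
      total≡ : total p x ≡ relationImbalance (before σ)
      total≡ = trans (total-imbalance p θ x (collected-collects U p θ id))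
        (trans (relationImbalance-cong (λ u v a → sym (before-agrees ρ sorted u v a))) e)

    accept-sound : ∀ {τ} → T (accept U τ) → Σ[ σ ∈ Permutation′ n ] relationImbalance (before σ) ≤ τ
    accept-sound {τ} t with any⁻ _ U t
    ... | p , _ , t′ with any⁻ _ (reach U p id) t′
    ... | x , x∈ , l with reach-sound U p id x∈
    ... | θ , c with realize p θ x c
    ... | σ , e = σ , ≤-trans (≤-reflexive e) (≤ᵇ⇒≤ (total p x) τ l)

-- Candidate states and the threshold

-- Only flagged coordinates are free, so the length is exponential in the number of flags rather
-- than in the dimension.
universe : ∀ {m} → ℕ → Vec Bool m → List (Vec ℕ m)
universe B []       = [ [] ]
universe B (b ∷ bs) = cartesianProductWith _∷_ (if b then upTo (suc B) else [ 0 ]) (universe B bs)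

∈-universe : ∀ {m} B (bs : Vec Bool m) x → (∀ i → lookup x i ≤ B) →
             (∀ i → ¬ T (lookup bs i) → lookup x i ≡ 0) → x ∈ˡ universe B bs
∈-universe B []           []      _ _ = here refl
∈-universe B (true  ∷ bs) (y ∷ x) x≤ x≡0 = ∈-cartesianProductWith⁺ _∷_ (∈-upTo⁺ (s≤s (x≤ zero)))
  (∈-universe B bs x (x≤ ∘ suc) (x≡0 ∘ suc))
∈-universe B (false ∷ bs) (y ∷ x) x≤ x≡0 = ∈-cartesianProductWith⁺ _∷_ {xs = [ 0 ]} (here (x≡0 zero (λ ())))
  (∈-universe B bs x (x≤ ∘ suc) (x≡0 ∘ suc))

size-unary : ∀ n → size (encodeUnary n) ≡ n
size-unary zero    = refl
size-unary (suc n) = cong suc (size-unary n)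

universe-size : ∀ {m} B (bs : Vec Bool m) → All (λ x → size (encodeVec encodeUnary x) ≤ m * suc B) (universe B bs)
universe-size B []       = z≤n ∷ []
universe-size {suc m} B (b ∷ bs) = cartesianProductWith⁺ (setoid ℕ) (setoid (Vec ℕ m)) _∷_ _ _ λ {y} {x} y∈ x∈ →
  s≤s (+-mono-≤ (≤-trans (≤-reflexive (size-unary y)) (entry b y∈)) (All.lookup (universe-size B bs) x∈))
  where
  entry : ∀ b {y} → y ∈ˡ (if b then upTo (suc B) else [ 0 ]) → y ≤ B
  entry true  y∈          = ≤-pred (∈-upTo⁻ y∈)
  entry false (here refl) = z≤n

length-product : ∀ {A B C : Set} (f : A → B → C) xs ys → length (cartesianProductWith f xs ys) ≡ length xs * length ys
length-product f []       ys = refl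
length-product f (x ∷ xs) ys = trans (length-++ (Data.List.map (f x) ys))
  (cong₂ _+_ (length-map (f x) ys) (length-product f xs ys))

universe-length : ∀ {m} B (bs : Vec Bool m) → length (universe B bs) ≡ suc B ^ ∣ bs ∣
universe-length B []           = refl
universe-length B (true  ∷ bs) = trans (length-product _∷_ (upTo (suc B)) (universe B bs))
  (cong₂ _*_ (length-upTo (suc B)) (universe-length B bs))
universe-length B (false ∷ bs) = trans (length-product _∷_ [ 0 ] (universe B bs))
  (trans (+-identityʳ _) (universe-length B bs))

size-list : ∀ {A : Set} {enc : A → Tree} {c} {xs : List A} → All (λ x → size (enc x) ≤ c) xs →
            size (encodeList enc xs) ≤ length xs * suc c
size-list []       = z≤n
size-list (p ∷ ps) = s≤s (+-mono-≤ p (size-list ps))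

size-vec : ∀ {A : Set} {enc : A → Tree} {c n} (xs : Vec A n) → (∀ x → size (enc x) ≤ c) →
           size (encodeVec enc xs) ≤ n * suc c
size-vec []       _ = z≤n
size-vec (x ∷ xs) h = s≤s (+-mono-≤ (h x) (size-vec xs h))

size-bool : ∀ b → size (encodeBool b) ≤ 1
size-bool true  = ≤-refl
size-bool false = z≤n

opaque
  universeStepᴾ : PolyFun 4
  universeStepᴾ = concatMapᴾ (ifᴾ (arg (# 0)) (arg (# 2)) (nodeᴾ nilᴾ nilᴾ))
    (concatMapᴾ (arg (# 2)) (nodeᴾ (nodeᴾ (arg (# 1)) (arg (# 0))) nilᴾ))

-- Only an `Algorithm`: its step is polynomial, but the list grows by the factor B + 1 at every
-- flagged coordinate.
universeᴬ : Algorithm 2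
universeᴬ = foldᴬ (argᴬ (# 1)) (nodeᴬ nilᴬ nilᴬ) (universeStepᴾ .algorithm)

private
  encodeStates : ∀ {m} → List (Vec ℕ m) → Tree
  encodeStates = encodeList (encodeVec encodeUnary)

opaque
  unfolding universeStepᴾ
  universeStep-spec : ∀ {m} B b (us : List (Vec ℕ m)) z →
    ⟦ universeStepᴾ ⟧ (encodeBool b ∷ encodeStates us ∷ encodeList encodeUnary (upTo (suc B)) ∷ z ∷ [])
    ≡ encodeStates (cartesianProductWith _∷_ (if b then upTo (suc B) else [ 0 ]) us)
  universeStep-spec {m} B b us z = trans
    (concatMap-list {enc = encodeUnary} {enc′ = encodeVec encodeUnary} (if b then upTo (suc B) else [ 0 ]) _
      (trans (if-bool b refl refl refl) (choose b))
      λ x → concatMap-list {enc = encodeVec encodeUnary} {enc′ = encodeVec encodeUnary} us (λ u → [ x ∷ u ]) refl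
              (λ u → refl))
    (cong encodeStates (product (if b then upTo (suc B) else [ 0 ])))
    where
    choose : ∀ b → (if b then encodeList encodeUnary (upTo (suc B)) else node nil nil)
                   ≡ encodeList encodeUnary (if b then upTo (suc B) else [ 0 ])
    choose true  = refl
    choose false = refl

    singletons : ∀ x (us : List (Vec ℕ m)) → concatMap (λ u → [ x ∷ u ]) us ≡ Data.List.map (x ∷_) us
    singletons x []       = refl
    singletons x (u ∷ us) = cong ((x ∷ u) ∷_) (singletons x us)

    product : ∀ xs → concatMap (λ x → concatMap (λ u → [ x ∷ u ]) us) xs ≡ cartesianProductWith _∷_ xs us
    product []       = refl
    product (x ∷ xs) = cong₂ _++_ (singletons x us) (product xs)

universe-fold : ∀ {m} B z (bs : Vec Bool m) →
  foldTree (λ h r → ⟦ universeStepᴾ ⟧ (h ∷ r ∷ encodeList encodeUnary (upTo (suc B)) ∷ z ∷ [])) (node nil nil)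
    (encodeVec encodeBool bs) ≡ encodeStates (universe B bs)
universe-fold B z []       = refl
universe-fold B z (b ∷ bs) = trans
  (cong (λ r → ⟦ universeStepᴾ ⟧ (encodeBool b ∷ r ∷ encodeList encodeUnary (upTo (suc B)) ∷ z ∷ [])) (universe-fold B z bs))
  (universeStep-spec B b (universe B bs) z)

universe-spec : ∀ {m} B (bs : Vec Bool m) →
  universeᴬ .fun (encodeList encodeUnary (upTo (suc B)) ∷ encodeVec encodeBool bs ∷ []) ≡ encodeStates (universe B bs)
universe-spec B bs = universe-fold B (encodeVec encodeBool bs) bs

-- Identifies the intermediate results of the fold in `universeᴬ` as universes of shorter vectors
-- with no more flags.
suffix-vec : ∀ {n t} (bs : Vec Bool n) → Suffix t (encodeVec encodeBool bs) →
             ∃[ m ] Σ[ cs ∈ Vec Bool m ] t ≡ encodeVec encodeBool cs × m ≤ n × ∣ cs ∣ ≤ ∣ bs ∣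
suffix-vec []       here = _ , [] , refl , ≤-refl , ≤-refl
suffix-vec (b ∷ bs) here = _ , b ∷ bs , refl , ≤-refl , ≤-refl
suffix-vec (b ∷ bs) (there s) with suffix-vec bs s
... | m , cs , e , m≤ , c≤ = m , cs , e , m≤n⇒m≤1+n m≤ , ≤-trans c≤ (grow b)
  where
  grow : ∀ b → ∣ bs ∣ ≤ ∣ b ∷ bs ∣
  grow true  = n≤1+n _
  grow false = ≤-refl

module _ {X : Set} {μ : X → ℕ} where

  feasible-apply-on : ∀ {n m} {ρ : X → Vec Tree n} {f : Algorithm m} {as : Vec (Algorithm n) m} →
    Feasible (values as ∘ ρ) μ f → argumentsTime as ∘ ρ ≼ μ → Feasible ρ μ (applyᴬ f as)
  feasible-apply-on (feasible t s) ta = feasible (≼-+ {μ = μ} (≼-const 40) (≼-+ {μ = μ} ta t)) s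

  -- The accumulator bound `M` is the number of candidates times a bound on the size of one; the
  -- exponential factor is polynomial in `μ` by hypothesis.
  feasible-universe : ∀ (n : X → ℕ) (B : X → ℕ) (bs : ∀ x → Vec Bool (n x)) →
    let ρ = λ x → encodeList encodeUnary (upTo (suc (B x))) ∷ encodeVec encodeBool (bs x) ∷ [] in
    (λ x → totalSize (ρ x)) ≼ μ → n ≼ μ → B ≼ μ → (λ x → suc (B x) ^ ∣ bs x ∣) ≼ μ →
    Feasible ρ μ universeᴬ
  feasible-universe n B bs ρ≼ n≼ B≼ p≼ = feasible-fold
    (feasible-arg (# 1) (≼-≤ {μ = μ} (λ x → size-lookup (ρ x) (# 1)) ρ≼))
    (feasible-node feasible-nil feasible-nil) (universeStepᴾ .polynomial) ρ≼ M
    (≼-* {μ = μ} p≼ (≼-+ {μ = μ} (≼-const 1) (≼-* {μ = μ} n≼ (≼-+ {μ = μ} (≼-const 1) B≼))))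
    bounded
    where
    ρ : X → Vec Tree 2
    ρ x = encodeList encodeUnary (upTo (suc (B x))) ∷ encodeVec encodeBool (bs x) ∷ []

    M : X → ℕ
    M x = suc (B x) ^ ∣ bs x ∣ * suc (n x * suc (B x))

    bounded : ∀ x t → Suffix t (encodeVec encodeBool (bs x)) → size (foldTree _ (node nil nil) t) ≤ M x
    bounded x t s with suffix-vec (bs x) s
    ... | m , cs , refl , m≤ , c≤ = ≤-trans (≤-reflexive (cong size (universe-fold (B x) _ cs)))
      (≤-trans (size-list (universe-size (B x) cs))
        (*-mono-≤ (≤-trans (≤-reflexive (universe-length (B x) cs)) (^-monoʳ-≤ (suc (B x)) c≤))
                  (s≤s (*-monoˡ-≤ (suc (B x)) m≤))))

-- The running time must not depend on the size of the integer t, so only a prefix of its digits is read: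
-- a step moves one digit from the unread input (the head of the state) to the end of the prefix (its tail).
takeStepᴬ : Algorithm 4
takeStepᴬ = ifᴬ (headᴬ (argᴬ (# 1)))
  (nodeᴬ (tailᴬ (headᴬ (argᴬ (# 1))))
    (applyᴬ (appendᴾ .algorithm) (tailᴬ (argᴬ (# 1))
      ∷ nodeᴬ (ifᴬ (headᴬ (headᴬ (argᴬ (# 1)))) (nodeᴬ nilᴬ nilᴬ) nilᴬ) nilᴬ ∷ [])))
  (argᴬ (# 1))

takeᴬ : Algorithm 2
takeᴬ = tailᴬ (foldᴬ (argᴬ (# 0)) (nodeᴬ (argᴬ (# 1)) nilᴬ) takeStepᴬ)

takeStep : Tree → Tree
takeStep r = takeStepᴬ .fun (nil ∷ r ∷ nil ∷ nil ∷ [])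

takeFold : Tree → Tree → Tree
takeFold ds = foldTree (λ _ r → takeStep r) (node ds nil)

-- Rebuilt from its truth value, a digit has bounded size whatever the unread tree contains.
digit : Tree → Tree
digit r = node (ifTree (headTree (headTree r)) (node nil nil) nil) nil

size-digit : ∀ d → size (node (ifTree d (node nil nil) nil) nil) ≤ 2
size-digit nil        = s≤s z≤n
size-digit (node _ _) = ≤-refl

size-takeFold : ∀ ds t → size (tailTree (takeFold ds t)) ≤ size t + size t
size-takeFold ds nil = z≤n
size-takeFold ds (node h t) = ≤-trans (step (takeFold ds t)) (≤-trans (+-monoˡ-≤ 2 (size-takeFold ds t))
  (≤-trans (m≤m+n _ (size h + size h)) (≤-reflexive (eq (size h) (size t)))))
  where
  eq : ∀ h t → t + t + 2 + (h + h) ≡ 1 + (h + t) + (1 + (h + t))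
  eq = solve-∀
  step : ∀ r → size (tailTree (takeStep r)) ≤ size (tailTree r) + 2
  step r with headTree r in eq
  ... | nil      = m≤m+n _ 2
  ... | node x y = ≤-trans (size-append (tailTree r) _) (+-monoʳ-≤ (size (tailTree r)) (size-digit x))

-- The only cost that is not constant is the append, whose arguments exclude the unread digits. A
-- bound in the size of all arguments would bring in the length of the integer.
takeStep-time : ∀ h r b ds → takeStepᴬ .time (h ∷ r ∷ b ∷ ds ∷ []) ≡
  1480 + (appendᴾ .algorithm .time (tailTree r ∷ digit r ∷ []) + 120)
takeStep-time h r b ds = refl

module _ {X : Set} {μ : X → ℕ} where

  feasible-take : ∀ (b ds : X → Tree) → size ∘ b ≼ μ → Feasible (λ x → b x ∷ ds x ∷ []) μ takeᴬ
  feasible-take b ds b≼ = feasible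
    (≼-≤ {μ = μ} time≤ (≼-+ {μ = μ} (≼-const 520) (≼-+ {μ = μ} (≼-const 20) (≼-* {μ = μ} b≼
      (≼-+ {μ = μ} (≼-const 20) W≼)))))
    (≼-≤ {μ = μ} (λ x → size-takeFold (ds x) (b x)) (≼-+ {μ = μ} b≼ b≼))
    where
    c : ℕ
    c = proj₁ (appendᴾ .polynomial .time≼)

    W : X → ℕ
    W x = 1480 + ((2 + (4 + (size (b x) + size (b x)))) ^ c + 120)

    W≼ : W ≼ μ
    W≼ = ≼-+ {μ = μ} (≼-const 1480) (≼-+ {μ = μ}
      (≼-^ {μ = μ} (≼-+ {μ = μ} (≼-const 6) (≼-+ {μ = μ} b≼ b≼)) c) (≼-const 120))

    step≤ : ∀ x h t → Suffix (node h t) (b x) →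
            takeStepᴬ .time (h ∷ takeFold (ds x) t ∷ b x ∷ ds x ∷ []) ≤ W x
    step≤ x h t s = ≤-trans (≤-reflexive (takeStep-time h r (b x) (ds x)))
      (+-monoʳ-≤ 1480 (+-monoˡ-≤ 120 (≤-trans (proj₂ (appendᴾ .polynomial .time≼) (tailTree r ∷ digit r ∷ []))
        (^-monoˡ-≤ c (+-monoʳ-≤ 2 (≤-trans (≤-reflexive (eq (size (tailTree r)) (size (digit r))))
          (+-mono-≤ (+-monoʳ-≤ 2 (size-digit (headTree (headTree r))))
                      (≤-trans (size-takeFold (ds x) t) (+-mono-≤ t≤ t≤)))))))))
      where
      r : Tree
      r = takeFold (ds x) t
      t≤ : size t ≤ size (b x)
      t≤ = size-suffix (suffix-tail s)
      eq : ∀ a d → 1 + (a + (1 + (d + 0))) ≡ 2 + d + a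
      eq = solve-∀

    time≤ : ∀ x → takeᴬ .time (b x ∷ ds x ∷ []) ≤ 520 + (20 + size (b x) * (20 + W x))
    time≤ x = ≤-trans (≤-reflexive (shape _))
      (+-mono-≤ (≤ᵇ⇒≤ 360 520 _) (foldTime-bound _ (node (ds x) nil)
        (λ h r → takeStepᴬ .time (h ∷ r ∷ b x ∷ ds x ∷ [])) (W x) (b x) (step≤ x)))
      where
      shape : ∀ t → 40 + ((40 + (40 + (200 + t))) + 40) ≡ 360 + t
      shape = solve-∀

-- Bijective base 2: `false` stands for the digit 1 and `true` for 2.
valueOf : List Bool → ℕ
valueOf []       = 0
valueOf (d ∷ ds) = valueOf ds + (valueOf ds + suc (bit d))

take-spec : ∀ j ds → ∃[ ps ] ∃[ rs ] takeFold (encodeList encodeBool ds) (encodeUnary j)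
              ≡ node (encodeList encodeBool rs) (encodeList encodeBool ps)
            × ps ++ rs ≡ ds × (rs ≡ [] ⊎ length ps ≡ j)
take-spec zero    ds = [] , ds , refl , refl , inj₂ refl
take-spec (suc j) ds with take-spec j ds
-- Once the digits are exhausted, a further step changes nothing.
... | ps , []     , e , a , _ = ps , [] , trans (cong takeStep e) refl , a , inj₁ refl
... | ps , d ∷ rs , e , a , inj₂ l = ps ++ [ d ] , rs
  , trans (cong takeStep e) (cong (node _) (append-list ps [ d ] refl (cong (λ x → node x nil) (if-encode d))))
  , trans (++-assoc ps [ d ] rs) a , inj₂ (trans (length-++ ps) (trans (+-comm (length ps) 1) (cong suc l)))
  where
  if-encode : ∀ d → ifTree (encodeBool d) (node nil nil) nil ≡ encodeBool d
  if-encode true  = refl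
  if-encode false = refl

valueOf-++ : ∀ ps rs → valueOf ps ≤ valueOf (ps ++ rs)
valueOf-++ []       rs = z≤n
valueOf-++ (p ∷ ps) rs = +-mono-≤ (valueOf-++ ps rs) (+-monoˡ-≤ _ (valueOf-++ ps rs))

length≤valueOf : ∀ ps → length ps ≤ valueOf ps
length≤valueOf []       = z≤n
length≤valueOf (p ∷ ps) = ≤-trans (≤-trans (s≤s (length≤valueOf ps)) (≤-reflexive (+-comm 1 _)))
  (+-monoʳ-≤ (valueOf ps) (≤-trans (s≤s z≤n) (m≤n+m (suc (bit p)) (valueOf ps))))

-- Cutting off digits is harmless: j digits in bijective base 2 have a value of at least j.
prefix-value : ∀ {j x} ps rs → rs ≡ [] ⊎ length ps ≡ j → x ≤ j → x ≤ valueOf (ps ++ rs) → x ≤ valueOf ps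
prefix-value ps rs (inj₁ refl) _   x≤ = ≤-trans x≤ (≤-reflexive (cong valueOf (++-identityʳ ps)))
prefix-value ps rs (inj₂ refl) x≤j _  = ≤-trans x≤j (length≤valueOf ps)

opaque
  valueᴾ : PolyFun 2
  valueᴾ = foldᴾ (arg (# 1)) nilᴾ
    (monusᴾ $ᴾ (arg (# 2) ∷ (monusᴾ $ᴾ (arg (# 2) ∷
      (appendᴾ $ᴾ (arg (# 1) ∷ (appendᴾ $ᴾ (arg (# 1) ∷ nodeᴾ nilᴾ (arg (# 0)) ∷ [])) ∷ [])) ∷ [])) ∷ []))
    (λ ρ → size (lookup ρ (# 0))) (size≼ᴾ (arg (# 0)))
    (λ { (b ∷ ds ∷ []) nil        _ → z≤n
       ; (b ∷ ds ∷ []) (node h t) _ → size-monus b _ })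

  -- The value is exponential in the number of digits, so it is capped at `b` after each digit, as a
  -- minimum written with two subtractions. Prepending a digit is monotone and never decreases the
  -- value, so early capping does not change the final minimum.
  value-spec : ∀ b ds → ⟦ valueᴾ ⟧ (encodeUnary b ∷ encodeList encodeBool ds ∷ []) ≡ encodeUnary (b ⊓ valueOf ds)
  value-spec b []       = cong encodeUnary (sym (⊓-zeroʳ b))
  value-spec b (d ∷ ds) = trans
    (monus-unary b _ refl (monus-unary b _ refl (append-unary (b ⊓ v) _ (value-spec b ds)
      (append-unary (b ⊓ v) (suc (bit d)) (value-spec b ds) (cong (node nil) (encodeBool-bit d))))))
    (cong encodeUnary cap)
    where
    v : ℕ
    v = valueOf ds
    m∸[m∸n]≡m⊓n : ∀ m n → m ∸ (m ∸ n) ≡ m ⊓ n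
    m∸[m∸n]≡m⊓n m n with ≤-total n m
    ... | inj₁ n≤m = trans (m∸[m∸n]≡n n≤m) (sym (m≥n⇒m⊓n≡n n≤m))
    ... | inj₂ m≤n = trans (cong (m ∸_) (m≤n⇒m∸n≡0 m≤n)) (sym (m≤n⇒m⊓n≡m m≤n))
    cap : b ∸ (b ∸ (b ⊓ v + (b ⊓ v + suc (bit d)))) ≡ b ⊓ (v + (v + suc (bit d)))
    cap with ≤-total v b
    ... | inj₁ v≤b = trans (m∸[m∸n]≡m⊓n b _) (cong (λ w → b ⊓ (w + (w + suc (bit d)))) (m≥n⇒m⊓n≡n v≤b))
    ... | inj₂ b≤v = trans (m∸[m∸n]≡m⊓n b _) (trans (cong (λ w → b ⊓ (w + (w + suc (bit d)))) (m≤n⇒m⊓n≡m b≤v))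
      (trans (m≤n⇒m⊓n≡m (m≤m+n b _)) (sym (m≤n⇒m⊓n≡m (≤-trans b≤v (m≤m+n v _))))))

  squareᴾ : PolyFun 1
  squareᴾ = concatMapᴾ (rangeᴾ $ᴾ (arg (# 0) ∷ [])) (concatMapᴾ (rangeᴾ $ᴾ (arg (# 1) ∷ [])) trueᴾ)

  square-spec : ∀ {n} (S : Subset n) → ⟦ squareᴾ ⟧ (encodeSubset S ∷ []) ≡ encodeUnary (n * n)
  square-spec {n} S = trans
    (sum-table _ (range-vec S) λ i → sum-table (λ _ → 1) (range-vec S) λ j → refl)
    (cong encodeUnary (trans (sum-const n (sum {n} (λ _ → 1))) (cong (n *_) (trans (sum-const n 1) (*-identityʳ n)))))

-- The graph instance

card-count : ∀ {n} (p : Subset n) → ∣ p ∣ ≡ count (lookup p)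
card-count []          = refl
card-count (true ∷ p)  = cong suc (card-count p)
card-count (false ∷ p) = card-count p

T-lookup : ∀ {n} {p : Subset n} {x} → T (lookup p x) → x ∈ p
T-lookup {p = p} {x} t = lookup⇒[]= x p (T⇒≡ t)

lookup-T : ∀ {n} {p : Subset n} {x} → x ∈ p → T (lookup p x)
lookup-T x∈ = ≡⇒T ([]=⇒lookup x∈)

opaque
  imbalance-attained : ∀ {n} (G : Graph n) → Σ[ σ ∈ Layout n ] imbalance G ≡ layoutImbalance G σ
  imbalance-attained {n} G = argmin (layoutImbalance G) Data.Fin.Permutation.id (layouts n) , refl

module GraphSearch {n : ℕ} (G : Graph n) (S : Subset n) (cover : IsTwinCover G S) where
  open Graph G

  rows : Vec (Subset n) n
  rows = tabulate N

  adjacent : Fin n → Fin n → Bool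
  adjacent u v = lookup (lookup rows u) v

  inCover : Fin n → Bool
  inCover = lookup S

  adjacent≡ : ∀ u v → adjacent u v ≡ lookup (N u) v
  adjacent≡ u v = cong (λ p → lookup p v) (lookup∘tabulate N u)

  adjacent⁻ : ∀ {u v} → T (adjacent u v) → v ∈ N u
  adjacent⁻ {u} {v} t = T-lookup (subst T (adjacent≡ u v) t)

  adjacent⁺ : ∀ {u v} → v ∈ N u → T (adjacent u v)
  adjacent⁺ {u} {v} v∈ = subst T (sym (adjacent≡ u v)) (lookup-T v∈)

  -- An edge outside the cover lies in one component, so its ends have equal closed neighbourhoods;
  -- passing to open ones excludes `w` equal to `v`.
  twin-neighbours : ∀ {u v} → ¬ T (inCover u) → ¬ T (inCover v) → T (adjacent u v) →
                    ∀ {w} → w ≢ v → T (adjacent u w) → T (adjacent v w)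
  twin-neighbours {u} {v} u∉ v∉ a {w} w≢v h
    with x∈p∪q⁻ (N v) ⁅ v ⁆ (subst (w ∈_) closed (x∈p∪q⁺ (inj₁ (adjacent⁻ h))))
    where
    edge : EdgeOutside G S u v
    edge = (λ u∈ → u∉ (lookup-T u∈)) , (λ v∈ → v∉ (lookup-T v∈)) , adjacent⁻ a
    closed : N[_] G u ≡ N[_] G v
    closed = cover (Star (EdgeOutside G S) u) (u , proj₁ edge , (λ s → s) , λ s → s) ε (edge ◅ ε)
  ... | inj₁ w∈ = adjacent⁺ w∈
  ... | inj₂ w∈ = ⊥-elim (w≢v (x∈⁅y⁆⇒x≡y v w∈))

  open Sorting adjacent inCover
    (λ a → adjacent⁺ (symmetric (adjacent⁻ a))) (λ a → irreflexive (adjacent⁻ a)) twin-neighbours public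

  private
    card-restricted : ∀ v (f : Fin n → Bool) → ∣ N v ∩ tabulate f ∣ ≡ count (λ u → adjacent v u ∧ f u)
    card-restricted v f = trans (card-count (N v ∩ tabulate f)) (sum-cong-≗ λ u → cong bit
      (trans (lookup-zipWith _∧_ u (N v) (tabulate f)) (cong₂ _∧_ (sym (adjacent≡ v u)) (lookup∘tabulate f u))))

    -- Positions are injective, so a neighbour is on exactly one side. The right count is thus the
    -- degree minus the left count, the form used by `discrepancy`.
    left+right : ∀ σ v → leftCount (before σ) v + count (λ u → adjacent v u ∧ before σ v u) ≡ degree v
    left+right σ v = trans (sym (∑-distrib-+ (λ u → bit (adjacent v u ∧ before σ u v)) _))
      (sum-cong-≗ λ u → pointwise u (adjacent v u) (λ t → t))
      where
      pointwise : ∀ u a → (T a → T (adjacent v u)) → bit (a ∧ before σ u v) + bit (a ∧ before σ v u) ≡ bit a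
      pointwise u false _ = refl
      pointwise u true  h with <-cmp (toℕ (σ ⟨$⟩ʳ u)) (toℕ (σ ⟨$⟩ʳ v))
      ... | tri< l _ ¬g = cong₂ _+_ (bit-true (T-does ((σ ⟨$⟩ʳ u) <?ᶠ (σ ⟨$⟩ʳ v)) l))
                                    (bit-false (¬g ∘ does-T ((σ ⟨$⟩ʳ v) <?ᶠ (σ ⟨$⟩ʳ u))))
      ... | tri> ¬l _ g = cong₂ _+_ (bit-false (¬l ∘ does-T ((σ ⟨$⟩ʳ u) <?ᶠ (σ ⟨$⟩ʳ v))))
                                    (bit-true (T-does ((σ ⟨$⟩ʳ v) <?ᶠ (σ ⟨$⟩ʳ u)) g))
      ... | tri≈ _ e _ with trans (sym (inverseˡ σ)) (trans (cong (σ ⟨$⟩ˡ_) (toℕ-injective e)) (inverseˡ σ))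
      ...   | refl = ⊥-elim (irreflexive (adjacent⁻ (h _)))

  layoutImbalance≡ : ∀ σ → layoutImbalance G σ ≡ relationImbalance (before σ)
  layoutImbalance≡ σ = sum-cong-≗ λ v → trans
    (cong₂ ∣_-_∣ (card-restricted v (λ u → before σ u v)) (card-restricted v (λ u → before σ v u)))
    (cong (λ r → ∣ leftCount (before σ) v - r ∣)
      (sym (trans (cong (_∸ leftCount (before σ) v) (sym (left+right σ v))) (m+n∸m≡n (leftCount (before σ) v) _))))

  states : List State
  states = universe (n * n) (true ∷ S)

  states-complete : ∀ x → cost x ≤ n * n → (∀ s → x ‼ s ≤ n * n) → (∀ s → ¬ T (inCover s) → x ‼ s ≡ 0) → x ∈ˡ states
  states-complete x c≤ x≤ x≡0 = ∈-universe (n * n) (true ∷ S) x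
    (λ { zero → c≤ ; (suc s) → x≤ s }) (λ { zero ¬t → ⊥-elim (¬t _) ; (suc s) → x≡0 s })

  accept-imbalance : ∀ τ → T (accept states τ) → imbalance G ≤ τ
  accept-imbalance τ t = ≤-trans (imbalance-minimal G (proj₁ found))
    (≤-trans (≤-reflexive (layoutImbalance≡ (proj₁ found))) (proj₂ found))
    where
    found : Σ[ σ ∈ Permutation′ n ] relationImbalance (before σ) ≤ τ
    found = accept-sound states states-complete {τ} t

  private
    optimum : ∃[ σ ] imbalance G ≡ relationImbalance (before σ)
    optimum = let σ , e = imbalance-attained G in σ , trans e (layoutImbalance≡ σ)

  imbalance-accept : ∀ τ → imbalance G ≤ τ → T (accept states τ)
  imbalance-accept τ h = accept-complete states states-complete (proj₁ optimum)
    (≤-trans (≤-reflexive (sym (proj₂ optimum))) h)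

  -- Justifies capping the integer at n²: from there on the answer is always yes.
  imbalance≤n² : imbalance G ≤ n * n
  imbalance≤n² = ≤-trans (≤-reflexive (proj₂ optimum))
    (sum-bounded n λ v → ≤-trans (∣m-n∣≤m⊔n (leftCount (before (proj₁ optimum)) v) _)
      (⊔-lub (count≤ _) (≤-trans (m∸n≤m (degree v) (leftCount (before (proj₁ optimum)) v)) (count≤ _))))

digits : ℕᵇ → List Bool
digits zero     = []
digits 1+[2 b ] = false ∷ digits b
digits 2[1+ b ] = true ∷ digits b

encodeBinary-digits : ∀ b → encodeBinary b ≡ encodeList encodeBool (digits b)
encodeBinary-digits zero     = refl
encodeBinary-digits 1+[2 b ] = cong (node nil) (encodeBinary-digits b)
encodeBinary-digits 2[1+ b ] = cong (node (node nil nil)) (encodeBinary-digits b)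

valueOf-digits : ∀ b → valueOf (digits b) ≡ toℕᵇ b
valueOf-digits zero     = refl
valueOf-digits 1+[2 b ] = trans (eq (valueOf (digits b))) (cong (λ v → suc (2 * v)) (valueOf-digits b))
  where
  eq : ∀ v → v + (v + 1) ≡ 1 + 2 * v
  eq = solve-∀
valueOf-digits 2[1+ b ] = trans (eq (valueOf (digits b))) (cong (λ v → 2 * suc v) (valueOf-digits b))
  where
  eq : ∀ v → v + (v + 2) ≡ 2 * (1 + v)
  eq = solve-∀

-- The algorithm on encoded instances

record Instance : Set where
  constructor instance-of
  field
    {order}   : ℕ
    graph     : Graph order
    coverSet  : Subset order
    threshold : ℤ

open Instance

inputs : Instance → Vec Tree 3
inputs x = encodeGraph (x .graph) ∷ encodeSubset (x .coverSet) ∷ encodeℤ (x .threshold) ∷ []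

-- The measure for the whole algorithm: the number of candidate states is at most its square, and
-- its base is at least 2 even for the empty graph.
scale : Instance → ℕ
scale x = (2 + x .order) ^ (2 + ∣ x .coverSet ∣)

boundᴬ : Algorithm 3
boundᴬ = applyᴬ (squareᴾ .algorithm) (argᴬ (# 1) ∷ [])

universeArguments : Vec (Algorithm 3) 2
universeArguments = applyᴬ (rangeᴾ .algorithm) (nodeᴬ nilᴬ boundᴬ ∷ []) ∷ nodeᴬ (nodeᴬ nilᴬ nilᴬ) (argᴬ (# 1)) ∷ []

prefixArguments : Vec (Algorithm 3) 2
prefixArguments = boundᴬ ∷ tailᴬ (argᴬ (# 2)) ∷ []

verticesᴬ universeOfᴬ prefixᴬ thresholdᴬ : Algorithm 3
verticesᴬ   = applyᴬ (rangeᴾ .algorithm) (argᴬ (# 1) ∷ [])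
universeOfᴬ = applyᴬ universeᴬ universeArguments
prefixᴬ     = applyᴬ takeᴬ prefixArguments
thresholdᴬ  = applyᴬ (valueᴾ .algorithm) (boundᴬ ∷ prefixᴬ ∷ [])

searchArguments : Vec (Algorithm 3) 5
searchArguments = argᴬ (# 0) ∷ argᴬ (# 1) ∷ verticesᴬ ∷ universeOfᴬ ∷ thresholdᴬ ∷ []

-- The head of an encoded integer is its sign, nonempty for negative integers, where the answer is
-- no.
searchᴬ mainᴬ : Algorithm 3
searchᴬ = applyᴬ (acceptᴾ .algorithm) searchArguments
mainᴬ   = ifᴬ (headᴬ (argᴬ (# 2))) nilᴬ searchᴬ

order≼ : order ≼ scale
order≼ = 1 , λ x → ≤-trans (≤-trans (m≤n+m (x .order) 2) (≤-trans (≤-reflexive (sym (*-identityʳ _)))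
  (^-monoʳ-≤ (2 + x .order) {1} {2 + ∣ x .coverSet ∣} (s≤s z≤n)))) (≤-trans (m≤n+m (scale x) 2) (≤-reflexive (sym (*-identityʳ _))))

square≼ : (λ x → x .order * x .order) ≼ scale
square≼ = ≼-* {μ = scale} order≼ order≼

universe≼ : (λ x → suc (x .order * x .order) ^ ∣ true ∷ x .coverSet ∣) ≼ scale
universe≼ = ≼-≤ {μ = scale} bound (≼-^ {μ = scale} ≼-refl 2)
  where
  bound : ∀ x → suc (x .order * x .order) ^ ∣ true ∷ x .coverSet ∣ ≤ scale x ^ 2
  -- Combines n² + 1 ≤ (n + 2)² with k + 1 ≤ k + 2 in the exponent.
  bound x = ≤-trans (^-monoˡ-≤ (suc k) (≤-trans (m≤m+n _ (3 + 4 * n)) (≤-reflexive (eq n))))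
    (≤-trans (≤-reflexive (^-*-assoc (2 + n) 2 (suc k)))
    (≤-trans (^-monoʳ-≤ (2 + n) (≤-trans (≤-reflexive (*-comm 2 (suc k))) (*-monoˡ-≤ 2 (n≤1+n (suc k)))))
      (≤-reflexive (sym (^-*-assoc (2 + n) (2 + k) 2)))))
    where
    n k : ℕ
    n = x .order
    k = ∣ x .coverSet ∣
    eq : ∀ n → 1 + n * n + (3 + 4 * n) ≡ (2 + n) * ((2 + n) * 1)
    eq = solve-∀

graph-feasible : Feasible inputs scale (argᴬ (# 0))
graph-feasible = feasible-arg (# 0) (≼-≤ {μ = scale}
  (λ x → size-vec (tabulate (Graph.N (x .graph))) (λ p → size-vec p size-bool))
  (≼-* {μ = scale} order≼ (≼-+ {μ = scale} (≼-const 1) (≼-* {μ = scale} order≼ (≼-const 2)))))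

cover-feasible : Feasible inputs scale (argᴬ (# 1))
cover-feasible = feasible-arg (# 1) (≼-≤ {μ = scale} (λ x → size-vec (x .coverSet) size-bool)
  (≼-* {μ = scale} order≼ (≼-const 2)))

bound-spec : ∀ x → boundᴬ .fun (inputs x) ≡ encodeUnary (x .order * x .order)
bound-spec x = square-spec (x .coverSet)

bound-feasible : Feasible inputs scale boundᴬ
bound-feasible = feasible-apply (squareᴾ .polynomial) (cover-feasible ∷ [])

vertices-feasible : Feasible inputs scale verticesᴬ
vertices-feasible = feasible-apply (rangeᴾ .polynomial) (cover-feasible ∷ [])

universeArguments-feasible : AllFeasible {ρ = inputs} {μ = scale} universeArguments
universeArguments-feasible = feasible-apply (rangeᴾ .polynomial) (feasible-node feasible-nil bound-feasible ∷ [])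
  ∷ feasible-node (feasible-node feasible-nil feasible-nil) cover-feasible ∷ []

universeArguments-spec : ∀ x → values universeArguments (inputs x) ≡
  encodeList encodeUnary (upTo (suc (x .order * x .order))) ∷ encodeVec encodeBool (true ∷ x .coverSet) ∷ []
universeArguments-spec x = cong (_∷ encodeVec encodeBool (true ∷ x .coverSet) ∷ [])
  (trans (cong (λ b → ⟦ rangeᴾ ⟧ (node nil b ∷ [])) (bound-spec x)) (range-unary (suc (x .order * x .order))))

Feasible-cong : ∀ {X : Set} {μ : X → ℕ} {n} {ρ π : X → Vec Tree n} {a} → (∀ x → ρ x ≡ π x) →
                Feasible π μ a → Feasible ρ μ a
Feasible-cong {μ = μ} {a = a} h (feasible t s) = feasible
  (≼-≤ {μ = μ} (λ x → ≤-reflexive (cong (a .time) (h x))) t)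
  (≼-≤ {μ = μ} (λ x → ≤-reflexive (cong (size ∘ a .fun) (h x))) s)

universeInputs : Instance → Vec Tree 2
universeInputs x =
  encodeList encodeUnary (upTo (suc (x .order * x .order))) ∷ encodeVec encodeBool (true ∷ x .coverSet) ∷ []

universe-feasible : Feasible universeInputs scale universeᴬ
universe-feasible = feasible-universe (λ x → suc (x .order)) (λ x → x .order * x .order) (λ x → true ∷ x .coverSet)
  (≼-≤ {μ = scale} (λ x → ≤-reflexive (cong totalSize (sym (universeArguments-spec x))))
    (argumentsSize≼ universeArguments-feasible))
  (≼-+ {μ = scale} (≼-const 1) order≼) square≼ universe≼

universeOf-feasible : Feasible inputs scale universeOfᴬ
universeOf-feasible = feasible-apply-on {ρ = inputs} {f = universeᴬ} {as = universeArguments}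
  (Feasible-cong {ρ = values universeArguments ∘ inputs} {π = universeInputs} {a = universeᴬ}
    universeArguments-spec universe-feasible)
  (argumentsTime≼ {as = universeArguments} universeArguments-feasible)

prefixInputs : Instance → Vec Tree 2
prefixInputs x = boundᴬ .fun (inputs x) ∷ tailTree (encodeℤ (x .threshold)) ∷ []

take-feasible : Feasible prefixInputs scale takeᴬ
take-feasible =
  feasible-take (λ x → boundᴬ .fun (inputs x)) (λ x → tailTree (encodeℤ (x .threshold))) (bound-feasible .size≼)

-- `feasible-apply` would demand a bound on the size of the integer. Here only the time to fetch its
-- digits enters, which is constant and covered by the 360.
prefix-feasible : Feasible inputs scale prefixᴬ
prefix-feasible = feasible-apply-on {ρ = inputs} {f = takeᴬ} {as = prefixArguments} take-feasible
  (≼-+ {μ = scale} (≼-const 40) (≼-+ {μ = scale} (bound-feasible .time≼) (≼-const 360)))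

threshold-feasible : Feasible inputs scale thresholdᴬ
threshold-feasible = feasible-apply {f = valueᴾ .algorithm} {as = boundᴬ ∷ prefixᴬ ∷ []} (valueᴾ .polynomial)
  (bound-feasible ∷ prefix-feasible ∷ [])

search-feasible : Feasible inputs scale searchᴬ
search-feasible = feasible-apply {f = acceptᴾ .algorithm} {as = searchArguments} (acceptᴾ .polynomial)
  (graph-feasible ∷ cover-feasible ∷ vertices-feasible ∷ universeOf-feasible ∷ threshold-feasible ∷ [])

main-time : mainᴬ .time ∘ inputs ≼ scale
main-time = ≼-+ {μ = scale} (≼-const 40) (≼-+ {μ = scale} (≼-const 280) (≼-+ {μ = scale} (≼-const 40)
  (search-feasible .time≼)))

module _ {n} (G : Graph n) (S : Subset n) (cover : IsTwinCover G S) where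

  private
    module Spec = SearchCorrect (tabulate (Graph.N G)) S
    open GraphSearch G S cover using (states; accept-imbalance; imbalance-accept; imbalance≤n²)

  universeOf-spec : ∀ t → universeOfᴬ .fun (inputs (instance-of G S t)) ≡ encodeList (encodeVec encodeUnary) states
  universeOf-spec t = trans (cong (universeᴬ .fun) (universeArguments-spec (instance-of G S t)))
    (universe-spec (n * n) (true ∷ S))

  main-spec-nonnegative : ∀ m ps rs → takeFold (encodeList encodeBool (digits (fromℕ m))) (encodeUnary (n * n))
      ≡ node (encodeList encodeBool rs) (encodeList encodeBool ps) → ps ++ rs ≡ digits (fromℕ m) →
    rs ≡ [] ⊎ length ps ≡ n * n →
    mainᴬ .fun (inputs (instance-of G S (+ m))) ≡ encodeBool (does (+ imbalance G ≤? + m))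
  main-spec-nonnegative m ps rs e a full = trans
    (cong₂ (λ z w → ⟦ acceptᴾ ⟧ (encodeGraph G ∷ encodeSubset S ∷ proj₁ z ∷ proj₂ z ∷ w ∷ []))
      (cong₂ _,_ (range-vec S) (universeOf-spec (+ m))) threshold≡)
    -- The capped threshold `τ` is at most `m`. Conversely, an imbalance of at most `m` is also at
    -- most n², and by `prefix-value` at most the value of the prefix.
    (trans (Spec.accept-spec states τ) (cong encodeBool (T-iff
      (λ t → T-does (+ imbalance G ≤? + m) (+≤+ (≤-trans (accept-imbalance τ t) (≤-trans (m⊓n≤n (n * n) _) ps≤m))))
      (λ t → imbalance-accept τ (⊓-glb imbalance≤n²
        (prefix-value ps rs full imbalance≤n²
          (≤-trans (drop‿+≤+ (does-T (+ imbalance G ≤? + m) t)) (≤-reflexive (sym value≡)))))))))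
    where
    τ : ℕ
    τ = n * n ⊓ valueOf ps
    value≡ : valueOf (ps ++ rs) ≡ m
    value≡ = trans (cong valueOf a) (trans (valueOf-digits (fromℕ m)) (toℕ-fromℕ m))
    ps≤m : valueOf ps ≤ m
    ps≤m = ≤-trans (valueOf-++ ps rs) (≤-reflexive value≡)
    prefix≡ : takeᴬ .fun (boundᴬ .fun (inputs (instance-of G S (+ m))) ∷ encodeBinary (fromℕ m) ∷ [])
              ≡ encodeList encodeBool ps
    prefix≡ = trans (cong₂ (λ b d → takeᴬ .fun (b ∷ d ∷ [])) (bound-spec (instance-of G S (+ m)))
      (encodeBinary-digits (fromℕ m))) (cong tailTree e)
    threshold≡ : thresholdᴬ .fun (inputs (instance-of G S (+ m))) ≡ encodeUnary τ
    threshold≡ = trans (cong₂ (λ b p → ⟦ valueᴾ ⟧ (b ∷ p ∷ [])) (bound-spec (instance-of G S (+ m))) prefix≡)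
      (value-spec (n * n) ps)

  main-spec : ∀ t → mainᴬ .fun (inputs (instance-of G S t)) ≡ encodeBool (does (+ imbalance G ≤? t))
  main-spec -[1+ m ] = refl
  main-spec (+ m) = let ps , rs , e , a , full = take-spec (n * n) (digits (fromℕ m)) in
    main-spec-nonnegative m ps rs e a full

-- The final time bound and the computability of its two functions

^-distribʳ-* : ∀ a b c → (a * b) ^ c ≡ a ^ c * b ^ c
^-distribʳ-* a b zero    = refl
^-distribʳ-* a b (suc c) = trans (cong (a * b *_) (^-distribʳ-* a b c)) (eq a b (a ^ c) (b ^ c))
  where
  eq : ∀ a b x y → a * b * (x * y) ≡ a * x * (b * y)
  eq = solve-∀

-- As 2 + n is at most three times the maximum of 1 and n, powers of 2 + n split into a power of 3,
-- which becomes f(k), and a power of that maximum.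
scale-bound : ∀ n k D → (2 + (2 + n) ^ (2 + k)) ^ D ≤ 3 ^ ((3 + k) * D) * (1 ⊔ n) ^ ((3 + k) * D)
scale-bound n k D = begin
  (2 + (2 + n) ^ (2 + k)) ^ D               ≤⟨ ^-monoˡ-≤ D absorb ⟩
  ((2 + n) ^ (3 + k)) ^ D                   ≡⟨ ^-*-assoc (2 + n) (3 + k) D ⟩
  (2 + n) ^ ((3 + k) * D)                   ≤⟨ ^-monoˡ-≤ ((3 + k) * D) triple ⟩
  (3 * (1 ⊔ n)) ^ ((3 + k) * D)             ≡⟨ ^-distribʳ-* 3 (1 ⊔ n) ((3 + k) * D) ⟩
  3 ^ ((3 + k) * D) * (1 ⊔ n) ^ ((3 + k) * D) ∎
  where
  open ≤-Reasoning
  y : ℕ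
  y = (2 + n) ^ (2 + k)
  2≤y : 2 ≤ y
  2≤y = ≤-trans (m≤m+n 2 n) (≤-trans (≤-reflexive (sym (*-identityʳ _))) (^-monoʳ-≤ (2 + n) {1} {2 + k} (s≤s z≤n)))
  absorb : 2 + y ≤ (2 + n) ^ (3 + k)
  absorb = ≤-trans (+-monoˡ-≤ y 2≤y) (≤-trans (≤-reflexive (cong (_+_ y) (sym (+-identityʳ y)))) (*-monoˡ-≤ y (m≤m+n 2 n)))
  triple : 2 + n ≤ 3 * (1 ⊔ n)
  triple = ≤-trans (+-mono-≤ (*-monoʳ-≤ 2 (m≤m⊔n 1 n)) (m≤n⊔m 1 n)) (≤-reflexive (+-comm (2 * (1 ⊔ n)) (1 ⊔ n)))

literalᴬ : ∀ {n} → Tree → Algorithm n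
literalᴬ nil        = nilᴬ
literalᴬ (node x y) = nodeᴬ (literalᴬ x) (literalᴬ y)

literal-spec : ∀ {n} t (ρ : Vec Tree n) → literalᴬ t .fun ρ ≡ t
literal-spec nil        ρ = refl
literal-spec (node x y) ρ = cong₂ node (literal-spec x ρ) (literal-spec y ρ)

computable : ∀ {f : ℕ → ℕ} (a : Algorithm 1) → (∀ k → a .fun (encodeUnary k ∷ []) ≡ encodeUnary (f k)) → Computable f
computable a h = interpreterProgram (a .code) , λ k →
  let t , _ , d = run-interpreter (encodeUnary k ∷ []) (a .runs (encodeUnary k ∷ []))
  in t , subst (λ y → interpreterProgram (a .code) on (encodeUnary k ∷ []) returns y inTime t) (h k) d

linearᴬ : ℕ → Algorithm 1
linearᴬ D = foldᴬ (nodeᴬ nilᴬ (nodeᴬ nilᴬ (nodeᴬ nilᴬ (argᴬ (# 0))))) nilᴬ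
  (applyᴬ (appendᴾ .algorithm) (literalᴬ (encodeUnary D) ∷ argᴬ (# 1) ∷ []))

linear-spec : ∀ D k → linearᴬ D .fun (encodeUnary k ∷ []) ≡ encodeUnary ((3 + k) * D)
linear-spec D k = go (3 + k)
  where
  go : ∀ m → foldTree (λ h r → ⟦ appendᴾ ⟧ (literalᴬ (encodeUnary D) .fun (h ∷ r ∷ encodeUnary k ∷ []) ∷ r ∷ []))
               nil (encodeUnary m) ≡ encodeUnary (m * D)
  go zero    = refl
  go (suc m) = append-unary D (m * D) (literal-spec (encodeUnary D) _) (go m)

exponentialᴬ : ℕ → Algorithm 1
exponentialᴬ D = foldᴬ (linearᴬ D) (nodeᴬ nilᴬ nilᴬ)
  (applyᴬ (appendᴾ .algorithm) (argᴬ (# 1) ∷ applyᴬ (appendᴾ .algorithm)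
    (argᴬ (# 1) ∷ applyᴬ (appendᴾ .algorithm) (argᴬ (# 1) ∷ nilᴬ ∷ []) ∷ []) ∷ []))

exponential-spec : ∀ D k → exponentialᴬ D .fun (encodeUnary k ∷ []) ≡ encodeUnary (3 ^ ((3 + k) * D))
exponential-spec D k = trans (cong (foldTree triple (node nil nil)) (linear-spec D k)) (go ((3 + k) * D))
  where
  triple : Tree → Tree → Tree
  triple _ r = ⟦ appendᴾ ⟧ (r ∷ ⟦ appendᴾ ⟧ (r ∷ ⟦ appendᴾ ⟧ (r ∷ nil ∷ []) ∷ []) ∷ [])

  go : ∀ m → foldTree triple (node nil nil) (encodeUnary m) ≡ encodeUnary (3 ^ m)
  go zero    = refl
  go (suc m) = append-unary (3 ^ m) _ (go m) (append-unary (3 ^ m) _ (go m) (append-unary (3 ^ m) 0 (go m) refl))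

xp-of-algorithm : (a : Algorithm 3) → a .time ∘ inputs ≼ scale →
  (∀ {n} (G : Graph n) (S : Subset n) → IsTwinCover G S →
    ∀ t → a .fun (inputs (instance-of G S t)) ≡ encodeBool (does (+ imbalance G ≤? t))) →
  Σ[ P ∈ Program 3 ] Σ[ f ∈ (ℕ → ℕ) ] Σ[ g ∈ (ℕ → ℕ) ]
      Computable f × Computable g ×
      (∀ (n k : ℕ) (G : Graph n) (S : Subset n) (t : ℤ) →
      IsTwinCover G S → ∣ S ∣ ≡ k →
      P on (encodeGraph G ∷ encodeSubset S ∷ encodeℤ t ∷ [])
      returns encodeBool (does (+ imbalance G ≤? t))
      within (f k * (1 ⊔ n) ^ g k))
xp-of-algorithm a a≼ correct = interpreterProgram (a .code) , (λ k → 3 ^ ((3 + k) * D)) , (λ k → (3 + k) * D)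
  , computable (exponentialᴬ D) (exponential-spec D) , computable (linearᴬ D) (linear-spec D)
  , decides
  where
  -- The 6 is the `n + n` of `run-interpreter` for three inputs, from building the environment.
  total≼ : (λ x → 3 + (size (a .code) + size (a .code)) + 6 + a .time (inputs x)) ≼ scale
  total≼ = ≼-+ {μ = scale} (≼-const (3 + (size (a .code) + size (a .code)) + 6)) a≼

  D : ℕ
  D = proj₁ total≼

  decides : ∀ n k (G : Graph n) (S : Subset n) (t : ℤ) → IsTwinCover G S → ∣ S ∣ ≡ k →
    interpreterProgram (a .code) on (encodeGraph G ∷ encodeSubset S ∷ encodeℤ t ∷ [])
      returns encodeBool (does (+ imbalance G ≤? t))
      within (3 ^ ((3 + k) * D) * (1 ⊔ n) ^ ((3 + k) * D))
  decides n k G S t cover refl =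
    let s , s≤ , d = run-interpreter (inputs x) (a .runs (inputs x)) in
    s , ≤-trans s≤ (≤-trans (proj₂ total≼ x) (scale-bound n k D))
    , subst (λ y → interpreterProgram (a .code) on (inputs x) returns y inTime s) (correct G S cover t) d
    where
    x : Instance
    x = instance-of G S t

theorem2 : Σ[ P ∈ Program 3 ] Σ[ f ∈ (ℕ → ℕ) ] Σ[ g ∈ (ℕ → ℕ) ]
    Computable f × Computable g ×
    (∀ (n k : ℕ) (G : Graph n) (S : Subset n) (t : ℤ) →
    IsTwinCover G S → ∣ S ∣ ≡ k →
    P on (encodeGraph G ∷ encodeSubset S ∷ encodeℤ t ∷ [])
    returns encodeBool (does (+ imbalance G ≤? t))
    within (f k * (1 ⊔ n) ^ g k))
theorem2 = xp-of-algorithm mainᴬ main-time main-spec
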